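{- Let $S_4=\{(-1,1,3,-3),(-3,8,1,-7)\}$. If $(t_1,t_2,t_3,t_4)\in S_4$, then for all integers $n\geq 0$, $$a_{1^{t_1}2^{t_2}3^{t_3}4^{t_4}}(2n)>0,\qquad a_{1^{t_1}2^{t_2}3^{t_3}4^{t_4}}(4n+1)>0,\qquad a_{1^{t_1}2^{t_2}3^{t_3}4^{t_4}}(4n+3)<0.$$
   Context: For $|q|<1$ (or as formal power series in $q$) let $f_j:=(q^j;q^j)_\infty=\prod_{k\ge 1}(1-q^{jk})$ for each positive integer $j$. For a positive integer $m$ and integers $t_1,\dots,t_m$ (possibly zero or negative), the integers $a_{1^{t_1}2^{t_2}\cdots m^{t_m}}(n)$, $n\ge 0$, are defined by $\sum_{n=0}^\infty a_{1^{t_1}2^{t_2}\cdots m^{t_m}}(n)q^n=f_1^{t_1}f_2^{t_2}\cdots f_m^{t_m}$. -}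

module Defs where

open import Data.Bool using (if_then_else_)
open import Data.Fin using (Fin; zero; suc; toℕ)
open import Data.Fin.Properties using (toℕ<n)
open import Data.Integer using (ℤ; +_; -[1+_]; -_; _+_; _-_; _*_; 0ℤ; 1ℤ)
import Data.Integer.Properties as ℤ
open import Data.List using (List; []; _∷_)
open import Data.Nat as ℕ using (ℕ; zero; suc; _∸_; _≤_; _<_; s≤s; NonZero)
import Data.Nat.Properties as ℕ
open import Data.Vec using (Vec; []; _∷_; head; lookup)
open import Relation.Binary.PropositionalEquality
open import Relation.Nullary using (does)
open import Relation.Nullary.Decidable using (dec-false)

open import Algebra.Properties.CommutativeMonoid.Sum ℤ.+-0-commutativeMonoid
  using (sum; sum⁺-syntax; sum-cong-≗; sum-replicate-zero)

-- Formal power series over ℤ: the value at n is the coefficient of qⁿ.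
PowerSeries : Set
PowerSeries = ℕ → ℤ

infixl 6 _⊖_
infixl 7 _⊛_
infixr 8 _^ₙ_ _^_

q^_ : ℕ → PowerSeries
(q^ e) n = if does (n ℕ.≟ e) then 1ℤ else 0ℤ

𝟙 : PowerSeries
𝟙 = q^ 0

_⊖_ : PowerSeries → PowerSeries → PowerSeries
(a ⊖ b) n = a n - b n

-- The index of ∑[ k ≤ n ] ranges over Fin (suc n), that is, over 0, …, n.
_⊛_ : PowerSeries → PowerSeries → PowerSeries
(a ⊛ b) n = ∑[ k ≤ n ] (a (toℕ k) * b (n ∸ toℕ k))

-- inverses a n lists bₙ, …, b₁, b₀, where b₀ = 1 and
-- bₙ₊₁ = - (a₁ bₙ + a₂ bₙ₋₁ + ⋯ + aₙ₊₁ b₀).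
inverses : PowerSeries → (n : ℕ) → Vec ℤ (suc n)
inverses a zero    = 1ℤ ∷ []
inverses a (suc n) =
  - (∑[ k ≤ n ] (a (suc (toℕ k)) * lookup (inverses a n) k)) ∷ inverses a n

-- The multiplicative inverse of a series with constant term 1 (see
-- ⊛-inverseʳ); not meaningful for other series.
inverse : PowerSeries → PowerSeries
inverse a n = head (inverses a n)

_^ₙ_ : PowerSeries → ℕ → PowerSeries
a ^ₙ zero  = 𝟙
a ^ₙ suc n = a ⊛ (a ^ₙ n)

-- As for inverse, negative powers require the constant term to be 1.
_^_ : PowerSeries → ℤ → PowerSeries
a ^ (+ n)    = a ^ₙ n
a ^ -[1+ n ] = inverse a ^ₙ suc n

-- The product of 1 - q^(j k) over 1 ≤ k ≤ N.
partialProduct : ℕ → ℕ → PowerSeries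
partialProduct j zero    = 𝟙
partialProduct j (suc N) = (𝟙 ⊖ q^ (j ℕ.* suc N)) ⊛ partialProduct j N

-- f j = (q^j; q^j)_∞.  The coefficient of qⁿ is the same in all partial
-- products with at least n factors (see f-limit), so it is read off from
-- the one with exactly n factors.
f : (j : ℕ) .{{_ : NonZero j}} → PowerSeries
f j n = partialProduct j n n

-- f_{i+1}^{t₁} f_{i+2}^{t₂} ⋯ f_{i+m}^{tₘ}
productFrom : ∀ {m} → ℕ → Vec ℤ m → PowerSeries
productFrom i []       = 𝟙
productFrom i (t ∷ ts) = f (suc i) ^ t ⊛ productFrom (suc i) ts

-- a (t₁ ∷ ⋯ ∷ tₘ ∷ []) n is the coefficient of qⁿ in f₁^{t₁} ⋯ fₘ^{tₘ}.
a : ∀ {m} → Vec ℤ m → ℕ → ℤ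
a = productFrom 0

S₄ : List (Vec ℤ 4)
S₄ = (- + 1 ∷ + 1 ∷ + 3 ∷ - + 3 ∷ [])
   ∷ (- + 3 ∷ + 8 ∷ + 1 ∷ - + 7 ∷ [])
   ∷ []

lookup-inverses : ∀ b n (k : Fin (suc n)) →
                  lookup (inverses b n) k ≡ inverse b (n ∸ toℕ k)
lookup-inverses b zero    zero    = refl
lookup-inverses b (suc n) zero    = refl
lookup-inverses b (suc n) (suc k) = lookup-inverses b n k

⊛-inverseʳ : ∀ b → b 0 ≡ 1ℤ → b ⊛ inverse b ≗ 𝟙
⊛-inverseʳ b b₀≡1 zero    = cong (λ x → x * 1ℤ + 0ℤ) b₀≡1
⊛-inverseʳ b b₀≡1 (suc n) = begin
  b 0 * - s + ∑[ k ≤ n ] (b (suc (toℕ k)) * inverse b (n ∸ toℕ k))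
    ≡⟨ cong₂ _+_ (trans (cong (_* - s) b₀≡1) (ℤ.*-identityˡ (- s)))
                 (sum-cong-≗ λ k → cong (b (suc (toℕ k)) *_) (sym (lookup-inverses b n k))) ⟩
  - s + s
    ≡⟨ ℤ.+-inverseˡ s ⟩
  0ℤ ∎
  where
  open ≡-Reasoning
  s : ℤ
  s = ∑[ k ≤ n ] (b (suc (toℕ k)) * lookup (inverses b n) k)

f-constant : ∀ j .{{_ : NonZero j}} → f j 0 ≡ 1ℤ
f-constant j = refl

factor-⊛ : ∀ e b n → n < e → ((𝟙 ⊖ q^ e) ⊛ b) n ≡ b n
factor-⊛ (suc e) b n n<e = begin
  1ℤ * b n + sum {n} (λ k → (0ℤ - (q^ suc e) (suc (toℕ k))) * b (n ∸ suc (toℕ k)))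
    ≡⟨ cong₂ _+_ (ℤ.*-identityˡ (b n)) (trans (sum-cong-≗ vanish) (sum-replicate-zero n)) ⟩
  b n + 0ℤ
    ≡⟨ ℤ.+-identityʳ (b n) ⟩
  b n ∎
  where
  open ≡-Reasoning
  vanish : ∀ (k : Fin n) → (0ℤ - (q^ suc e) (suc (toℕ k))) * b (n ∸ suc (toℕ k)) ≡ 0ℤ
  vanish k = cong (λ z → (0ℤ - (if z then 1ℤ else 0ℤ)) * b (n ∸ suc (toℕ k)))
    (dec-false (suc (toℕ k) ℕ.≟ suc e)
      (ℕ.<⇒≢ (ℕ.≤-<-trans (toℕ<n k) n<e)))

f-limit : ∀ j .{{_ : NonZero j}} n N → n ≤ N → partialProduct j N n ≡ f j n
f-limit j n N n≤N = begin
  partialProduct j N n              ≡⟨ cong (λ M → partialProduct j M n) (ℕ.m∸n+n≡m n≤N) ⟨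
  partialProduct j (N ∸ n ℕ.+ n) n  ≡⟨ stable (N ∸ n) ⟩
  f j n                             ∎
  where
  open ≡-Reasoning
  stable : ∀ d → partialProduct j (d ℕ.+ n) n ≡ f j n
  stable zero    = refl
  stable (suc d) = trans
    (factor-⊛ (j ℕ.* suc (d ℕ.+ n)) (partialProduct j (d ℕ.+ n)) n
      (ℕ.<-≤-trans (s≤s (ℕ.m≤n+m n d)) (ℕ.m≤n*m (suc (d ℕ.+ n)) j)))
    (stable d)

{-# OPTIONS --safe #-}

-- Both eta quotients have explicit 2-dissections.  Splitting the sums for Ramanujan's
-- f(a, a g) and f(a, a g)² by parity and using Jacobi's triple product yields
--   f₃³/f₁ = f₄³f₆²/(f₂²f₁₂) + x f₁₂³/f₄   and
--   f₁² = f₄f₆⁷/(f₂f₃²f₁₂³) - 2x f₂²f₃f₁₂³/(f₁f₄f₆²)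
-- in every variable x.  The second one at x = -q, combined with the first, becomes
--   f₃/f₁³ = f₄⁶f₆³/(f₂⁹f₁₂²) + 3q f₄²f₆f₁₂²/f₂⁷,
-- and with the first one at x = q and x = q² it follows that
--   f₂f₃³/(f₁f₄³)   = f₆²/(f₂f₁₂) + q f₂f₁₂³/f₄⁴,
--   f₂⁸f₃/(f₁³f₄⁷) = f₈³/(f₄³f₂₄) + q² f₂₄³/(f₄f₈f₁₂²) + 3q f₂f₆f₁₂²/f₄⁵.
-- The summands without the factor q are products of 1/(1 - q^(2i)), after pairing factors in
-- the case of f₆²/(f₂f₁₂); the cofactors of q are products of 1 - q^(4i+2) and 1/(1 - q^(4i)),
-- so their nonzero coefficients alternate in sign.

module Submission where

-- Products of signed factors yield only weak inequalities. Strictness comes from the factors with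
-- the smallest exponent: once 1/(1 - q²), 1/(1 - q⁴) or (1 - q²)/(1 - q⁴) = 1/(1 + q²) is taken
-- out, a linear recurrence carries the nonzero constant term to every index required. The even part
-- of the second quotient is f₆³/(f₂f₄f₁₂²). Pairing factors as for f₆²/(f₂f₁₂) would leave
-- f₆/(f₄f₁₂), whose coefficient at q⁶ is -1. This is why f₆³/f₂ is dissected once more: both
-- resulting terms are reciprocals of products in q⁴, one serving the indices 4n and the other the
-- indices 4n + 2. Quotients are stated with cleared denominators. Limits are treated modulo each
-- q^K, where infinite sums and products become finite; the same ring structure serves the
-- congruences and the exact equality.

open import Defs
open import Algebra using (CommutativeMonoid; CommutativeRing)
open import Algebra.Structures using (IsCommutativeRing)
open import Data.Bool using (if_then_else_)
open import Data.Fin using (Fin; zero; suc; toℕ)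
open import Data.Fin.Properties using (toℕ<n)
open import Data.Integer as ℤ using (ℤ; +_; -[1+_]; 0ℤ; 1ℤ; -1ℤ; ∣_∣; _<_; _>_)
import Data.Integer.Properties as ℤ
open import Data.Integer.Solver using (module +-*-Solver)
import Data.Integer.Tactic.RingSolver as ℤSolver
open import Data.List.Membership.Propositional using (_∈_)
open import Data.List.Relation.Unary.Any using (here; there)
open import Data.Nat as ℕ using (ℕ; zero; suc; _∸_; _≤_; z≤n; s≤s; NonZero)
open import Data.Nat.DivMod using (_/_; _%_; m≡m%n+[m/n]*n; m%n<n)
import Data.Nat.Properties as ℕ
import Data.Nat.Tactic.RingSolver as ℕSolver
open import Data.Product using (_×_; _,_)
open import Data.Sum using (_⊎_; inj₁; inj₂; [_,_]′)
open import Data.Unit using (⊤; tt)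
open import Data.Vec using (Vec; []; _∷_)
open import Function using (_∘_)
open import Level using (0ℓ)
open import Relation.Binary.PropositionalEquality as ≡ using (_≡_; _≢_; cong; cong₂; subst)
open import Relation.Nullary using (yes; no)
open import Relation.Nullary.Decidable using (dec-true; dec-false)
open import Algebra.Properties.CommutativeMonoid.Sum ℤ.+-0-commutativeMonoid
  using (sum; sum-cong-≗; sum-replicate-zero)

-- The ring of formal power series

-- By computation `(a ⊛ b) (suc n)` is `a 0 * b (suc n)` plus `(tail a ⊛ b) n`, so laws of `⊛` go by
-- induction on the index, for all series at once.
tail : PowerSeries → PowerSeries
tail a n = a (suc n)

infixl 6 _∔_ _⊞_
infixl 7 _·_
infixl 7 _∙_

𝟘 : PowerSeries
𝟘 n = 0ℤ

_∙_ : ℤ → PowerSeries → PowerSeries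
(z ∙ a) n = z ℤ.* a n

_⊞_ : PowerSeries → PowerSeries → PowerSeries
(a ⊞ b) n = a n ℤ.+ b n

module Convolution where

  ⊛-cong-≤ : ∀ n {a a′ b b′} → (∀ k → k ≤ n → a k ≡ a′ k) → (∀ k → k ≤ n → b k ≡ b′ k) →
             (a ⊛ b) n ≡ (a′ ⊛ b′) n
  ⊛-cong-≤ n p r = sum-cong-≗ {suc n} λ k →
    cong₂ ℤ._*_ (p (toℕ k) (ℕ.≤-pred (toℕ<n k))) (r (n ∸ toℕ k) (ℕ.m∸n≤m n (toℕ k)))

  ⊛-zeroˡ : ∀ n b → (𝟘 ⊛ b) n ≡ 0ℤ
  ⊛-zeroˡ n b = ≡.trans (sum-cong-≗ {suc n} λ k → ℤ.*-zeroˡ (b (n ∸ toℕ k))) (sum-replicate-zero (suc n))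

  ⊛-distribʳ : ∀ n a b c → ((a ⊞ b) ⊛ c) n ≡ (a ⊛ c) n ℤ.+ (b ⊛ c) n
  ⊛-distribʳ zero a b c = lemma (a 0) (b 0) (c 0)
    where
    lemma : ∀ x y z → (x ℤ.+ y) ℤ.* z ℤ.+ 0ℤ ≡ x ℤ.* z ℤ.+ 0ℤ ℤ.+ (y ℤ.* z ℤ.+ 0ℤ)
    lemma = ℤSolver.solve-∀
  ⊛-distribʳ (suc n) a b c =
    ≡.trans (cong (λ u → (a 0 ℤ.+ b 0) ℤ.* c (suc n) ℤ.+ u) (⊛-distribʳ n (tail a) (tail b) c))
          (lemma (a 0) (b 0) (c (suc n)) _ _)
    where
    lemma : ∀ x y z u v →
            (x ℤ.+ y) ℤ.* z ℤ.+ (u ℤ.+ v) ≡ (x ℤ.* z ℤ.+ u) ℤ.+ (y ℤ.* z ℤ.+ v)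
    lemma = ℤSolver.solve-∀

  ∙-⊛ : ∀ n z a b → ((z ∙ a) ⊛ b) n ≡ z ℤ.* (a ⊛ b) n
  ∙-⊛ zero z a b = lemma z (a 0) (b 0)
    where
    lemma : ∀ z x y → (z ℤ.* x) ℤ.* y ℤ.+ 0ℤ ≡ z ℤ.* (x ℤ.* y ℤ.+ 0ℤ)
    lemma = ℤSolver.solve-∀
  ∙-⊛ (suc n) z a b =
    ≡.trans (cong (λ u → z ℤ.* a 0 ℤ.* b (suc n) ℤ.+ u) (∙-⊛ n z (tail a) b))
          (lemma z (a 0) (b (suc n)) _)
    where
    lemma : ∀ z x y u → (z ℤ.* x) ℤ.* y ℤ.+ z ℤ.* u ≡ z ℤ.* (x ℤ.* y ℤ.+ u)
    lemma = ℤSolver.solve-∀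

  ⊛-assoc : ∀ n a b c → ((a ⊛ b) ⊛ c) n ≡ (a ⊛ (b ⊛ c)) n
  ⊛-assoc zero a b c = lemma (a 0) (b 0) (c 0)
    where
    lemma : ∀ x y z → (x ℤ.* y ℤ.+ 0ℤ) ℤ.* z ℤ.+ 0ℤ ≡ x ℤ.* (y ℤ.* z ℤ.+ 0ℤ) ℤ.+ 0ℤ
    lemma = ℤSolver.solve-∀
  ⊛-assoc (suc n) a b c = begin
    -- The tail of `a ⊛ b` is `a 0 ∙ tail b ⊞ tail a ⊛ b` by computation.
    (a ⊛ b) 0 ℤ.* c (suc n) ℤ.+ ((a 0 ∙ tail b ⊞ tail a ⊛ b) ⊛ c) n
      ≡⟨ cong (λ u → (a ⊛ b) 0 ℤ.* c (suc n) ℤ.+ u)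
           (≡.trans (⊛-distribʳ n (a 0 ∙ tail b) (tail a ⊛ b) c)
                  (cong₂ ℤ._+_ (∙-⊛ n (a 0) (tail b) c) (⊛-assoc n (tail a) b c))) ⟩
    (a ⊛ b) 0 ℤ.* c (suc n) ℤ.+ (a 0 ℤ.* (tail b ⊛ c) n ℤ.+ (tail a ⊛ (b ⊛ c)) n)
      ≡⟨ lemma (a 0) (b 0) (c (suc n)) _ _ ⟩
    a 0 ℤ.* (b ⊛ c) (suc n) ℤ.+ (tail a ⊛ (b ⊛ c)) n ∎
    where
    open ≡.≡-Reasoning
    lemma : ∀ x y z u v → (x ℤ.* y ℤ.+ 0ℤ) ℤ.* z ℤ.+ (x ℤ.* u ℤ.+ v) ≡
                          x ℤ.* (y ℤ.* z ℤ.+ u) ℤ.+ v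
    lemma = ℤSolver.solve-∀

  -- Mirror image of the unfolding by computation: it splits off the last summand instead of the
  -- first, which is what commutativity needs.
  ⊛-tailʳ : ∀ n a b → (a ⊛ b) (suc n) ≡ (a ⊛ tail b) n ℤ.+ a (suc n) ℤ.* b 0
  ⊛-tailʳ zero a b = lemma (a 0) (b 1) (a 1) (b 0)
    where
    lemma : ∀ x y z w → x ℤ.* y ℤ.+ (z ℤ.* w ℤ.+ 0ℤ) ≡ (x ℤ.* y ℤ.+ 0ℤ) ℤ.+ z ℤ.* w
    lemma = ℤSolver.solve-∀
  ⊛-tailʳ (suc n) a b =
    ≡.trans (cong (λ u → a 0 ℤ.* b (suc (suc n)) ℤ.+ u) (⊛-tailʳ n (tail a) b))
          (≡.sym (ℤ.+-assoc (a 0 ℤ.* b (suc (suc n))) _ _))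

  ⊛-comm : ∀ n a b → (a ⊛ b) n ≡ (b ⊛ a) n
  ⊛-comm zero a b = cong (ℤ._+ 0ℤ) (ℤ.*-comm (a 0) (b 0))
  ⊛-comm (suc n) a b = begin
    a 0 ℤ.* b (suc n) ℤ.+ (tail a ⊛ b) n  ≡⟨ ℤ.+-comm (a 0 ℤ.* b (suc n)) _ ⟩
    (tail a ⊛ b) n ℤ.+ a 0 ℤ.* b (suc n)  ≡⟨ cong₂ ℤ._+_ (⊛-comm n (tail a) b) (ℤ.*-comm (a 0) _) ⟩
    (b ⊛ tail a) n ℤ.+ b (suc n) ℤ.* a 0  ≡⟨ ⊛-tailʳ n b a ⟨
    (b ⊛ a) (suc n)                       ∎
    where open ≡.≡-Reasoning

  ⊛-identityˡ : ∀ n a → (𝟙 ⊛ a) n ≡ a n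
  ⊛-identityˡ zero a = ≡.trans (ℤ.+-identityʳ _) (ℤ.*-identityˡ (a 0))
  ⊛-identityˡ (suc n) a =
    ≡.trans (cong₂ ℤ._+_ (ℤ.*-identityˡ (a (suc n))) (⊛-zeroˡ n a)) (ℤ.+-identityʳ _)

  q^suc-⊛ : ∀ n e a → (q^ suc e ⊛ a) (suc n) ≡ (q^ e ⊛ a) n
  q^suc-⊛ n e a = ≡.trans (cong (ℤ._+ (q^ e ⊛ a) n) (ℤ.*-zeroˡ (a (suc n)))) (ℤ.+-identityˡ _)

  q^-homo : ∀ n d e → (q^ (d ℕ.+ e)) n ≡ (q^ d ⊛ q^ e) n
  q^-homo n       zero    e = ≡.sym (⊛-identityˡ n (q^ e))
  q^-homo zero    (suc d) e = ≡.sym (≡.trans (ℤ.+-identityʳ _) (ℤ.*-zeroˡ ((q^ e) 0)))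
  q^-homo (suc n) (suc d) e = ≡.trans (q^-homo n d e) (≡.sym (q^suc-⊛ n d (q^ e)))

opaque
  -- Opaque copies, so that long products stay symbolic and are never compared by unfolding them to
  -- finite sums.
  _·_ _∔_ : PowerSeries → PowerSeries → PowerSeries
  _·_ = _⊛_
  _∔_ = _⊞_

  neg : PowerSeries → PowerSeries
  neg a n = ℤ.- a n

-- Equality of the coefficients with index in P.  For P = (_< K) this is
-- congruence modulo q^K.
record _≈[_]_ (a : PowerSeries) (P : ℕ → Set) (b : PowerSeries) : Set where
  constructor ⟨_⟩
  field
    at : ∀ n → P n → a n ≡ b n
open _≈[_]_ public

infix 4 _≈[_]_

-- A coefficient of a product involves all lower coefficients of the factors, so this is the
-- condition under which agreement on P is a congruence for products.
DownClosed : (ℕ → Set) → Set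
DownClosed P = ∀ {m n} → m ≤ n → P n → P m

opaque
  unfolding _·_ _∔_ neg

  isCommutativeRing : (P : ℕ → Set) → DownClosed P →
                      IsCommutativeRing (_≈[ P ]_) _∔_ _·_ neg 𝟘 𝟙
  isCommutativeRing P down = record
    { isRing = record
      { +-isAbelianGroup = record
        { isGroup = record
          { isMonoid = record
            { isSemigroup = record
              { isMagma = record
                { isEquivalence = record
                  { refl  = ⟨ (λ _ _ → ≡.refl) ⟩
                  ; sym   = λ p → ⟨ (λ n k → ≡.sym (at p n k)) ⟩
                  ; trans = λ p r → ⟨ (λ n k → ≡.trans (at p n k) (at r n k)) ⟩
                  }
                ; ∙-cong = λ p r → ⟨ (λ n k → cong₂ ℤ._+_ (at p n k) (at r n k)) ⟩
                }
              ; assoc = λ a b c → ⟨ (λ n _ → ℤ.+-assoc (a n) (b n) (c n)) ⟩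
              }
            ; identity = (λ a → ⟨ (λ n _ → ℤ.+-identityˡ (a n)) ⟩)
                       , (λ a → ⟨ (λ n _ → ℤ.+-identityʳ (a n)) ⟩)
            }
          ; inverse = (λ a → ⟨ (λ n _ → ℤ.+-inverseˡ (a n)) ⟩)
                    , (λ a → ⟨ (λ n _ → ℤ.+-inverseʳ (a n)) ⟩)
          ; ⁻¹-cong = λ p → ⟨ (λ n k → cong ℤ.-_ (at p n k)) ⟩
          }
        ; comm = λ a b → ⟨ (λ n _ → ℤ.+-comm (a n) (b n)) ⟩
        }
      ; *-cong = λ p r → ⟨ (λ n k → ⊛-cong-≤ n (λ m m≤n → at p m (down m≤n k))
                                               (λ m m≤n → at r m (down m≤n k))) ⟩
      ; *-assoc = λ a b c → ⟨ (λ n _ → ⊛-assoc n a b c) ⟩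
      ; *-identity = (λ a → ⟨ (λ n _ → ⊛-identityˡ n a) ⟩)
                   , (λ a → ⟨ (λ n _ → ≡.trans (⊛-comm n a 𝟙) (⊛-identityˡ n a)) ⟩)
      ; distrib = (λ a b c → ⟨ (λ n _ → ≡.trans (⊛-comm n a (b ∔ c))
                                 (≡.trans (⊛-distribʳ n b c a)
                                   (cong₂ ℤ._+_ (⊛-comm n b a) (⊛-comm n c a)))) ⟩)
                , (λ a b c → ⟨ (λ n _ → ⊛-distribʳ n b c a) ⟩)
      }
    ; *-comm = λ a b → ⟨ (λ n _ → ⊛-comm n a b) ⟩
    }
    where open Convolution

ring : (P : ℕ → Set) → DownClosed P → CommutativeRing 0ℓ 0ℓ
ring P down = record { isCommutativeRing = isCommutativeRing P down }

-- Bilateral sums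

-- Defined by cases rather than as j + 1, so that `tri (succ j)` reduces once j is a constructor.
succ : ℤ → ℤ
succ (+ n)          = + suc n
succ -[1+ zero ]    = + 0
succ -[1+ suc n ]   = -[1+ n ]

-- The reflection j ↦ -1 - j. It preserves `size` and swaps the two terms that each stage of `sumℤ`
-- adds.
flip : ℤ → ℤ
flip (+ n)    = -[1+ n ]
flip -[1+ n ] = + n

-- The interval [-B, B) consists of the j with size j < B.
size : ℤ → ℕ
size (+ n)    = n
size -[1+ n ] = n

succ-+ : ∀ j → succ j ≡ j ℤ.+ 1ℤ
succ-+ (+ n)        = cong +_ (ℕ.+-comm 1 n)
succ-+ -[1+ zero ]  = ≡.refl
succ-+ -[1+ suc n ] = ≡.refl

flip-- : ∀ j → flip j ≡ ℤ.- (succ j)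
flip-- (+ n)        = ≡.refl
flip-- -[1+ zero ]  = ≡.refl
flip-- -[1+ suc n ] = ≡.refl

size-succ : ∀ j → size j ≤ suc (size (succ j))
size-succ (+ n)        = ℕ.≤-trans (ℕ.n≤1+n n) (ℕ.n≤1+n (suc n))
size-succ -[1+ zero ]  = z≤n
size-succ -[1+ suc n ] = ℕ.≤-refl

size-pred : ∀ j → size j ≤ suc (size (j ℤ.- 1ℤ))
size-pred (+ zero)   = z≤n
size-pred (+ suc n)  = ℕ.≤-refl
size-pred -[1+ n ]   = ℕ.≤-trans (ℕ.n≤1+n n) (ℕ.s≤s (ℕ.≤-trans (ℕ.n≤1+n n) (ℕ.s≤s (ℕ.m≤m+n n 0))))

∣-∣≤ : ∀ {B} j → size j ℕ.< B → ∣ ℤ.- j ∣ ≤ B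
∣-∣≤ (+ zero)  p = z≤n
∣-∣≤ (+ suc n) p = ℕ.<⇒≤ p
∣-∣≤ -[1+ n ]  p = p

∣∣≤ : ∀ {B} j → size j ℕ.< B → ∣ j ∣ ≤ B
∣∣≤ j p = subst (_≤ _) (ℤ.∣-i∣≡∣i∣ j) (∣-∣≤ j p)

∣succ∣≤ : ∀ {B} j → size j ℕ.< B → ∣ succ j ∣ ≤ B
∣succ∣≤ (+ n)        p = p
∣succ∣≤ -[1+ zero ]  p = z≤n
∣succ∣≤ -[1+ suc n ] p = ℕ.<⇒≤ p

module BilateralSum {c} {C : Set c} (_+_ : C → C → C) (0# : C) where

  sumℤ : ℕ → (ℤ → C) → C
  sumℤ zero    g = 0#
  sumℤ (suc B) g = sumℤ B g + (g (+ B) + g -[1+ B ])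

module Bilateral {c ℓ} (M : CommutativeMonoid c ℓ) where
  open CommutativeMonoid M renaming (_∙_ to _+_; ε to 0#; ∙-cong to +-cong; ∙-congˡ to +-congˡ
    ; ∙-congʳ to +-congʳ; identityˡ to +-identityˡ; identityʳ to +-identityʳ; assoc to +-assoc; comm
        to +-comm)
  open import Algebra.Properties.CommutativeSemigroup commutativeSemigroup using (interchange)
  open import Algebra.Solver.CommutativeMonoid M using (solve; _⊕_; _⊜_)
  open import Relation.Binary.Reasoning.Setoid setoid

  open BilateralSum _+_ 0#

  -- In use `≈` is congruence modulo q^K, so that the terms of a convergent bilateral series have
  -- finite support in this sense.
  Supported : ℕ → (ℤ → Carrier) → Set ℓ
  Supported B g = ∀ j → B ≤ size j → g j ≈ 0#

  sumℤ-cong : ∀ B {g h} → (∀ j → size j ℕ.< B → g j ≈ h j) → sumℤ B g ≈ sumℤ B h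
  sumℤ-cong zero    p = refl
  sumℤ-cong (suc B) p = +-cong (sumℤ-cong B λ j j<B → p j (ℕ.m<n⇒m<1+n j<B))
                               (+-cong (p (+ B) ℕ.≤-refl) (p -[1+ B ] ℕ.≤-refl))

  sumℤ-0 : ∀ B → sumℤ B (λ _ → 0#) ≈ 0#
  sumℤ-0 zero    = refl
  sumℤ-0 (suc B) = trans (+-cong (sumℤ-0 B) (+-identityˡ 0#)) (+-identityˡ 0#)

  sumℤ-+ : ∀ B g h → sumℤ B (λ j → g j + h j) ≈ sumℤ B g + sumℤ B h
  sumℤ-+ zero    g h = sym (+-identityˡ 0#)
  sumℤ-+ (suc B) g h = trans (+-cong (sumℤ-+ B g h) (interchange _ _ _ _)) (interchange _ _ _ _)

  sumℤ-swap : ∀ B C (G : ℤ → ℤ → Carrier) →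
              sumℤ B (λ i → sumℤ C (G i)) ≈ sumℤ C (λ j → sumℤ B (λ i → G i j))
  sumℤ-swap zero    C G = sym (sumℤ-0 C)
  sumℤ-swap (suc B) C G = begin
    sumℤ B (λ i → sumℤ C (G i)) + (sumℤ C (G (+ B)) + sumℤ C (G -[1+ B ]))
      ≈⟨ +-cong (sumℤ-swap B C G) (sym (sumℤ-+ C (G (+ B)) (G -[1+ B ]))) ⟩
    sumℤ C (λ j → sumℤ B (λ i → G i j)) + sumℤ C (λ j → G (+ B) j + G -[1+ B ] j)
      ≈⟨ sumℤ-+ C _ _ ⟨
    sumℤ C (λ j → sumℤ (suc B) (λ i → G i j)) ∎

  sumℤ-stable : ∀ {B g} → Supported B g → ∀ k → sumℤ (k ℕ.+ B) g ≈ sumℤ B g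
  sumℤ-stable         p zero    = refl
  sumℤ-stable {B} {g} p (suc k) = begin
    sumℤ (k ℕ.+ B) g + (g (+ (k ℕ.+ B)) + g -[1+ k ℕ.+ B ])
      ≈⟨ +-cong (sumℤ-stable p k) (+-cong (p (+ (k ℕ.+ B)) (ℕ.m≤n+m B k)) (p -[1+ k ℕ.+ B ] (ℕ.m≤n+m B k))) ⟩
    sumℤ B g + (0# + 0#)  ≈⟨ +-congˡ (+-identityˡ 0#) ⟩
    sumℤ B g + 0#         ≈⟨ +-identityʳ _ ⟩
    sumℤ B g              ∎

  sumℤ-flip : ∀ B g → sumℤ B (g ∘ flip) ≈ sumℤ B g
  sumℤ-flip zero    g = refl
  sumℤ-flip (suc B) g = +-cong (sumℤ-flip B g) (+-comm _ _)

  -- The shift moves the window [-B, B) to [-B + 1, B + 1); the two extra terms are the end points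
  -- lost and gained.
  sumℤ-succ-exact : ∀ B g → sumℤ B (g ∘ succ) + g (ℤ.- (+ B)) ≈ sumℤ B g + g (+ B)
  sumℤ-succ-exact zero    g = refl
  sumℤ-succ-exact (suc B) g = begin
    sumℤ B (g ∘ succ) + (g (+ suc B) + g (succ -[1+ B ])) + g -[1+ B ]
      ≡⟨ cong (λ j → sumℤ B (g ∘ succ) + (g (+ suc B) + g j) + g -[1+ B ]) (succ-neg B) ⟩
    sumℤ B (g ∘ succ) + (g (+ suc B) + g (ℤ.- (+ B))) + g -[1+ B ]
      ≈⟨ solve 4 (λ a b c d → (a ⊕ (b ⊕ c)) ⊕ d ⊜ ((a ⊕ c) ⊕ d) ⊕ b) refl _ _ _ _ ⟩
    sumℤ B (g ∘ succ) + g (ℤ.- (+ B)) + g -[1+ B ] + g (+ suc B)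
      ≈⟨ +-congʳ (trans (+-congʳ (sumℤ-succ-exact B g)) (+-assoc _ _ _)) ⟩
    sumℤ B g + (g (+ B) + g -[1+ B ]) + g (+ suc B) ∎
    where
    succ-neg : ∀ B → succ -[1+ B ] ≡ ℤ.- (+ B)
    succ-neg zero    = ≡.refl
    succ-neg (suc B) = ≡.refl

  sumℤ-succ : ∀ {B g} → Supported B g → ∀ C → B ℕ.< C → sumℤ C (g ∘ succ) ≈ sumℤ C g
  sumℤ-succ {B} {g} p (suc C) (s≤s B≤C) = begin
    sumℤ (suc C) (g ∘ succ)               ≈⟨ +-identityʳ _ ⟨
    sumℤ (suc C) (g ∘ succ) + 0#          ≈⟨ +-congˡ (p -[1+ C ] B≤C) ⟨
    sumℤ (suc C) (g ∘ succ) + g -[1+ C ]  ≈⟨ sumℤ-succ-exact (suc C) g ⟩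
    sumℤ (suc C) g + g (+ suc C)          ≈⟨ +-congˡ (p (+ suc C) (ℕ.m≤n⇒m≤1+n B≤C)) ⟩
    sumℤ (suc C) g + 0#                   ≈⟨ +-identityʳ _ ⟩
    sumℤ (suc C) g                        ∎

  sumℤ-stable-≤ : ∀ {B g} → Supported B g → ∀ {C} → B ≤ C → sumℤ C g ≈ sumℤ B g
  sumℤ-stable-≤ {B} {g} p {C} B≤C =
    trans (reflexive (cong (λ C → sumℤ C g) (≡.sym (ℕ.m∸n+n≡m B≤C)))) (sumℤ-stable p (C ℕ.∸ B))

  private
    shift⁺ : ∀ k {B g} → Supported B g → ∀ C → k ℕ.+ B ≤ C → sumℤ C (λ j → g (j ℤ.+ + k)) ≈ sumℤ B g
    shift⁺ zero {B} {g} p C h = trans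
      (sumℤ-cong C λ j _ → reflexive (cong g (ℤ.+-identityʳ j))) (sumℤ-stable-≤ p h)
    shift⁺ (suc k) {B} {g} p C h = begin
      sumℤ C (λ j → g (j ℤ.+ + suc k))
        ≈⟨ sumℤ-cong C (λ j _ → reflexive (cong g
             (≡.trans (≡.sym (≡.trans (ℤ.+-assoc j (+ k) 1ℤ)
                 (cong (λ i → j ℤ.+ + i) (ℕ.+-comm k 1)))) (≡.sym (succ-+ (j ℤ.+ + k)))))) ⟩
      sumℤ C (λ j → g (succ (j ℤ.+ + k)))
        ≈⟨ shift⁺ k {suc B} {g ∘ succ} (λ j q → p (succ j) (ℕ.≤-pred (ℕ.≤-trans q (size-succ j)))) C
             (ℕ.≤-trans (ℕ.≤-reflexive (ℕ.+-suc k B)) h) ⟩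
      sumℤ (suc B) (g ∘ succ)
        ≈⟨ sumℤ-succ p (suc B) ℕ.≤-refl ⟩
      sumℤ (suc B) g
        ≈⟨ sumℤ-stable p 1 ⟩
      sumℤ B g ∎

    shift⁻ : ∀ k {B g} → Supported B g → ∀ C → k ℕ.+ B ≤ C → sumℤ C (λ j → g (j ℤ.- + k)) ≈ sumℤ B g
    shift⁻ zero p C h = shift⁺ zero p C h
    shift⁻ (suc k) {B} {g} p C h = begin
      sumℤ C (λ j → g (j ℤ.- + suc k))
        ≈⟨ sumℤ-cong C (λ j _ → reflexive (cong g (lemma j (+ k)))) ⟩
      sumℤ C (λ j → g′ (j ℤ.- + k))
        ≈⟨ shift⁻ k {suc B} {g′} p′ C (ℕ.≤-trans (ℕ.≤-reflexive (ℕ.+-suc k B)) h) ⟩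
      sumℤ (suc B) g′
        ≈⟨ sumℤ-stable p′ 1 ⟨
      sumℤ (suc (suc B)) g′
        ≈⟨ sumℤ-succ p′ (suc (suc B)) ℕ.≤-refl ⟨
      sumℤ (suc (suc B)) (g′ ∘ succ)
        ≈⟨ sumℤ-cong (suc (suc B)) (λ j _ → reflexive
            (cong g (≡.trans (cong (ℤ._- 1ℤ) (succ-+ j)) (lemma₂ j)))) ⟩
      sumℤ (suc (suc B)) g
        ≈⟨ sumℤ-stable p 2 ⟩
      sumℤ B g ∎
      where
      g′ : ℤ → Carrier
      g′ j = g (j ℤ.- 1ℤ)
      p′ : Supported (suc B) g′
      p′ j q = p (j ℤ.- 1ℤ) (ℕ.≤-pred (ℕ.≤-trans q (size-pred j)))
      lemma : ∀ i k → i ℤ.- (1ℤ ℤ.+ k) ≡ (i ℤ.- k) ℤ.- 1ℤ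
      lemma = ℤSolver.solve-∀
      lemma₂ : ∀ i → (i ℤ.+ 1ℤ) ℤ.- 1ℤ ≡ i
      lemma₂ = ℤSolver.solve-∀

  -- Enlarging the window by C ≥ ∣i∣ on both sides keeps the translated support inside it.
  sumℤ-shift : ∀ {B g} → Supported B g → ∀ i {C} → ∣ i ∣ ≤ C → sumℤ (C ℕ.+ B) (λ j → g (j ℤ.+ i)) ≈ sumℤ B g
  sumℤ-shift p (+ k)    h = shift⁺ k p _ (ℕ.+-monoˡ-≤ _ h)
  sumℤ-shift p -[1+ k ] h = shift⁻ (suc k) p _ (ℕ.+-monoˡ-≤ _ h)

  -- - j = flip (succ⁻¹ j), so the sum over - j is a shift of the sum over flip j.
  sumℤ-neg : ∀ {B g} → Supported B g → sumℤ (2 ℕ.+ B) (λ j → g (ℤ.- j)) ≈ sumℤ B g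
  sumℤ-neg {B} {g} p = begin
    sumℤ (2 ℕ.+ B) g⁻             ≈⟨ sumℤ-succ p⁻ (2 ℕ.+ B) ℕ.≤-refl ⟨
    sumℤ (2 ℕ.+ B) (g⁻ ∘ succ)    ≈⟨ sumℤ-cong (2 ℕ.+ B) (λ j _ → reflexive (cong g (≡.sym (flip-- j)))) ⟩
    sumℤ (2 ℕ.+ B) (g ∘ flip)     ≈⟨ sumℤ-flip (2 ℕ.+ B) g ⟩
    sumℤ (2 ℕ.+ B) g              ≈⟨ sumℤ-stable p 2 ⟩
    sumℤ B g                      ∎
    where
    g⁻ : ℤ → Carrier
    g⁻ j = g (ℤ.- j)
    p⁻ : Supported (suc B) g⁻
    p⁻ (+ suc n) q = p -[1+ n ] (ℕ.≤-pred q)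
    p⁻ -[1+ n ]  q = p (+ suc n) (ℕ.≤-trans (ℕ.n≤1+n B) (ℕ.m≤n⇒m≤1+n q))

  sumℤ-parity : ∀ B g → sumℤ (B ℕ.+ B) g ≈
                sumℤ B (λ j → g (j ℤ.+ j)) + sumℤ B (λ j → g (succ (j ℤ.+ j)))
  sumℤ-parity zero    g = sym (+-identityˡ 0#)
  sumℤ-parity (suc B) g = begin
    sumℤ (suc B ℕ.+ suc B) g
      ≡⟨ cong (λ C → sumℤ (suc C) g) (ℕ.+-suc B B) ⟩
    sumℤ (B ℕ.+ B) g + (g (+ (B ℕ.+ B)) + g -[1+ B ℕ.+ B ]) + (g (+ suc (B ℕ.+ B)) + g -[1+ suc (B ℕ.+ B) ])
      ≈⟨ +-congʳ (+-congʳ (sumℤ-parity B g)) ⟩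
    sumℤ B (λ j → g (j ℤ.+ j)) + sumℤ B (λ j → g (succ (j ℤ.+ j)))
      + (g (+ (B ℕ.+ B)) + g -[1+ B ℕ.+ B ]) + (g (+ suc (B ℕ.+ B)) + g -[1+ suc (B ℕ.+ B) ])
      -- Of the negative indices `-[1+ B ℕ.+ B ]` is the odd one and `-[1+ suc (B ℕ.+ B) ]` the even
      -- one, so d and f change places.
      ≈⟨ solve 6 (λ a b c d e f → ((a ⊕ b) ⊕ (c ⊕ d)) ⊕ (e ⊕ f) ⊜ (a ⊕ (c ⊕ f)) ⊕ (b ⊕ (e ⊕ d)))
          refl _ _ _ _ _ _ ⟩
    sumℤ (suc B) (λ j → g (j ℤ.+ j)) + sumℤ (suc B) (λ j → g (succ (j ℤ.+ j))) ∎

  -- Substitution m = s + d, n = s - d if m + n is even, m = s + d + 1, n = s - d if it is odd.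
  sumℤ²-parity : ∀ {B} {G : ℤ → ℤ → Carrier} →
    (∀ i j → B ≤ size i ⊎ B ≤ size j → G i j ≈ 0#) →
    sumℤ B (λ i → sumℤ B (G i)) ≈
      sumℤ B (λ s → sumℤ (B ℕ.+ B) (λ d → G (s ℤ.+ d) (s ℤ.- d)))
      + sumℤ B (λ s → sumℤ (B ℕ.+ B) (λ d → G (succ (s ℤ.+ d)) (s ℤ.- d)))
  sumℤ²-parity {B} {G} p = begin
    sumℤ B (λ i → sumℤ B (G i))
      -- The inner sum is reindexed by r = i + j. Since ∣i∣ ≤ B, the window `B ℕ.+ B` is large
      -- enough, and it is one that `sumℤ-parity` can split.
      ≈⟨ sumℤ-cong B (λ i i<B → sumℤ-shift (λ j q → p i j (inj₂ q)) (ℤ.- i) (∣-∣≤ i i<B)) ⟨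
    sumℤ B (λ i → sumℤ (B ℕ.+ B) (λ r → G i (r ℤ.- i)))
      ≈⟨ sumℤ-swap B (B ℕ.+ B) (λ i r → G i (r ℤ.- i)) ⟩
    sumℤ (B ℕ.+ B) (λ r → sumℤ B (λ i → G i (r ℤ.- i)))
      ≈⟨ sumℤ-parity B _ ⟩
    sumℤ B (λ s → sumℤ B (λ i → G i (s ℤ.+ s ℤ.- i))) + sumℤ B
        (λ s → sumℤ B (λ i → G i (succ (s ℤ.+ s) ℤ.- i)))
      -- Now r = 2s or r = 2s + 1, and i is replaced by d + s or d + s + 1 respectively.
      ≈⟨ +-cong (sumℤ-cong B λ s s<B → sym (sumℤ-shift (λ i q → p i _ (inj₁ q)) s (∣∣≤ s s<B)))
                (sumℤ-cong B λ s s<B → sym (sumℤ-shift (λ i q → p i _ (inj₁ q)) (succ s) (∣succ∣≤ s s<B))) ⟩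
    sumℤ B (λ s → sumℤ (B ℕ.+ B) (λ d → G (d ℤ.+ s) (s ℤ.+ s ℤ.- (d ℤ.+ s))))
      + sumℤ B (λ s → sumℤ (B ℕ.+ B) (λ d → G (d ℤ.+ succ s) (succ (s ℤ.+ s) ℤ.- (d ℤ.+ succ s))))
      ≈⟨ +-cong (sumℤ-cong B λ s _ → sumℤ-cong (B ℕ.+ B) λ d _ → reflexive
          (cong₂ G (ℤ.+-comm d s) (even s d)))
                (sumℤ-cong B λ s _ → sumℤ-cong (B ℕ.+ B) λ d _ → reflexive (cong₂ G
                  (≡.trans (cong (λ x → d ℤ.+ x) (succ-+ s)) (≡.trans (odd₁ s d) (≡.sym (succ-+ (s ℤ.+ d)))))
                  (≡.trans (cong₂ (λ x y → x ℤ.- (d ℤ.+ y)) (succ-+ (s ℤ.+ s)) (succ-+ s)) (odd₂ s d)))) ⟩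
    sumℤ B (λ s → sumℤ (B ℕ.+ B) (λ d → G (s ℤ.+ d) (s ℤ.- d)))
      + sumℤ B (λ s → sumℤ (B ℕ.+ B) (λ d → G (succ (s ℤ.+ d)) (s ℤ.- d))) ∎
    where
    even : ∀ s d → s ℤ.+ s ℤ.- (d ℤ.+ s) ≡ s ℤ.- d
    even = ℤSolver.solve-∀
    odd₁ : ∀ s d → d ℤ.+ (s ℤ.+ 1ℤ) ≡ s ℤ.+ d ℤ.+ 1ℤ
    odd₁ = ℤSolver.solve-∀
    odd₂ : ∀ s d → s ℤ.+ s ℤ.+ 1ℤ ℤ.- (d ℤ.+ (s ℤ.+ 1ℤ)) ≡ s ℤ.- d
    odd₂ = ℤSolver.solve-∀

-- Limits and infinite products

infixr 8 _↑_
_↑_ : PowerSeries → ℕ → PowerSeries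
a ↑ zero  = 𝟙
a ↑ suc n = a · a ↑ n

prod : ℕ → (ℕ → PowerSeries) → PowerSeries
prod zero    g = 𝟙
prod (suc L) g = prod L g · g L

sumℕ : ℕ → (ℕ → PowerSeries) → PowerSeries
sumℕ zero    g = 𝟘
sumℕ (suc L) g = sumℕ L g ∔ g L

open BilateralSum _∔_ 𝟘 public

module On (P : ℕ → Set) (down : DownClosed P) where
  open CommutativeRing (ring P down) public
    using (refl; sym; trans; reflexive; setoid; +-cong; +-congˡ; +-congʳ; *-cong; *-congˡ; *-congʳ;
           +-assoc; +-comm; +-identityˡ; +-identityʳ; *-assoc; *-comm; *-identityˡ; *-identityʳ;
           zeroˡ; zeroʳ; distribˡ; distribʳ; -‿inverseˡ; -‿inverseʳ; -‿cong;
           commutativeSemiring; *-commutativeMonoid; +-commutativeMonoid; _≈_)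
  open import Relation.Binary.Reasoning.Setoid setoid public
  open import Algebra.Properties.Ring (CommutativeRing.ring (ring P down)) public
    using (-‿distribˡ-*; -‿distribʳ-*; -‿involutive)
  module CM = CommutativeMonoid *-commutativeMonoid
  open import Algebra.Properties.CommutativeSemigroup CM.commutativeSemigroup public
    using () renaming (interchange to *-interchange)
  open import Algebra.Properties.CommutativeSemigroup
    (CommutativeMonoid.commutativeSemigroup +-commutativeMonoid) public
    using () renaming (interchange to +-interchange)
  module Solve where
    open import Algebra.Solver.Ring.NaturalCoefficients.Default commutativeSemiring public
  module SolveMonoid where
    open import Algebra.Solver.CommutativeMonoid *-commutativeMonoid public

  ↑-cong : ∀ {a b} n → a ≈ b → a ↑ n ≈ b ↑ n
  ↑-cong zero    p = refl
  ↑-cong (suc n) p = *-cong p (↑-cong n p)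

  ↑-≡ : ∀ a {m n} → m ≡ n → a ↑ m ≈ a ↑ n
  ↑-≡ a p = reflexive (cong (a ↑_) p)

  ↑-+ : ∀ a m n → a ↑ (m ℕ.+ n) ≈ a ↑ m · a ↑ n
  ↑-+ a zero    n = sym (*-identityˡ _)
  ↑-+ a (suc m) n = trans (*-congˡ (↑-+ a m n)) (sym (*-assoc _ _ _))

  ↑-* : ∀ a m n → (a ↑ m) ↑ n ≈ a ↑ (n ℕ.* m)
  ↑-* a m zero    = refl
  ↑-* a m (suc n) = trans (*-congˡ (↑-* a m n)) (sym (↑-+ a m (n ℕ.* m)))

  ↑-· : ∀ a b n → (a · b) ↑ n ≈ a ↑ n · b ↑ n
  ↑-· a b zero    = sym (*-identityˡ _)
  ↑-· a b (suc n) = trans (*-congˡ (↑-· a b n)) (*-interchange _ _ _ _)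

  ↑-1 : ∀ a → a ↑ 1 ≈ a
  ↑-1 a = *-identityʳ a

  𝟙↑ : ∀ n → 𝟙 ↑ n ≈ 𝟙
  𝟙↑ zero    = refl
  𝟙↑ (suc n) = trans (*-identityˡ _) (𝟙↑ n)

  prod-cong : ∀ L {g h} → (∀ k → k ℕ.< L → g k ≈ h k) → prod L g ≈ prod L h
  prod-cong zero    p = refl
  prod-cong (suc L) p = *-cong (prod-cong L λ k q → p k (ℕ.m<n⇒m<1+n q)) (p L ℕ.≤-refl)

  prod-· : ∀ L g h → prod L (λ k → g k · h k) ≈ prod L g · prod L h
  prod-· zero    g h = sym (*-identityˡ _)
  prod-· (suc L) g h = trans (*-congʳ (prod-· L g h)) (*-interchange _ _ _ _)

  prod-𝟙 : ∀ L → prod L (λ _ → 𝟙) ≈ 𝟙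
  prod-𝟙 zero    = refl
  prod-𝟙 (suc L) = trans (*-identityʳ _) (prod-𝟙 L)

  prod-head : ∀ L g → prod (suc L) g ≈ g 0 · prod L (g ∘ suc)
  prod-head zero    g = *-comm _ _
  prod-head (suc L) g = trans (*-congʳ (prod-head L g)) (*-assoc _ _ _)

  prod-split₂ : ∀ L g → prod (L ℕ.* 2) g ≈ prod L (λ k → g (k ℕ.* 2) · g (suc (k ℕ.* 2)))
  prod-split₂ zero    g = refl
  prod-split₂ (suc L) g = trans (*-assoc _ _ _) (*-congʳ (prod-split₂ L g))

  prod-split₃ : ∀ L g → prod (L ℕ.* 3) g ≈ prod L (λ k → g (k ℕ.* 3) · g (1 ℕ.+ k ℕ.* 3) · g (2 ℕ.+ k ℕ.* 3))
  prod-split₃ zero    g = refl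
  prod-split₃ (suc L) g = trans (trans (*-assoc _ _ _)
      (trans (*-assoc _ _ _) (*-congˡ (sym (*-assoc _ _ _))))) (*-congʳ (prod-split₃ L g))

  sumℕ-cong : ∀ L {g h} → (∀ k → k ℕ.< L → g k ≈ h k) → sumℕ L g ≈ sumℕ L h
  sumℕ-cong zero    p = refl
  sumℕ-cong (suc L) p = +-cong (sumℕ-cong L λ k q → p k (ℕ.m<n⇒m<1+n q)) (p L ℕ.≤-refl)

  sumℕ-· : ∀ L a g → a · sumℕ L g ≈ sumℕ L (λ k → a · g k)
  sumℕ-· zero    a g = zeroʳ a
  sumℕ-· (suc L) a g = trans (distribˡ _ _ _) (+-congʳ (sumℕ-· L a g))

  sumℕ-head : ∀ L g → sumℕ (suc L) g ≈ g 0 ∔ sumℕ L (g ∘ suc)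
  sumℕ-head zero    g = +-comm _ _
  sumℕ-head (suc L) g = trans (+-congʳ (sumℕ-head L g)) (+-assoc _ _ _)

  open Bilateral +-commutativeMonoid public

  sumℤ-·ˡ : ∀ B a g → a · sumℤ B g ≈ sumℤ B (λ j → a · g j)
  sumℤ-·ˡ zero    a g = zeroʳ a
  sumℤ-·ˡ (suc B) a g = trans (distribˡ _ _ _) (+-cong (sumℤ-·ˡ B a g) (distribˡ _ _ _))

  sumℤ-· : ∀ B C g h → sumℤ B g · sumℤ C h ≈ sumℤ B (λ i → sumℤ C (λ j → g i · h j))
  sumℤ-· B C g h = begin
    sumℤ B g · sumℤ C h                     ≈⟨ *-comm _ _ ⟩
    sumℤ C h · sumℤ B g                     ≈⟨ sumℤ-·ˡ B _ g ⟩
    sumℤ B (λ i → sumℤ C h · g i)           ≈⟨ sumℤ-cong B (λ i _ → trans (*-comm _ _) (sumℤ-·ˡ C (g i) h)) ⟩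
    sumℤ B (λ i → sumℤ C (λ j → g i · h j)) ∎

everywhere : DownClosed (λ _ → ⊤)
everywhere _ _ = tt

below : ∀ K → DownClosed (ℕ._< K)
below K = ℕ.≤-<-trans

infix 4 _≈_ _≡_mod_
_≈_ : PowerSeries → PowerSeries → Set
a ≈ b = a ≈[ (λ _ → ⊤) ] b

_≡_mod_ : PowerSeries → PowerSeries → ℕ → Set
a ≡ b mod K = a ≈[ ℕ._< K ] b

module Series = On (λ _ → ⊤) everywhere
module Mod (K : ℕ) = On (ℕ._< K) (below K)

restrict : ∀ {P a b} → a ≈ b → a ≈[ P ] b
restrict p = ⟨ (λ n _ → at p n tt) ⟩

weaken : ∀ {K L a b} → K ≤ L → a ≡ b mod L → a ≡ b mod K
weaken K≤L p = ⟨ (λ n n<K → at p n (ℕ.<-≤-trans n<K K≤L)) ⟩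

≈-by-mod : ∀ {a b} → (∀ K → a ≡ b mod K) → a ≈ b
≈-by-mod p = ⟨ (λ n _ → at (p (suc n)) n ℕ.≤-refl) ⟩

-- The q-adic valuation is at least e.
Ord : ℕ → PowerSeries → Set
Ord e a = a ≡ 𝟘 mod e

opaque
  unfolding _·_

  ord-· : ∀ {d e a b} → Ord d a → Ord e b → Ord (d ℕ.+ e) (a · b)
  ord-· {d} {e} {a} {b} p r = ⟨ (λ n n<d+e → ≡.trans (sum-cong-≗ {suc n} (term n n<d+e))
      (sum-replicate-zero (suc n))) ⟩
    where
    term : ∀ n → n ℕ.< d ℕ.+ e → (k : Fin (suc n)) → a (toℕ k) ℤ.* b (n ∸ toℕ k) ≡ 0ℤ
    term n n<d+e k with toℕ k ℕ.<? d
    ... | yes k<d = cong (ℤ._* b (n ∸ toℕ k)) (at p (toℕ k) k<d)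
    ... | no  k≮d = ≡.trans (cong (a (toℕ k) ℤ.*_) (at r (n ∸ toℕ k) n-k<e)) (ℤ.*-zeroʳ (a (toℕ k)))
      where
      n-k<e : n ∸ toℕ k ℕ.< e
      n-k<e = ℕ.+-cancelˡ-< (toℕ k) _ _ (≡.subst (ℕ._< toℕ k ℕ.+ e)
        (≡.sym (ℕ.m+[n∸m]≡n (ℕ.≤-pred (toℕ<n k)))) (ℕ.<-≤-trans n<d+e (ℕ.+-monoˡ-≤ e (ℕ.≮⇒≥ k≮d))))

  ·-inverse : ∀ u → u 0 ≡ 1ℤ → u · inverse u ≈ 𝟙
  ·-inverse u u₀ = ⟨ (λ n _ → ⊛-inverseʳ u u₀ n) ⟩

  coeff-·-0 : ∀ a b → (a · b) 0 ≡ a 0 ℤ.* b 0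
  coeff-·-0 a b = ℤ.+-identityʳ _

  q^-+ : ∀ d e → q^ (d ℕ.+ e) ≈ q^ d · q^ e
  q^-+ d e = ⟨ (λ n _ → Convolution.q^-homo n d e) ⟩

ord-0 : ∀ {a} → Ord 0 a
ord-0 = ⟨ (λ _ ()) ⟩

ord-·ˡ : ∀ {e a} b → Ord e a → Ord e (a · b)
ord-·ˡ b p = weaken (ℕ.m≤m+n _ 0) (ord-· p ord-0)

ord-·ʳ : ∀ {e b} a → Ord e b → Ord e (a · b)
ord-·ʳ a p = ord-· ord-0 p

ord-↑ : ∀ {a} → Ord 1 a → ∀ n → Ord n (a ↑ n)
ord-↑ p zero    = ord-0
ord-↑ p (suc n) = ord-· p (ord-↑ p n)

∔-ord : ∀ {K a b c} → a ≡ c mod K → Ord K b → a ∔ b ≡ c mod K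
∔-ord {K} p r = trans (+-cong p r) (+-identityʳ _)
  where open Mod K

-- The difference is y · (a - b), of order at least 1 + K. Multiplication by y is thus a q-adic
-- contraction, which makes the iteration for fixed points converge.
·-mod-suc : ∀ {K a b y} → Ord 1 y → a ≡ b mod K → y · a ≡ y · b mod suc K
·-mod-suc {K} {a} {b} {y} y₁ p = begin
  y · a                     ≈⟨ *-congˡ (trans (sym (+-identityˡ a))
      (trans (+-congʳ (sym (-‿inverseʳ b))) (+-assoc _ _ _))) ⟩
  y · (b ∔ (neg b ∔ a))     ≈⟨ distribˡ _ _ _ ⟩
  y · b ∔ y · (neg b ∔ a)   ≈⟨ ∔-ord refl (ord-· y₁ (Mod.trans K (Mod.+-congˡ K p) (Mod.-‿inverseˡ K b))) ⟩
  y · b                     ∎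
  where open Mod (suc K)

Cauchy : (ℕ → PowerSeries) → Set
Cauchy s = ∀ K → s (suc K) ≡ s K mod K

-- Stage K of a Cauchy sequence has settled the coefficients below K, so coefficient n is read at
-- stage `suc n`.
lim : (ℕ → PowerSeries) → PowerSeries
lim s n = s (suc n) n

cauchy-≤ : ∀ {s} → Cauchy s → ∀ {K L} → K ≤ L → s L ≡ s K mod K
cauchy-≤ {s} p {K} {L} K≤L = ≡.subst (λ L → s L ≡ s K mod K) (ℕ.m∸n+n≡m K≤L) (go (L ∸ K))
  where
  open Mod K
  go : ∀ k → s (k ℕ.+ K) ≡ s K mod K
  go zero    = refl
  go (suc k) = trans (weaken (ℕ.m≤n+m K k) (p (k ℕ.+ K))) (go k)

lim-mod : ∀ {s} → Cauchy s → ∀ {K L} → K ≤ L → lim s ≡ s L mod K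
lim-mod p {K} K≤L = ⟨ (λ n n<K → ≡.sym (at (cauchy-≤ p (ℕ.≤-trans n<K K≤L)) n ℕ.≤-refl)) ⟩

∏ : (ℕ → PowerSeries) → PowerSeries
∏ g = lim (λ L → prod L g)

-- The modulus k, rather than k + 1, admits the factors 1 + x^(6k) that start at exponent 0 and
-- occur in f(x⁶, 1).
Tame : (ℕ → PowerSeries) → Set
Tame g = ∀ k → g k ≡ 𝟙 mod k

tame-cauchy : ∀ {g} → Tame g → Cauchy (λ L → prod L g)
tame-cauchy p K = trans (*-congˡ (p K)) (*-identityʳ _)
  where open Mod K

∏-mod : ∀ {g} → Tame g → ∀ {K L} → K ≤ L → ∏ g ≡ prod L g mod K
∏-mod p = lim-mod (tame-cauchy p)

∏-cong : ∀ {g h} → (∀ k → g k ≈ h k) → ∏ g ≈ ∏ h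
∏-cong p = ⟨ (λ n _ → at (Series.prod-cong (suc n) λ k _ → p k) n tt) ⟩

tame-· : ∀ {g h} → Tame g → Tame h → Tame (λ k → g k · h k)
tame-· p r k = trans (*-cong (p k) (r k)) (*-identityˡ _)
  where open Mod k

∏-· : ∀ {g h} → Tame g → Tame h → ∏ (λ k → g k · h k) ≈ ∏ g · ∏ h
∏-· p r = ≈-by-mod λ K → let open Mod K in
  trans (∏-mod (tame-· p r) ℕ.≤-refl)
    (trans (prod-· K _ _) (sym (*-cong (∏-mod p ℕ.≤-refl) (∏-mod r ℕ.≤-refl))))

∏-head : ∀ {g} → Tame g → ∏ g ≈ g 0 · ∏ (g ∘ suc)
∏-head {g} p = ≈-by-mod λ K → let open Mod K in
  trans (∏-mod p (ℕ.n≤1+n K)) (trans (prod-head K g)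
    (*-congˡ (sym (∏-mod (λ k → weaken (ℕ.n≤1+n k) (p (suc k))) ℕ.≤-refl))))

tame-∘ : ∀ {g} → Tame g → ∀ φ → (∀ k → k ≤ φ k) → Tame (g ∘ φ)
tame-∘ p φ h k = weaken (h k) (p (φ k))

∏-split₂ : ∀ {g} → Tame g → ∏ g ≈ ∏ (λ k → g (k ℕ.* 2)) · ∏ (λ k → g (suc (k ℕ.* 2)))
∏-split₂ {g} p = ≈-by-mod λ K → let open Mod K in begin
  ∏ g                                                     ≈⟨ ∏-mod p (ℕ.m≤m*n K 2) ⟩
  prod (K ℕ.* 2) g                                        ≈⟨ prod-split₂ K g ⟩
  prod K (λ k → g (k ℕ.* 2) · g (suc (k ℕ.* 2)))          ≈⟨ ∏-mod (tame-· p₀ p₁) ℕ.≤-refl ⟨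
  ∏ (λ k → g (k ℕ.* 2) · g (suc (k ℕ.* 2)))               ≈⟨ restrict (∏-· p₀ p₁) ⟩
  ∏ (λ k → g (k ℕ.* 2)) · ∏ (λ k → g (suc (k ℕ.* 2)))     ∎
  where
  p₀ = tame-∘ p (ℕ._* 2) (λ k → ℕ.m≤m*n k 2)
  p₁ = tame-∘ p (λ k → suc (k ℕ.* 2)) (λ k → ℕ.m≤n⇒m≤1+n (ℕ.m≤m*n k 2))

∏-split₃ : ∀ {g} → Tame g →
  ∏ g ≈ ∏ (λ k → g (k ℕ.* 3)) · ∏ (λ k → g (1 ℕ.+ k ℕ.* 3)) · ∏ (λ k → g (2 ℕ.+ k ℕ.* 3))
∏-split₃ {g} p = ≈-by-mod λ K → let open Mod K in
  trans (∏-mod p (ℕ.m≤m*n K 3)) (trans (prod-split₃ K g)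
    (trans (sym (∏-mod (tame-· (tame-· p₀ p₁) p₂) ℕ.≤-refl))
      (trans (restrict (∏-· (tame-· p₀ p₁) p₂)) (*-congʳ (restrict (∏-· p₀ p₁))))))
  where
  p₀ = tame-∘ p (ℕ._* 3) (λ k → ℕ.m≤m*n k 3)
  p₁ = tame-∘ p (λ k → 1 ℕ.+ k ℕ.* 3) (λ k → ℕ.m≤n⇒m≤o+n 1 (ℕ.m≤m*n k 3))
  p₂ = tame-∘ p (λ k → 2 ℕ.+ k ℕ.* 3) (λ k → ℕ.m≤n⇒m≤o+n 2 (ℕ.m≤m*n k 3))

-- Jacobi's triple product identity

triangle : ℕ → ℕ
triangle zero    = 0
triangle (suc n) = suc n ℕ.+ triangle n

-- tri j = j (j - 1) / 2
tri : ℤ → ℕ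
tri (+ zero)  = 0
tri (+ suc n) = triangle n
tri -[1+ n ]  = triangle (suc n)

n≤triangle : ∀ n → n ≤ triangle n
n≤triangle zero    = z≤n
n≤triangle (suc n) = ℕ.m≤m+n (suc n) (triangle n)

term : PowerSeries → PowerSeries → ℤ → PowerSeries
term a b j = a ↑ tri (succ j) · b ↑ tri j

-- Ramanujan's f(a, b) = ∑_j a^(j(j+1)/2) b^(j(j-1)/2), for a b without constant term.
θ : PowerSeries → PowerSeries → PowerSeries
θ a b = lim λ L → sumℤ (suc L) (term a b)

module _ {a b : PowerSeries} (ab : Ord 1 (a · b)) where

  private
    common : ∀ m k → Ord m (a ↑ (k ℕ.+ m) · b ↑ m)
    common m k = trans (trans (*-congʳ (↑-+ a k m)) (trans (*-assoc _ _ _) (*-congˡ (sym (↑-· a b m)))))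
                       (ord-·ʳ (a ↑ k) (ord-↑ ab m))
      where open Mod m

    common′ : ∀ m k → Ord m (a ↑ m · b ↑ (k ℕ.+ m))
    common′ m k = trans (trans (*-congˡ (trans (↑-+ b k m) (*-comm _ _)))
        (trans (sym (*-assoc _ _ _)) (*-congʳ (sym (↑-· a b m)))))
                       (ord-·ˡ (b ↑ k) (ord-↑ ab m))
      where open Mod m

  -- Only a · b is known to vanish at 0, so the order is taken from the common power: the term is (a
  -- b)^t times a power of a or of b, where t is the smaller of `tri j` and `tri (succ j)`. For j =
  -- i + 1 this is `triangle i` ≥ i, hence the loss of one in the index.
  ord-term : ∀ K j → suc K ≤ size j → Ord K (term a b j)
  ord-term K (+ suc i)    (s≤s K≤i) = weaken (ℕ.≤-trans K≤i (n≤triangle i)) (common (triangle i) (suc i))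
  ord-term K -[1+ suc i ] (s≤s K≤i) =
    weaken (ℕ.≤-trans K≤i (ℕ.≤-trans (ℕ.n≤1+n i) (n≤triangle (suc i))))
        (common′ (triangle (suc i)) (suc (suc i)))

  θ-cauchy : Cauchy (λ L → sumℤ (suc L) (term a b))
  θ-cauchy K = sumℤ-stable (λ j q → ord-term K j q) 1
    where open Mod K

  θ-mod : ∀ {K L} → K ℕ.< L → θ a b ≡ sumℤ L (term a b) mod K
  θ-mod {L = suc L} (s≤s K≤L) = lim-mod θ-cauchy K≤L

θ-cong : ∀ {a b a′ b′} → a ≈ a′ → b ≈ b′ → θ a b ≈ θ a′ b′
θ-cong p r = ⟨ (λ n _ → at (sumℤ-cong (suc (suc n)) λ j _ → *-cong (↑-cong (tri (succ j)) p)
    (↑-cong (tri j) r)) n _) ⟩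
  where open Series

-- This is `tri (succ j)` - `tri j` = j for j = t - n, arranged without subtraction.
tri-⊖ : ∀ t n → tri (t ℤ.⊖ n) ℕ.+ t ≡ tri (succ (t ℤ.⊖ n)) ℕ.+ n
tri-⊖ zero    zero    = ≡.refl
tri-⊖ zero    (suc zero) = ≡.refl
tri-⊖ zero    (suc (suc n)) = ≡.trans (ℕ.+-identityʳ _) (ℕ.+-comm (suc (suc n)) (triangle (suc n)))
tri-⊖ (suc zero) zero = ≡.refl
tri-⊖ (suc (suc t)) zero = ≡.trans (ℕ.+-comm (triangle (suc t)) (suc (suc t))) (≡.sym (ℕ.+-identityʳ _))
tri-⊖ (suc t) (suc n) rewrite ℤ.[1+m]⊖[1+n]≡m⊖n t n =
  ≡.trans (ℕ.+-suc _ t) (≡.trans (cong suc (tri-⊖ t n)) (≡.sym (ℕ.+-suc _ n)))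

succ-⊖ : ∀ t n → succ (t ℤ.⊖ suc n) ≡ t ℤ.⊖ n
succ-⊖ zero    zero    = ≡.refl
succ-⊖ zero    (suc n) = ≡.refl
succ-⊖ (suc t) zero    rewrite ℤ.[1+m]⊖[1+n]≡m⊖n t 0 = ≡.refl
succ-⊖ (suc t) (suc n) rewrite ℤ.[1+m]⊖[1+n]≡m⊖n t (suc n) | ℤ.[1+m]⊖[1+n]≡m⊖n t n = succ-⊖ t n

-- r t = 1 / ((1 - c) (1 - c²) ⋯ (1 - cᵗ)) makes V n = ∑_{t ≥ 0} term (t - n) r t a
-- finite product (up to the factor V 0) by r (t + 1) = r t + c^(t+1) r (t + 1), and
-- term (t - n) r t tends to term (t - n) r ∞.
module JacobiTripleProduct {a b c : PowerSeries} (c≈ab : c ≈ a · b) (c₀ : Ord 1 c) where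

  T : ℤ → PowerSeries
  T = term a b

  ab : Ord 1 (a · b)
  ab = trans (restrict (Series.sym c≈ab)) c₀
    where open Mod 1

  1-c : ℕ → PowerSeries
  1-c k = 𝟙 ∔ neg (c ↑ suc k)

  1+ac 1+bc : ℕ → PowerSeries
  1+ac k = 𝟙 ∔ a · c ↑ k
  1+bc k = 𝟙 ∔ b · c ↑ k

  tame-1-c : Tame 1-c
  tame-1-c k = trans (+-congˡ (trans (-‿cong (weaken (ℕ.n≤1+n k) (ord-↑ c₀ (suc k)))) neg-𝟘)) (+-identityʳ 𝟙)
    where
    open Mod k
    neg-𝟘 : neg 𝟘 ≡ 𝟘 mod k
    neg-𝟘 = trans (sym (+-identityˡ _)) (-‿inverseʳ 𝟘)

  tame-1+ : ∀ d → Tame (λ k → 𝟙 ∔ d · c ↑ k)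
  tame-1+ d k = trans (+-congˡ (ord-·ʳ d (ord-↑ c₀ k))) (+-identityʳ 𝟙)
    where open Mod k

  r : ℕ → PowerSeries
  r zero    = 𝟙
  r (suc t) = r t · inverse (1-c t)

  module Exact where
    open Series hiding (_≈_)

    1-c-inverse : ∀ t → 1-c t · inverse (1-c t) ≈ 𝟙
    1-c-inverse t = ·-inverse (1-c t) (at (weaken {1} {suc t} (s≤s z≤n) tame′) 0 (s≤s z≤n))
      where
      module M = Mod (suc t)
      tame′ : 1-c t ≡ 𝟙 mod suc t
      tame′ = M.trans (M.+-congˡ (M.trans (M.-‿cong (ord-↑ c₀ (suc t)))
        (M.trans (M.sym (M.+-identityˡ _)) (M.-‿inverseʳ 𝟘)))) (M.+-identityʳ 𝟙)

    r-suc : ∀ t → r (suc t) ≈ r t ∔ c ↑ suc t · r (suc t)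
    r-suc t = begin
      r (suc t)                                        ≈⟨ *-identityˡ _ ⟨
      𝟙 · r (suc t)
          ≈⟨ *-congʳ (trans (sym (+-identityʳ _)) (trans (+-congˡ (sym (-‿inverseˡ (c ↑ suc t))))
          (sym (+-assoc _ _ _)))) ⟩
      (1-c t ∔ c ↑ suc t) · r (suc t)                  ≈⟨ distribʳ _ _ _ ⟩
      1-c t · r (suc t) ∔ c ↑ suc t · r (suc t)        ≈⟨ +-congʳ cancel ⟩
      r t ∔ c ↑ suc t · r (suc t)                      ∎
      where
      cancel : 1-c t · r (suc t) ≈ r t
      cancel = begin
        1-c t · (r t · inverse (1-c t))  ≈⟨ *-congˡ (*-comm _ _) ⟩
        1-c t · (inverse (1-c t) · r t)  ≈⟨ *-assoc _ _ _ ⟨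
        1-c t · inverse (1-c t) · r t    ≈⟨ *-congʳ (1-c-inverse t) ⟩
        𝟙 · r t                          ≈⟨ *-identityˡ _ ⟩
        r t                              ∎

    prod-r : ∀ t → prod t 1-c · r t ≈ 𝟙
    prod-r zero    = *-identityˡ 𝟙
    prod-r (suc t) = trans (*-interchange _ _ _ _) (trans (*-cong (prod-r t) (1-c-inverse t)) (*-identityˡ 𝟙))

    -- With j = t - n one has T j = T (j - 1) a^j b^(j-1), so T j · b c^n is T (j - 1) c^(j+n), and
    -- j + n = t. This form avoids negative exponents.
    T-step : ∀ t n → T (t ℤ.⊖ suc n) · c ↑ t ≈ T (t ℤ.⊖ n) · (b · c ↑ n)
    T-step t n = begin
      a ↑ tri (succ j) · b ↑ tri j · c ↑ t
        ≈⟨ *-cong (*-congʳ (reflexive (cong (λ i → a ↑ tri i) (succ-⊖ t n))))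
            (trans (↑-cong t c≈ab) (↑-· a b t)) ⟩
      a ↑ tri i · b ↑ tri j · (a ↑ t · b ↑ t)
        ≈⟨ *-interchange _ _ _ _ ⟩
      (a ↑ tri i · a ↑ t) · (b ↑ tri j · b ↑ t)
        ≈⟨ *-cong (↑-+ a (tri i) t) (↑-+ b (tri j) t) ⟨
      a ↑ (tri i ℕ.+ t) · b ↑ (tri j ℕ.+ t)
        ≈⟨ *-cong (↑-≡ a (tri-⊖ t n)) (↑-≡ b (≡.trans (tri-⊖ t (suc n))
            (cong (λ i → tri i ℕ.+ suc n) (succ-⊖ t n)))) ⟩
      a ↑ (tri (succ i) ℕ.+ n) · b ↑ (tri i ℕ.+ suc n)
        ≈⟨ *-cong (↑-+ a (tri (succ i)) n) (↑-+ b (tri i) (suc n)) ⟩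
      (a ↑ tri (succ i) · a ↑ n) · (b ↑ tri i · (b · b ↑ n))
        ≈⟨ SM.solve 5 (λ x y z w v → (x SM.⊕ y) SM.⊕ (z SM.⊕ (w SM.⊕ v)) SM.⊜ (x SM.⊕ z) SM.⊕
            (w SM.⊕ (y SM.⊕ v))) refl _ _ _ _ _ ⟩
      T i · (b · (a ↑ n · b ↑ n))
        ≈⟨ *-congˡ (*-congˡ (trans (↑-cong n c≈ab) (↑-· a b n))) ⟨
      T i · (b · c ↑ n) ∎
      where
      i = t ℤ.⊖ n
      j = t ℤ.⊖ suc n
      module SM = SolveMonoid

    T-suc : ∀ t → T (+ suc t) ≈ T (+ t) · (a · c ↑ t)
    T-suc t = begin
      a ↑ triangle (suc t) · b ↑ triangle t
        ≈⟨ *-cong (↑-+ a (suc t) (triangle t)) (↑-≡ b (tri-suc t)) ⟩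
      (a · a ↑ t) · a ↑ triangle t · b ↑ (t ℕ.+ tri (+ t))
        ≈⟨ *-congˡ (↑-+ b t (tri (+ t))) ⟩
      (a · a ↑ t) · a ↑ triangle t · (b ↑ t · b ↑ tri (+ t))
        ≈⟨ SM.solve 5 (λ x y z w v → ((x SM.⊕ y) SM.⊕ z) SM.⊕ (w SM.⊕ v) SM.⊜ (z SM.⊕ v) SM.⊕
            (x SM.⊕ (y SM.⊕ w))) refl _ _ _ _ _ ⟩
      T (+ t) · (a · (a ↑ t · b ↑ t))
        ≈⟨ *-congˡ (*-congˡ (trans (↑-cong t c≈ab) (↑-· a b t))) ⟨
      T (+ t) · (a · c ↑ t) ∎
      where
      module SM = SolveMonoid
      tri-suc : ∀ t → triangle t ≡ t ℕ.+ tri (+ t)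
      tri-suc zero    = ≡.refl
      tri-suc (suc t) = ≡.refl

    V : ℕ → ℕ → PowerSeries
    V n L = sumℕ L (λ t → T (t ℤ.⊖ n) · r t)

    -- Since T t = a^t c^(t(t-1)/2), this is Euler's series for the product of the 1 + a c^k, with a
    -- replaced by a c^m. It evaluates `V 0`, which equals `W 0`.
    W : ℕ → ℕ → PowerSeries
    W m L = sumℕ L (λ t → T (+ t) · c ↑ (t ℕ.* m) · r t)

    -- The two halves of `r` produce different truncations, which keeps the recurrence exact; modulo
    -- q^K they agree and it becomes V (n + 1) = (1 + b c^n) V n.
    V-step : ∀ n L → V (suc n) (suc L) ≈ V n L ∔ (b · c ↑ n) · V n (suc L)
    V-step n zero = begin
      𝟘 ∔ T (0 ℤ.⊖ suc n) · 𝟙                ≈⟨ +-congˡ (*-congʳ (trans (sym (*-identityʳ _)) (T-step 0 n))) ⟩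
      𝟘 ∔ T (0 ℤ.⊖ n) · (b · c ↑ n) · 𝟙      ≈⟨ +-congˡ (trans (*-congʳ (*-comm _ _)) (*-assoc _ _ _)) ⟩
      𝟘 ∔ (b · c ↑ n) · (T (0 ℤ.⊖ n) · 𝟙)    ≈⟨ +-congˡ (*-congˡ (+-identityˡ _)) ⟨
      𝟘 ∔ (b · c ↑ n) · V n 1                ∎
    V-step n (suc L) = begin
      V (suc n) (suc L) ∔ T j · r (suc L)
        ≈⟨ +-cong (V-step n L) (*-congˡ (r-suc L)) ⟩
      (V n L ∔ B · V n (suc L)) ∔ T j · (r L ∔ c ↑ suc L · r (suc L))
        ≈⟨ +-congˡ (trans (distribˡ _ _ _) (+-cong (*-congʳ (reflexive (cong T (ℤ.[1+m]⊖[1+n]≡m⊖n L n))))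
             (trans (sym (*-assoc _ _ _)) (*-congʳ (T-step (suc L) n))))) ⟩
      (V n L ∔ B · V n (suc L)) ∔ (T (L ℤ.⊖ n) · r L ∔ T (suc L ℤ.⊖ n) · B · r (suc L))
        ≈⟨ +-interchange _ _ _ _ ⟩
      V n (suc L) ∔ (B · V n (suc L) ∔ T (suc L ℤ.⊖ n) · B · r (suc L))
        ≈⟨ +-congˡ (trans (+-congˡ (trans (*-congʳ (*-comm _ _)) (*-assoc _ _ _))) (sym (distribˡ _ _ _))) ⟩
      V n (suc L) ∔ B · V n (suc (suc L)) ∎
      where
      B = b · c ↑ n
      j = suc L ℤ.⊖ suc n

    W-step : ∀ m L → W m (suc L) ≈ W (suc m) (suc L) ∔ (a · c ↑ m) · W (suc m) L
    W-step m zero    = trans (sym (+-identityʳ _)) (+-congˡ (sym (zeroʳ _)))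
    W-step m (suc L) = begin
      W m (suc L) ∔ T (+ suc L) · c ↑ (m ℕ.+ L ℕ.* m) · r (suc L)
        ≈⟨ +-cong (W-step m L) (trans (*-congˡ (r-suc L)) (distribˡ _ _ _)) ⟩
      (W (suc m) (suc L) ∔ A · W (suc m) L) ∔
        (T (+ suc L) · c ↑ (m ℕ.+ L ℕ.* m) · r L ∔ T (+ suc L) · c ↑ (m ℕ.+ L ℕ.* m) ·
            (c ↑ suc L · r (suc L)))
        ≈⟨ trans (+-congˡ (+-comm _ _)) (+-interchange _ _ _ _) ⟩
      (W (suc m) (suc L) ∔ T (+ suc L) · c ↑ (m ℕ.+ L ℕ.* m) · (c ↑ suc L · r (suc L))) ∔
        (A · W (suc m) L ∔ T (+ suc L) · c ↑ (m ℕ.+ L ℕ.* m) · r L)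
        ≈⟨ +-cong (+-congˡ (trans (sym (*-assoc _ _ _)) (*-congʳ (trans (*-assoc _ _ _) (*-congˡ same)))))
                  (trans (+-congˡ shifted) (sym (distribˡ _ _ _))) ⟩
      W (suc m) (suc (suc L)) ∔ A · W (suc m) (suc L) ∎
      where
      module SM = SolveMonoid
      A = a · c ↑ m
      same : c ↑ (m ℕ.+ L ℕ.* m) · c ↑ suc L ≈ c ↑ (suc L ℕ.* suc m)
      same = trans (sym (↑-+ c (m ℕ.+ L ℕ.* m) (suc L))) (↑-≡ c (eq L m))
        where
        eq : ∀ L m → m ℕ.+ L ℕ.* m ℕ.+ suc L ≡ suc L ℕ.* suc m
        eq = ℕSolver.solve-∀
      shifted : T (+ suc L) · c ↑ (m ℕ.+ L ℕ.* m) · r L ≈ A · (T (+ L) · c ↑ (L ℕ.* suc m) · r L)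
      shifted = begin
        T (+ suc L) · c ↑ (m ℕ.+ L ℕ.* m) · r L
          ≈⟨ *-congʳ (*-cong (T-suc L) (↑-+ c m (L ℕ.* m))) ⟩
        T (+ L) · (a · c ↑ L) · (c ↑ m · c ↑ (L ℕ.* m)) · r L
          ≈⟨ SM.solve 6 (λ t a l m lm r → ((t SM.⊕ (a SM.⊕ l)) SM.⊕ (m SM.⊕ lm)) SM.⊕ r SM.⊜
                                          (a SM.⊕ m) SM.⊕ ((t SM.⊕ (l SM.⊕ lm)) SM.⊕ r)) refl _ _ _ _ _ _ ⟩
        A · (T (+ L) · (c ↑ L · c ↑ (L ℕ.* m)) · r L)
          ≈⟨ *-congˡ (*-congʳ (*-congˡ (trans (sym (↑-+ c L (L ℕ.* m))) (↑-≡ c (≡.sym (ℕ.*-suc L m)))))) ⟩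
        A · (T (+ L) · c ↑ (L ℕ.* suc m) · r L) ∎

  open Exact

  module Limit (K : ℕ) where
    open Mod K hiding (_≈_)
    infix 4 _≋_
    _≋_ : PowerSeries → PowerSeries → Set
    x ≋ y = x ≡ y mod K

    drop-last : ∀ {x y} → Ord K y → x ∔ y ≋ x
    drop-last p = trans (+-congˡ p) (+-identityʳ _)

    factor : ∀ {x y d} → x ≋ y → x ∔ d · y ≋ (𝟙 ∔ d) · y
    factor p = trans (+-congʳ (trans p (sym (*-identityˡ _)))) (sym (distribʳ _ _ _))

    W-factor : ∀ m → W m (suc K) ≋ 1+ac m · W (suc m) (suc K)
    W-factor m = begin
      W m (suc K)
          ≈⟨ drop-last (ord-·ˡ _ (ord-·ˡ _ (ord-term ab K (+ suc K) ℕ.≤-refl))) ⟨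
      W m (suc (suc K))                                  ≈⟨ restrict (W-step m (suc K)) ⟩
      W (suc m) (suc (suc K)) ∔ (a · c ↑ m) · W (suc m) (suc K)
        ≈⟨ factor (drop-last (ord-·ˡ _ (ord-·ˡ _ (ord-term ab K (+ suc K) ℕ.≤-refl)))) ⟩
      1+ac m · W (suc m) (suc K)                         ∎

    W-product : ∀ m → W 0 (suc K) ≋ prod m 1+ac · W m (suc K)
    W-product zero    = sym (*-identityˡ _)
    W-product (suc m) = trans (W-product m) (trans (*-congˡ (W-factor m)) (sym (*-assoc _ _ _)))

    -- Every term with t > 0 carries c^(tK), so only the term t = 0 survives modulo q^K.
    W-limit : ∀ L → W K (suc L) ≋ 𝟙
    W-limit zero    = trans (+-identityˡ _) (trans (*-identityʳ _) (trans (*-identityʳ _) (*-identityʳ _)))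
    W-limit (suc L) = trans (drop-last (ord-·ˡ _
        (ord-·ʳ _ (weaken (ℕ.m≤m+n K (L ℕ.* K)) (ord-↑ c₀ (suc L ℕ.* K)))))) (W-limit L)

    V₀ : ∀ L → V 0 L ≋ W 0 L
    V₀ L = sumℕ-cong L λ t _ → *-congʳ (trans (sym (*-identityʳ _)) (*-congˡ (↑-≡ c (≡.sym (ℕ.*-zeroʳ t)))))

    -- The truncation n + K + 1 keeps the indices t - n ≤ K; the next one is K + 1, whose term
    -- already vanishes modulo q^K.
    V-product : ∀ n → V n (n ℕ.+ suc K) ≋ prod n 1+bc · prod K 1+ac
    V-product zero    = begin
      V 0 (suc K)                  ≈⟨ V₀ (suc K) ⟩
      W 0 (suc K)                  ≈⟨ W-product K ⟩
      prod K 1+ac · W K (suc K)    ≈⟨ *-congˡ (W-limit K) ⟩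
      prod K 1+ac · 𝟙              ≈⟨ *-comm _ _ ⟩
      𝟙 · prod K 1+ac              ∎
    V-product (suc n) = begin
      V (suc n) (suc (n ℕ.+ suc K))                           ≈⟨ restrict (V-step n (n ℕ.+ suc K)) ⟩
      V n (n ℕ.+ suc K) ∔ (b · c ↑ n) · V n (suc (n ℕ.+ suc K)) ≈⟨ factor (sym last) ⟩
      1+bc n · V n (suc (n ℕ.+ suc K))                        ≈⟨ *-congˡ (trans last (V-product n)) ⟩
      1+bc n · (prod n 1+bc · prod K 1+ac)                    ≈⟨ *-assoc _ _ _ ⟨
      1+bc n · prod n 1+bc · prod K 1+ac                      ≈⟨ *-congʳ (*-comm _ _) ⟩
      prod (suc n) 1+bc · prod K 1+ac                         ∎
      where
      ⊖-large : n ℕ.+ suc K ℤ.⊖ n ≡ + suc K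
      ⊖-large = ≡.trans (cong (ℤ._⊖ n) (ℕ.+-comm n (suc K)))
          (≡.trans (ℤ.⊖-≥ (ℕ.m≤n+m n (suc K))) (cong +_ (ℕ.m+n∸n≡m (suc K) n)))
      last : V n (suc (n ℕ.+ suc K)) ≋ V n (n ℕ.+ suc K)
      last = drop-last (ord-·ˡ _ (ord-term ab K (n ℕ.+ suc K ℤ.⊖ n)
          (subst (λ j → suc K ≤ size j) (≡.sym ⊖-large) ℕ.≤-refl)))

    sum-⊖ : ∀ n L (g : ℤ → PowerSeries) → sumℕ (n ℕ.+ L) (λ t → g (t ℤ.⊖ n)) ≋ sumℕ n
        (λ i → g -[1+ i ]) ∔ sumℕ L (λ i → g (+ i))
    sum-⊖ zero    L g = sym (+-identityˡ _)
    sum-⊖ (suc n) L g = begin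
      sumℕ (suc (n ℕ.+ L)) (λ t → g (t ℤ.⊖ suc n))
        ≈⟨ sumℕ-head (n ℕ.+ L) _ ⟩
      g -[1+ n ] ∔ sumℕ (n ℕ.+ L) (λ t → g (suc t ℤ.⊖ suc n))
        ≈⟨ +-congˡ (sumℕ-cong (n ℕ.+ L) λ t _ → reflexive (cong g (ℤ.[1+m]⊖[1+n]≡m⊖n t n))) ⟩
      g -[1+ n ] ∔ sumℕ (n ℕ.+ L) (λ t → g (t ℤ.⊖ n))
        ≈⟨ trans (+-congˡ (sum-⊖ n L g)) (sym (+-assoc _ _ _)) ⟩
      g -[1+ n ] ∔ sumℕ n (λ i → g -[1+ i ]) ∔ sumℕ L (λ i → g (+ i))
        ≈⟨ +-congʳ (+-comm _ _) ⟩
      sumℕ (suc n) (λ i → g -[1+ i ]) ∔ sumℕ L (λ i → g (+ i)) ∎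

    sumℤ-halves : ∀ L (g : ℤ → PowerSeries) → sumℤ L g ≋ sumℕ L (λ i → g -[1+ i ]) ∔ sumℕ L (λ i → g (+ i))
    sumℤ-halves zero    g = sym (+-identityˡ 𝟘)
    sumℤ-halves (suc L) g = trans (+-cong (sumℤ-halves L g) (+-comm _ _)) (+-interchange _ _ _ _)

    negative-part : ∀ k → sumℕ (k ℕ.+ suc K) (λ i → T -[1+ i ]) ≋ sumℕ (suc K) (λ i → T -[1+ i ])
    negative-part zero    = refl
    negative-part (suc k) = trans (drop-last (ord-term ab K -[1+ k ℕ.+ suc K ] (ℕ.m≤n+m (suc K) k)))
        (negative-part k)

    Q : PowerSeries
    Q = prod K 1-c

    N : ℕ
    N = suc K ℕ.+ suc K

    -- `Q` cancels `r t` modulo q^K as soon as t ≥ K. For t ≤ K the choice N = 2K + 2 puts t - N at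
    -- or below -(K + 2), where the term itself vanishes modulo q^K.
    T-r : ∀ t → Q · (T (t ℤ.⊖ N) · r t) ≋ T (t ℤ.⊖ N)
    T-r t with ℕ.≤-total K t
    ... | inj₁ K≤t = begin
      Q · (T (t ℤ.⊖ N) · r t)            ≈⟨ *-congʳ (cauchy-≤ (tame-cauchy tame-1-c) K≤t) ⟨
      prod t 1-c · (T (t ℤ.⊖ N) · r t)   ≈⟨ *-congˡ (*-comm _ _) ⟩
      prod t 1-c · (r t · T (t ℤ.⊖ N))   ≈⟨ *-assoc _ _ _ ⟨
      prod t 1-c · r t · T (t ℤ.⊖ N)     ≈⟨ *-congʳ (restrict (prod-r t)) ⟩
      𝟙 · T (t ℤ.⊖ N)                    ≈⟨ *-identityˡ _ ⟩
      T (t ℤ.⊖ N)                        ∎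
    ... | inj₂ t≤K = trans (ord-·ʳ Q (ord-·ˡ (r t) T≋𝟘)) (sym T≋𝟘)
      where
      k = suc K ℕ.+ (K ∸ t)
      N≡ : N ≡ suc k ℕ.+ t
      N≡ = ≡.trans (ℕ.+-suc (suc K) K) (cong suc (≡.trans (cong (suc K ℕ.+_) (≡.sym (ℕ.m∸n+n≡m t≤K)))
                                                          (≡.sym (ℕ.+-assoc (suc K) (K ∸ t) t))))
      j≡ : t ℤ.⊖ N ≡ -[1+ k ]
      j≡ = ≡.trans (cong (t ℤ.⊖_) N≡)
        (≡.trans (ℤ.⊖-< (s≤s (ℕ.m≤n+m t k))) (cong (λ i → ℤ.- (+ i)) (ℕ.m+n∸n≡m (suc k) t)))
      T≋𝟘 : Ord K (T (t ℤ.⊖ N))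
      T≋𝟘 = subst (λ j → Ord K (T j)) (≡.sym j≡) (ord-term ab K -[1+ k ] (ℕ.m≤m+n (suc K) (K ∸ t)))

    triple-product : θ a b ≋ prod K 1+ac · prod N 1+bc · Q
    triple-product = begin
      θ a b                                                                 ≈⟨ θ-mod ab ℕ.≤-refl ⟩
      sumℤ (suc K) T                                                        ≈⟨ sumℤ-halves (suc K) T ⟩
      sumℕ (suc K) (λ i → T -[1+ i ]) ∔ sumℕ (suc K) (λ i → T (+ i))
          ≈⟨ +-congʳ (negative-part (suc K)) ⟨
      sumℕ N (λ i → T -[1+ i ]) ∔ sumℕ (suc K) (λ i → T (+ i))              ≈⟨ sum-⊖ N (suc K) T ⟨
      sumℕ (N ℕ.+ suc K) (λ t → T (t ℤ.⊖ N))
          ≈⟨ sumℕ-cong (N ℕ.+ suc K) (λ t _ → T-r t) ⟨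
      sumℕ (N ℕ.+ suc K) (λ t → Q · (T (t ℤ.⊖ N) · r t))                    ≈⟨ sumℕ-· (N ℕ.+ suc K) Q _ ⟨
      Q · V N (N ℕ.+ suc K)                                                 ≈⟨ *-comm _ _ ⟩
      V N (N ℕ.+ suc K) · Q
          ≈⟨ *-congʳ (trans (V-product N) (*-comm _ _)) ⟩
      prod K 1+ac · prod N 1+bc · Q                                         ∎

  jacobi : θ a b ≈ ∏ 1+ac · ∏ 1+bc · ∏ 1-c
  jacobi = ≈-by-mod λ K → let open Mod K; open Limit K in
    trans triple-product (sym (*-cong (*-cong (∏-mod (tame-1+ a) ℕ.≤-refl)
        (∏-mod (tame-1+ b) (ℕ.m≤n⇒m≤1+n (ℕ.m≤m+n K (suc K))))) (∏-mod tame-1-c ℕ.≤-refl)))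

-- Squares and dissections of theta functions

-- Exponents contain triangular numbers; doubled and moved to ℤ they are polynomials in the
-- summation indices, which a ring solver can compare.
halve : ∀ {m n} → + m ℤ.+ + m ≡ + n ℤ.+ + n → m ≡ n
halve {m} {n} p = ℕ.*-cancelˡ-≡ m n 2 (≡.trans (double m) (≡.trans (ℤ.+-injective p) (≡.sym (double n))))
  where
  double : ∀ k → 2 ℕ.* k ≡ k ℕ.+ k
  double = ℕSolver.solve-∀

twice-triangle : ∀ n → + triangle n ℤ.+ + triangle n ≡ + n ℤ.* (+ n ℤ.+ 1ℤ)
twice-triangle zero    = ≡.refl
twice-triangle (suc n) = ≡.trans (lemma₁ (+ n) (+ triangle n))
  (≡.trans (cong (λ x → 1ℤ ℤ.+ + n ℤ.+ (1ℤ ℤ.+ + n) ℤ.+ x) (twice-triangle n)) (lemma₂ (+ n)))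
  where
  lemma₁ : ∀ x t → (1ℤ ℤ.+ x ℤ.+ t) ℤ.+ (1ℤ ℤ.+ x ℤ.+ t) ≡ 1ℤ ℤ.+ x ℤ.+ (1ℤ ℤ.+ x) ℤ.+ (t ℤ.+ t)
  lemma₁ = ℤSolver.solve-∀
  lemma₂ : ∀ x → 1ℤ ℤ.+ x ℤ.+ (1ℤ ℤ.+ x) ℤ.+ x ℤ.* (x ℤ.+ 1ℤ) ≡ (1ℤ ℤ.+ x) ℤ.* (1ℤ ℤ.+ x ℤ.+ 1ℤ)
  lemma₂ = ℤSolver.solve-∀

twice-tri : ∀ j → + tri j ℤ.+ + tri j ≡ j ℤ.* (j ℤ.- 1ℤ)
twice-tri (+ zero)  = ≡.refl
twice-tri (+ suc n) = ≡.trans (twice-triangle n) (lemma (+ n))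
  where
  lemma : ∀ x → x ℤ.* (x ℤ.+ 1ℤ) ≡ (1ℤ ℤ.+ x) ℤ.* (1ℤ ℤ.+ x ℤ.- 1ℤ)
  lemma = ℤSolver.solve-∀
twice-tri -[1+ n ]  = ≡.trans (twice-triangle (suc n)) (lemma (+ suc n))
  where
  lemma : ∀ x → x ℤ.* (x ℤ.+ 1ℤ) ≡ (ℤ.- x) ℤ.* (ℤ.- x ℤ.- 1ℤ)
  lemma = ℤSolver.solve-∀

twice-tri-succ : ∀ j → + tri (succ j) ℤ.+ + tri (succ j) ≡ (j ℤ.+ 1ℤ) ℤ.* j
twice-tri-succ j = ≡.trans (twice-tri (succ j))
  (≡.trans (cong (λ i → i ℤ.* (i ℤ.- 1ℤ)) (succ-+ j)) (cong ((j ℤ.+ 1ℤ) ℤ.*_) (lemma j)))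
  where
  lemma : ∀ j → j ℤ.+ 1ℤ ℤ.- 1ℤ ≡ j
  lemma = ℤSolver.solve-∀

tri-neg : ∀ j → tri (ℤ.- j) ≡ tri (succ j)
tri-neg (+ zero)        = ≡.refl
tri-neg (+ suc n)       = ≡.refl
tri-neg -[1+ zero ]     = ≡.refl
tri-neg -[1+ suc n ]    = ≡.refl

tri-succ-neg : ∀ j → tri (succ (ℤ.- j)) ≡ tri j
tri-succ-neg (+ zero)        = ≡.refl
tri-succ-neg (+ suc zero)    = ≡.refl
tri-succ-neg (+ suc (suc n)) = ≡.refl
tri-succ-neg -[1+ n ]        = ≡.refl

-- The exponent of a in term (aⁱ ⋯) (aᵏ ⋯) j, and its double as a polynomial in j.
expo : ℤ → ℕ → ℕ → ℕ
expo j i k = tri (succ j) ℕ.* i ℕ.+ tri j ℕ.* k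

quad : ℤ → ℤ → ℤ → ℤ
quad j i k = (j ℤ.+ 1ℤ) ℤ.* j ℤ.* i ℤ.+ j ℤ.* (j ℤ.- 1ℤ) ℤ.* k

twice-expo : ∀ j i k → + expo j i k ℤ.+ + expo j i k ≡ quad j (+ i) (+ k)
twice-expo j i k = ≡.trans
  (cong (λ x → x ℤ.+ x) (cong₂ ℤ._+_ (ℤ.pos-* (tri (succ j)) i) (ℤ.pos-* (tri j) k)))
  (≡.trans (lemma (+ tri (succ j)) (+ tri j) (+ i) (+ k))
    (cong₂ (λ x y → x ℤ.* + i ℤ.+ y ℤ.* + k) (twice-tri-succ j) (twice-tri j)))
  where
  lemma : ∀ p q i k → (p ℤ.* i ℤ.+ q ℤ.* k) ℤ.+ (p ℤ.* i ℤ.+ q ℤ.* k) ≡ (p ℤ.+ p) ℤ.* i ℤ.+ (q ℤ.+ q) ℤ.* k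
  lemma = ℤSolver.solve-∀

twice-expo-+ : ∀ m i k n i′ k′ →
  + (expo m i k ℕ.+ expo n i′ k′) ℤ.+ + (expo m i k ℕ.+ expo n i′ k′) ≡ quad m (+ i) (+ k) ℤ.+ quad
      n (+ i′) (+ k′)
twice-expo-+ m i k n i′ k′ = ≡.trans (lemma (+ expo m i k) (+ expo n i′ k′))
    (cong₂ ℤ._+_ (twice-expo m i k) (twice-expo n i′ k′))
  where
  lemma : ∀ x y → (x ℤ.+ y) ℤ.+ (x ℤ.+ y) ≡ (x ℤ.+ x) ℤ.+ (y ℤ.+ y)
  lemma = ℤSolver.solve-∀

module QuadraticExponents where
  open +-*-Solver

  private
    quadᵖ : ∀ {n} → Polynomial n → Polynomial n → Polynomial n → Polynomial n
    quadᵖ j i k = (j :+ con 1ℤ) :* j :* i :+ j :* (j :- con 1ℤ) :* k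

  quad-even : ∀ s d i k → quad (s ℤ.+ d) i k ℤ.+ quad (s ℤ.- d) i k ≡
              quad s (i ℤ.+ i) (k ℤ.+ k) ℤ.+ quad d (i ℤ.+ k) (i ℤ.+ k)
  quad-even = solve 4 (λ s d i k → quadᵖ (s :+ d) i k :+ quadᵖ (s :- d) i k :=
                quadᵖ s (i :+ i) (k :+ k) :+ quadᵖ d (i :+ k) (i :+ k)) ≡.refl

  -- Here h is the difference of the two exponents, the exponent of b/a in f(a, b). With h as a
  -- parameter no exponent needs subtraction.
  quad-odd : ∀ s d i h → quad (s ℤ.+ d ℤ.+ 1ℤ) i (i ℤ.+ h) ℤ.+ quad (s ℤ.- d) i (i ℤ.+ h) ≡
             + 2 ℤ.* i ℤ.+ (quad s (+ 4 ℤ.* i ℤ.+ h) h ℤ.+ quad d (+ 4 ℤ.* i ℤ.+ + 2 ℤ.* h) 0ℤ)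
  quad-odd = solve 4 (λ s d i h → quadᵖ (s :+ d :+ con 1ℤ) i (i :+ h) :+ quadᵖ (s :- d) i (i :+ h) :=
               con (+ 2) :* i :+ (quadᵖ s (con (+ 4) :* i :+ h) h :+ quadᵖ d
                   (con (+ 4) :* i :+ con (+ 2) :* h) (con 0ℤ))) ≡.refl

  quad-double : ∀ s i h → quad (s ℤ.+ s) i (i ℤ.+ h) ≡ quad s (+ 4 ℤ.* i ℤ.+ h) (+ 4 ℤ.* i ℤ.+ + 3 ℤ.* h)
  quad-double = solve 3 (λ s i h → quadᵖ (s :+ s) i (i :+ h) :=
                  quadᵖ s (con (+ 4) :* i :+ h) (con (+ 4) :* i :+ con (+ 3) :* h)) ≡.refl

  quad-double+1 : ∀ s i h → quad (s ℤ.+ s ℤ.+ 1ℤ) i (i ℤ.+ h) ≡ + 2 ℤ.* i ℤ.+ quad s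
      (+ 8 ℤ.* i ℤ.+ + 3 ℤ.* h) h
  quad-double+1 = solve 3 (λ s i h → quadᵖ (s :+ s :+ con 1ℤ) i (i :+ h) :=
                    con (+ 2) :* i :+ quadᵖ s (con (+ 8) :* i :+ con (+ 3) :* h) h) ≡.refl

open QuadraticExponents

expo-even : ∀ s d i k → expo (s ℤ.+ d) i k ℕ.+ expo (s ℤ.- d) i k ≡ expo s (i ℕ.+ i) (k ℕ.+ k) ℕ.+
    expo d (i ℕ.+ k) (i ℕ.+ k)
expo-even s d i k = halve (≡.trans (twice-expo-+ (s ℤ.+ d) i k (s ℤ.- d) i k)
  (≡.trans (quad-even s d (+ i) (+ k)) (≡.sym (twice-expo-+ s (i ℕ.+ i) (k ℕ.+ k) d (i ℕ.+ k) (i ℕ.+ k)))))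

quad-succ : ∀ j i k → quad (succ j) i k ≡ quad (j ℤ.+ 1ℤ) i k
quad-succ j i k = cong (λ j → quad j i k) (succ-+ j)

twice-+ : ∀ m n → + (m ℕ.+ n) ℤ.+ + (m ℕ.+ n) ≡ (+ m ℤ.+ + m) ℤ.+ (+ n ℤ.+ + n)
twice-+ m n = lemma (+ m) (+ n)
  where
  lemma : ∀ x y → (x ℤ.+ y) ℤ.+ (x ℤ.+ y) ≡ (x ℤ.+ x) ℤ.+ (y ℤ.+ y)
  lemma = ℤSolver.solve-∀

twice-pos : ∀ i → + 2 ℤ.* + i ≡ + i ℤ.+ + i
twice-pos i = lemma (+ i)
  where
  lemma : ∀ x → + 2 ℤ.* x ≡ x ℤ.+ x
  lemma = ℤSolver.solve-∀

pos-linear : ∀ m i n h → + m ℤ.* + i ℤ.+ + n ℤ.* + h ≡ + (m ℕ.* i ℕ.+ n ℕ.* h)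
pos-linear m i n h = cong₂ ℤ._+_ (≡.sym (ℤ.pos-* m i)) (≡.sym (ℤ.pos-* n h))

expo-odd : ∀ s d i h → expo (succ (s ℤ.+ d)) i (i ℕ.+ h) ℕ.+ expo (s ℤ.- d) i (i ℕ.+ h) ≡
           i ℕ.+ (expo s (4 ℕ.* i ℕ.+ h) h ℕ.+ expo d (4 ℕ.* i ℕ.+ 2 ℕ.* h) 0)
expo-odd s d i h = halve (begin
  + (expo m i k ℕ.+ expo n i k) ℤ.+ + (expo m i k ℕ.+ expo n i k)
    ≡⟨ twice-expo-+ m i k n i k ⟩
  quad m (+ i) (+ k) ℤ.+ quad n (+ i) (+ k)
    ≡⟨ cong (ℤ._+ quad n (+ i) (+ k)) (quad-succ (s ℤ.+ d) (+ i) (+ k)) ⟩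
  quad (s ℤ.+ d ℤ.+ 1ℤ) (+ i) (+ k) ℤ.+ quad n (+ i) (+ k)
    ≡⟨ quad-odd s d (+ i) (+ h) ⟩
  + 2 ℤ.* + i ℤ.+ (quad s (+ 4 ℤ.* + i ℤ.+ + h) (+ h) ℤ.+ quad d (+ 4 ℤ.* + i ℤ.+ + 2 ℤ.* + h) 0ℤ)
    ≡⟨ cong₂ ℤ._+_ (twice-pos i) (cong₂ (λ x y → quad s x (+ h) ℤ.+ quad d y 0ℤ)
         (cong (ℤ._+ + h) (≡.sym (ℤ.pos-* 4 i))) (pos-linear 4 i 2 h)) ⟩
  (+ i ℤ.+ + i) ℤ.+ (quad s (+ (4 ℕ.* i ℕ.+ h)) (+ h) ℤ.+ quad d (+ (4 ℕ.* i ℕ.+ 2 ℕ.* h)) 0ℤ)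
    ≡⟨ cong (λ x → (+ i ℤ.+ + i) ℤ.+ x) (twice-expo-+ s _ h d _ 0) ⟨
  (+ i ℤ.+ + i) ℤ.+ (+ e ℤ.+ + e)
    ≡⟨ twice-+ i e ⟨
  + (i ℕ.+ e) ℤ.+ + (i ℕ.+ e) ∎)
  where
  open ≡.≡-Reasoning
  k = i ℕ.+ h
  m = succ (s ℤ.+ d)
  n = s ℤ.- d
  e = expo s (4 ℕ.* i ℕ.+ h) h ℕ.+ expo d (4 ℕ.* i ℕ.+ 2 ℕ.* h) 0

expo-double : ∀ s i h → expo (s ℤ.+ s) i (i ℕ.+ h) ≡ expo s (4 ℕ.* i ℕ.+ h) (4 ℕ.* i ℕ.+ 3 ℕ.* h)
expo-double s i h = halve (≡.trans (twice-expo (s ℤ.+ s) i (i ℕ.+ h)) (≡.trans (quad-double s (+ i) (+ h))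
  (≡.trans (cong₂ (quad s) (cong (ℤ._+ + h) (≡.sym (ℤ.pos-* 4 i))) (pos-linear 4 i 3 h))
      (≡.sym (twice-expo s _ _)))))

expo-double+1 : ∀ s i h → expo (succ (s ℤ.+ s)) i (i ℕ.+ h) ≡ i ℕ.+ expo s (8 ℕ.* i ℕ.+ 3 ℕ.* h) h
expo-double+1 s i h = halve (≡.trans (twice-expo (succ (s ℤ.+ s)) i (i ℕ.+ h))
  (≡.trans (quad-succ (s ℤ.+ s) (+ i) (+ (i ℕ.+ h))) (≡.trans (quad-double+1 s (+ i) (+ h))
  (≡.trans (cong₂ ℤ._+_ (twice-pos i) (≡.trans (cong (λ x → quad s x (+ h)) (pos-linear 8 i 3 h))
      (≡.sym (twice-expo s _ h))))
    (≡.sym (twice-+ i _))))))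

-- The reflection j ↦ -j exchanges `tri j` and `tri (succ j)`.
θ-comm : ∀ a b → Ord 1 (a · b) → θ a b ≈ θ b a
θ-comm a b ab = ≈-by-mod λ K → let open Mod K in begin
  θ a b                                             ≈⟨ θ-mod ab ℕ.≤-refl ⟩
  sumℤ (suc K) (term a b)                           ≈⟨ sumℤ-neg (ord-term ab K) ⟨
  sumℤ (3 ℕ.+ K) (λ j → term a b (ℤ.- j))
      ≈⟨ sumℤ-cong (3 ℕ.+ K) (λ j _ → trans (*-comm _ _)
      (*-cong (↑-≡ b (tri-neg j)) (↑-≡ a (tri-succ-neg j)))) ⟩
  sumℤ (3 ℕ.+ K) (term b a)
      ≈⟨ θ-mod (Mod.trans 1 (Mod.*-comm 1 b a) ab) (ℕ.m≤n⇒m≤1+n (ℕ.m≤n⇒m≤1+n ℕ.≤-refl)) ⟨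
  θ b a                                             ∎

module _ {a g : PowerSeries} (a₁ : Ord 1 a) where

  opaque
    -- Monomials indexed by their exponents, so that products of terms reduce to the exponent
    -- identities above. The choice g = 1 occurs, for f(-x³, -x³).
    M : ℕ → ℕ → PowerSeries
    M i k = a ↑ i · g ↑ k

    M-def : ∀ i k → M i k ≡ a ↑ i · g ↑ k
    M-def i k = ≡.refl

    ord-M : ∀ i k i′ k′ → Ord 1 (M (suc i) k · M i′ k′)
    ord-M i k i′ k′ = ord-·ˡ _ (ord-·ˡ _ (ord-·ˡ _ a₁))

  module Monomials where
    open Series hiding (_≈_)

    opaque
      unfolding M

      M-· : ∀ i k i′ k′ → M i k · M i′ k′ ≈ M (i ℕ.+ i′) (k ℕ.+ k′)
      M-· i k i′ k′ = trans (*-interchange _ _ _ _) (sym (*-cong (↑-+ a i i′) (↑-+ g k k′)))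

      M-↑ : ∀ i k e → M i k ↑ e ≈ M (e ℕ.* i) (e ℕ.* k)
      M-↑ i k e = trans (↑-· _ _ e) (*-cong (↑-* a i e) (↑-* g k e))

    M-≡ : ∀ {i k i′ k′} → i ≡ i′ → k ≡ k′ → M i k ≈ M i′ k′
    M-≡ p r = reflexive (cong₂ M p r)

    term-M : ∀ i k i′ k′ j → term (M i k) (M i′ k′) j ≈ M (expo j i i′) (expo j k k′)
    term-M i k i′ k′ j = trans (*-cong (M-↑ i k (tri (succ j))) (M-↑ i′ k′ (tri j))) (M-· _ _ _ _)

    term-even : ∀ s d → term (M 1 0) (M 1 1) (s ℤ.+ d) · term (M 1 0) (M 1 1) (s ℤ.- d) ≈
                        term (M 2 0) (M 2 2) s · term (M 2 1) (M 2 1) d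
    term-even s d = trans (*-cong (term-M 1 0 1 1 (s ℤ.+ d)) (term-M 1 0 1 1 (s ℤ.- d))) (trans (M-· _ _ _ _)
      (trans (M-≡ (expo-even s d 1 1) (expo-even s d 0 1))
        (sym (trans (*-cong (term-M 2 0 2 2 s) (term-M 2 1 2 1 d)) (M-· _ _ _ _)))))

    term-odd : ∀ s d → term (M 1 0) (M 1 1) (succ (s ℤ.+ d)) · term (M 1 0) (M 1 1) (s ℤ.- d) ≈
                       M 1 0 · (term (M 4 1) (M 0 1) s · term (M 4 2) (M 0 0) d)
    term-odd s d = trans (*-cong (term-M 1 0 1 1 (succ (s ℤ.+ d))) (term-M 1 0 1 1 (s ℤ.- d)))
        (trans (M-· _ _ _ _)
      (trans (M-≡ (expo-odd s d 1 0) (expo-odd s d 0 1))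
        (sym (trans (*-congˡ (trans (*-cong (term-M 4 1 0 1 s) (term-M 4 2 0 0 d)) (M-· _ _ _ _)))
            (M-· 1 0 _ _)))))

    term-double : ∀ s → term (M 1 0) (M 1 1) (s ℤ.+ s) ≈ term (M 4 1) (M 4 3) s
    term-double s = trans (term-M 1 0 1 1 (s ℤ.+ s))
        (trans (M-≡ (expo-double s 1 0) (expo-double s 0 1)) (sym (term-M 4 1 4 3 s)))

    term-double+1 : ∀ s → term (M 1 0) (M 1 1) (succ (s ℤ.+ s)) ≈ M 1 0 · term (M 8 3) (M 0 1) s
    term-double+1 s = trans (term-M 1 0 1 1 (succ (s ℤ.+ s)))
        (trans (M-≡ (expo-double+1 s 1 0) (expo-double+1 s 0 1))
      (sym (trans (*-congˡ (term-M 8 3 0 1 s)) (M-· 1 0 _ _))))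

  open Monomials

  -- With b = a g this is f(a, b)² = f(a², b²) f(ab, ab) + a f(a³b, b/a) f(a²b², 1), from splitting
  -- the double sum by the parity of the sum of its indices. The parameter g stands for b/a, which
  -- need not exist for arbitrary series.
  θ-square : θ (M 1 0) (M 1 1) · θ (M 1 0) (M 1 1) ≈
             θ (M 2 0) (M 2 2) · θ (M 2 1) (M 2 1) ∔ M 1 0 · (θ (M 4 1) (M 0 1) · θ (M 4 2) (M 0 0))
  θ-square = ≈-by-mod λ K → let open Mod K; B = suc K; B≤2B = ℕ.m≤m+n B B in begin
    θ (M 1 0) (M 1 1) · θ (M 1 0) (M 1 1)
      ≈⟨ *-cong (θ-mod (ord-M 0 0 1 1) ℕ.≤-refl) (θ-mod (ord-M 0 0 1 1) ℕ.≤-refl) ⟩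
    sumℤ B t · sumℤ B t
      ≈⟨ sumℤ-· B B t t ⟩
    sumℤ B (λ i → sumℤ B (λ j → t i · t j))
      ≈⟨ sumℤ²-parity {B} {λ i j → t i · t j} (λ i j → [ (λ q → ord-·ˡ (t j) (ord-term (ord-M 0 0 1 1) K i q))
                                    , (λ q → ord-·ʳ (t i) (ord-term (ord-M 0 0 1 1) K j q)) ]′) ⟩
    sumℤ B (λ s → sumℤ (B ℕ.+ B) (λ d → t (s ℤ.+ d) · t (s ℤ.- d)))
      ∔ sumℤ B (λ s → sumℤ (B ℕ.+ B) (λ d → t (succ (s ℤ.+ d)) · t (s ℤ.- d)))
      ≈⟨ +-cong (sumℤ-cong B λ s _ → sumℤ-cong (B ℕ.+ B) λ d _ → restrict (term-even s d))
                (sumℤ-cong B λ s _ → trans (sumℤ-cong (B ℕ.+ B) λ d _ → restrict (term-odd s d))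
                    (sym (sumℤ-·ˡ (B ℕ.+ B) (M 1 0) _))) ⟩
    sumℤ B (λ s → sumℤ (B ℕ.+ B) (λ d → t₁ s · t₂ d)) ∔ sumℤ B
        (λ s → M 1 0 · sumℤ (B ℕ.+ B) (λ d → t₃ s · t₄ d))
      ≈⟨ +-cong (sumℤ-· B (B ℕ.+ B) t₁ t₂) (trans (*-congˡ (sumℤ-· B (B ℕ.+ B) t₃ t₄))
          (sumℤ-·ˡ B (M 1 0) _)) ⟨
    sumℤ B t₁ · sumℤ (B ℕ.+ B) t₂ ∔ M 1 0 · (sumℤ B t₃ · sumℤ (B ℕ.+ B) t₄)
      ≈⟨ +-cong (*-cong (θ-mod (ord-M 1 0 2 2) ℕ.≤-refl) (θ-mod (ord-M 1 1 2 1) B≤2B))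
                (*-congˡ (*-cong (θ-mod (ord-M 3 1 0 1) ℕ.≤-refl) (θ-mod (ord-M 3 2 0 0) B≤2B))) ⟨
    θ (M 2 0) (M 2 2) · θ (M 2 1) (M 2 1) ∔ M 1 0 · (θ (M 4 1) (M 0 1) · θ (M 4 2) (M 0 0)) ∎
    where
    t t₁ t₂ t₃ t₄ : ℤ → PowerSeries
    t  = term (M 1 0) (M 1 1)
    t₁ = term (M 2 0) (M 2 2)
    t₂ = term (M 2 1) (M 2 1)
    t₃ = term (M 4 1) (M 0 1)
    t₄ = term (M 4 2) (M 0 0)

  -- With b = a g: f(a, b) = f(a³b, ab³) + a f(a⁵b³, b/a), the even and the odd summation indices.
  θ-dissect : θ (M 1 0) (M 1 1) ≈ θ (M 4 1) (M 4 3) ∔ M 1 0 · θ (M 8 3) (M 0 1)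
  θ-dissect = ≈-by-mod λ K → let open Mod K; B = suc K in begin
    θ (M 1 0) (M 1 1)
      ≈⟨ θ-mod (ord-M 0 0 1 1) (ℕ.m≤m+n B B) ⟩
    sumℤ (B ℕ.+ B) t
      ≈⟨ sumℤ-parity B t ⟩
    sumℤ B (λ s → t (s ℤ.+ s)) ∔ sumℤ B (λ s → t (succ (s ℤ.+ s)))
      ≈⟨ +-cong (sumℤ-cong B λ s _ → restrict (term-double s))
                (trans (sumℤ-cong B λ s _ → restrict (term-double+1 s)) (sym (sumℤ-·ˡ B (M 1 0) _))) ⟩
    sumℤ B (term (M 4 1) (M 4 3)) ∔ M 1 0 · sumℤ B (term (M 8 3) (M 0 1))
      ≈⟨ +-cong (θ-mod (ord-M 3 1 4 3) ℕ.≤-refl) (*-congˡ (θ-mod (ord-M 7 3 0 1) ℕ.≤-refl)) ⟨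
    θ (M 4 1) (M 4 3) ∔ M 1 0 · θ (M 8 3) (M 0 1) ∎
    where
    t : ℤ → PowerSeries
    t = term (M 1 0) (M 1 1)

-- Theta functions as products

-𝟙 : PowerSeries
-𝟙 = neg 𝟙

-𝟙·-𝟙 : -𝟙 · -𝟙 ≈ 𝟙
-𝟙·-𝟙 = trans (sym (-‿distribˡ-* 𝟙 -𝟙)) (trans (-‿cong (*-identityˡ -𝟙)) (-‿involutive 𝟙))
  where open Series

module _ (x : PowerSeries) where

  factor : PowerSeries → ℕ → ℕ → ℕ → PowerSeries
  factor σ m b k = 𝟙 ∔ σ · x ↑ (b ℕ.+ k ℕ.* m)

  -- The product (-σ x^b; x^m)_∞, where σ is a sign.
  P : PowerSeries → ℕ → ℕ → PowerSeries
  P σ m b = ∏ (factor σ m b)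

  -- f_j with x in place of q.
  F : ℕ → PowerSeries
  F j = P -𝟙 j j

  Θ : PowerSeries → ℕ → ℕ → PowerSeries
  Θ σ i k = θ (σ · x ↑ i) (σ · x ↑ k)

module Products {x : PowerSeries} (x₁ : Ord 1 x) where

  factor-tame : ∀ σ m b → .{{NonZero m}} → Tame (factor x σ m b)
  factor-tame σ m b k = trans (+-congˡ (ord-·ʳ σ (weaken k≤ (ord-↑ x₁ (b ℕ.+ k ℕ.* m))))) (+-identityʳ 𝟙)
    where
    open Mod k
    k≤ : k ≤ b ℕ.+ k ℕ.* m
    k≤ = ℕ.≤-trans (ℕ.m≤m*n k m) (ℕ.m≤n+m _ b)

  open Series hiding (_≈_)

  factor-≡ : ∀ σ {d e} → d ≡ e → 𝟙 ∔ σ · x ↑ d ≈ 𝟙 ∔ σ · x ↑ e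
  factor-≡ σ p = reflexive (cong (λ e → 𝟙 ∔ σ · x ↑ e) p)

  P-split₂ : ∀ σ m b → .{{NonZero m}} → P x σ m b ≈ P x σ (2 ℕ.* m) b · P x σ (2 ℕ.* m) (b ℕ.+ m)
  P-split₂ σ m b = trans (∏-split₂ (factor-tame σ m b))
    (*-cong (∏-cong λ k → factor-≡ σ (eq₀ b k m)) (∏-cong λ k → factor-≡ σ (eq₁ b k m)))
    where
    eq₀ : ∀ b k m → b ℕ.+ k ℕ.* 2 ℕ.* m ≡ b ℕ.+ k ℕ.* (2 ℕ.* m)
    eq₀ = ℕSolver.solve-∀
    eq₁ : ∀ b k m → b ℕ.+ suc (k ℕ.* 2) ℕ.* m ≡ b ℕ.+ m ℕ.+ k ℕ.* (2 ℕ.* m)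
    eq₁ = ℕSolver.solve-∀

  P-split₃ : ∀ σ m b → .{{NonZero m}} →
             P x σ m b ≈ P x σ (3 ℕ.* m) b · P x σ (3 ℕ.* m) (b ℕ.+ m) · P x σ (3 ℕ.* m) (b ℕ.+ 2 ℕ.* m)
  P-split₃ σ m b = trans (∏-split₃ (factor-tame σ m b))
    (*-cong (*-cong (∏-cong λ k → factor-≡ σ (eq₀ b k m)) (∏-cong λ k → factor-≡ σ (eq₁ b k m)))
            (∏-cong λ k → factor-≡ σ (eq₂ b k m)))
    where
    eq₀ : ∀ b k m → b ℕ.+ k ℕ.* 3 ℕ.* m ≡ b ℕ.+ k ℕ.* (3 ℕ.* m)
    eq₀ = ℕSolver.solve-∀
    eq₁ : ∀ b k m → b ℕ.+ (1 ℕ.+ k ℕ.* 3) ℕ.* m ≡ b ℕ.+ m ℕ.+ k ℕ.* (3 ℕ.* m)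
    eq₁ = ℕSolver.solve-∀
    eq₂ : ∀ b k m → b ℕ.+ (2 ℕ.+ k ℕ.* 3) ℕ.* m ≡ b ℕ.+ 2 ℕ.* m ℕ.+ k ℕ.* (3 ℕ.* m)
    eq₂ = ℕSolver.solve-∀

  P-pair : ∀ m b → .{{NonZero m}} → P x 𝟙 m b · P x -𝟙 m b ≈ P x -𝟙 (2 ℕ.* m) (2 ℕ.* b)
  P-pair m b = trans (sym (∏-· (factor-tame 𝟙 m b) (factor-tame -𝟙 m b))) (∏-cong λ k → begin
      (𝟙 ∔ 𝟙 · y k) · (𝟙 ∔ -𝟙 · y k)
        ≈⟨ *-cong (+-congˡ (*-identityˡ _)) (+-congˡ
            (trans (sym (-‿distribˡ-* 𝟙 (y k))) (-‿cong (*-identityˡ _)))) ⟩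
      (𝟙 ∔ y k) · (𝟙 ∔ neg (y k))
        ≈⟨ trans (distribʳ _ _ _) (+-cong (*-identityˡ _)
            (trans (distribˡ _ _ _) (+-congʳ (*-identityʳ _)))) ⟩
      (𝟙 ∔ neg (y k)) ∔ (y k ∔ y k · neg (y k))
        ≈⟨ trans (+-assoc _ _ _) (+-congˡ (trans (sym (+-assoc _ _ _))
            (trans (+-congʳ (-‿inverseˡ (y k))) (+-identityˡ _)))) ⟩
      𝟙 ∔ y k · neg (y k)
        ≈⟨ +-congˡ (trans (sym (-‿distribʳ-* (y k) (y k)))
            (trans (-‿cong (trans (sym (↑-+ x (e k) (e k))) (sym (*-identityˡ _)))) (-‿distribˡ-* 𝟙 _))) ⟩
      𝟙 ∔ -𝟙 · x ↑ (e k ℕ.+ e k)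
        ≈⟨ factor-≡ -𝟙 (eq b k m) ⟩
      factor x -𝟙 (2 ℕ.* m) (2 ℕ.* b) k ∎)
    where
    e : ℕ → ℕ
    e k = b ℕ.+ k ℕ.* m
    y : ℕ → PowerSeries
    y k = x ↑ e k
    eq : ∀ b k m → (b ℕ.+ k ℕ.* m) ℕ.+ (b ℕ.+ k ℕ.* m) ≡ 2 ℕ.* b ℕ.+ k ℕ.* (2 ℕ.* m)
    eq = ℕSolver.solve-∀

  P-head : ∀ σ m b → .{{NonZero m}} → P x σ m b ≈ (𝟙 ∔ σ · x ↑ b) · P x σ m (b ℕ.+ m)
  P-head σ m b = trans (∏-head (factor-tame σ m b))
    (*-cong (factor-≡ σ (ℕ.+-identityʳ b)) (∏-cong λ k → factor-≡ σ (≡.sym (ℕ.+-assoc b m (k ℕ.* m)))))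

  -- As σ² = 1, the two arguments multiply to the pure power x^(i+k), the `c` of Jacobi's identity.
  Θ-product : ∀ σ → σ · σ ≈ 𝟙 → ∀ i k → .{{NonZero (i ℕ.+ k)}} →
              Θ x σ i k ≈ P x σ (i ℕ.+ k) i · P x σ (i ℕ.+ k) k · F x (i ℕ.+ k)
  Θ-product σ σσ i k = trans jacobi (*-cong (*-cong (∏-cong (shift i)) (∏-cong (shift k))) (∏-cong last))
    where
    c = x ↑ (i ℕ.+ k)
    c≈ : c ≈ (σ · x ↑ i) · (σ · x ↑ k)
    c≈ = sym (trans (*-interchange _ _ _ _) (trans (*-cong σσ (sym (↑-+ x i k))) (*-identityˡ _)))
    1≤ : ∀ n → .{{NonZero n}} → 1 ≤ n
    1≤ (suc n) = s≤s z≤n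
    open JacobiTripleProduct c≈ (weaken (1≤ (i ℕ.+ k)) (ord-↑ x₁ (i ℕ.+ k)))
    shift : ∀ d n → 𝟙 ∔ (σ · x ↑ d) · c ↑ n ≈ factor x σ (i ℕ.+ k) d n
    shift d n = +-congˡ (trans (*-assoc _ _ _) (*-congˡ
        (trans (*-congˡ (↑-* x (i ℕ.+ k) n)) (sym (↑-+ x d _)))))
    last : ∀ n → 1-c n ≈ factor x -𝟙 (i ℕ.+ k) (i ℕ.+ k) n
    last n = +-congˡ (trans (-‿cong (trans (↑-* x (i ℕ.+ k) (suc n)) (sym (*-identityˡ _))))
        (-‿distribˡ-* 𝟙 _))

  module _ (σ : PowerSeries) (σσ : σ · σ ≈ 𝟙) (α γ : ℕ) where

    private
      e : ℕ → ℕ → ℕ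
      e i k = i ℕ.* α ℕ.+ k ℕ.* γ

      σ² : σ ↑ 2 ≈ 𝟙
      σ² = trans (*-congˡ (↑-1 σ)) σσ

      σ⁴ : σ ↑ 4 ≈ 𝟙
      σ⁴ = trans (↑-+ σ 2 2) (trans (*-cong σ² σ²) (*-identityˡ 𝟙))

      σ⁸ : σ ↑ 8 ≈ 𝟙
      σ⁸ = trans (↑-+ σ 4 4) (trans (*-cong σ⁴ σ⁴) (*-identityˡ 𝟙))

    module _ (a₁ : Ord 1 (σ · x ↑ α)) where

      M-x : ∀ {τ} i k → σ ↑ i ≈ τ → M {σ · x ↑ α} {x ↑ γ} a₁ i k ≈ τ · x ↑ e i k
      M-x i k p = begin
        M a₁ i k                                     ≡⟨ M-def a₁ i k ⟩
        (σ · x ↑ α) ↑ i · (x ↑ γ) ↑ k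
            ≈⟨ *-cong (trans (↑-· σ _ i) (*-cong p (↑-* x α i))) (↑-* x γ k) ⟩
        _ · x ↑ (i ℕ.* α) · x ↑ (k ℕ.* γ)            ≈⟨ *-assoc _ _ _ ⟩
        _ · (x ↑ (i ℕ.* α) · x ↑ (k ℕ.* γ))          ≈⟨ *-congˡ (↑-+ x (i ℕ.* α) (k ℕ.* γ)) ⟨
        _ · x ↑ e i k                                ∎

      Θ-square : Θ x σ (e 1 0) (e 1 1) · Θ x σ (e 1 0) (e 1 1) ≈
                 Θ x 𝟙 (e 2 0) (e 2 2) · Θ x 𝟙 (e 2 1) (e 2 1)
                 ∔ σ · x ↑ e 1 0 · (Θ x 𝟙 (e 4 1) (e 0 1) · Θ x 𝟙 (e 4 2) (e 0 0))
      Θ-square = begin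
        _ ≈⟨ *-cong (θ-cong (M-x 1 0 (↑-1 σ)) (M-x 1 1 (↑-1 σ)))
            (θ-cong (M-x 1 0 (↑-1 σ)) (M-x 1 1 (↑-1 σ))) ⟨
        _ ≈⟨ θ-square {σ · x ↑ α} {x ↑ γ} a₁ ⟩
        _ ≈⟨ +-cong (*-cong (θ-cong (M-x 2 0 σ²) (M-x 2 2 σ²)) (θ-cong (M-x 2 1 σ²) (M-x 2 1 σ²)))
                    (*-cong (M-x 1 0 (↑-1 σ)) (*-cong (θ-cong (M-x 4 1 σ⁴) (M-x 0 1 refl))
                        (θ-cong (M-x 4 2 σ⁴) (M-x 0 0 refl)))) ⟩
        _ ∎

      Θ-dissect : Θ x σ (e 1 0) (e 1 1) ≈ Θ x 𝟙 (e 4 1) (e 4 3) ∔ σ · x ↑ e 1 0 · Θ x 𝟙 (e 8 3) (e 0 1)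
      Θ-dissect = begin
        _ ≈⟨ θ-cong (M-x 1 0 (↑-1 σ)) (M-x 1 1 (↑-1 σ)) ⟨
        _ ≈⟨ θ-dissect {σ · x ↑ α} {x ↑ γ} a₁ ⟩
        _ ≈⟨ +-cong (θ-cong (M-x 4 1 σ⁴) (M-x 4 3 σ⁴))
            (*-cong (M-x 1 0 (↑-1 σ)) (θ-cong (M-x 8 3 σ⁸) (M-x 0 1 refl))) ⟩
        _ ∎

  ord-σx : ∀ σ α → Ord 1 (σ · x ↑ suc α)
  ord-σx σ α = ord-·ʳ σ (weaken {1} {suc α} (s≤s z≤n) (ord-↑ x₁ (suc α)))

  Θ-comm : ∀ σ i k → Θ x σ (suc i) k ≈ Θ x σ k (suc i)
  Θ-comm σ i k = θ-comm _ _ (ord-·ˡ _ (ord-σx σ i))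

  𝟙·𝟙 : 𝟙 · 𝟙 ≈ 𝟙
  𝟙·𝟙 = *-identityˡ 𝟙

  private
    module Theta where
      A = Θ x 𝟙 8 16
      B = Θ x 𝟙 20 4
      C = Θ x 𝟙 12 12
      D = Θ x 𝟙 24 0

      sq₄ : Θ x -𝟙 4 8 · Θ x -𝟙 4 8 ≈ A · C ∔ -𝟙 · x ↑ 4 · (B · D)
      sq₄ = Θ-square -𝟙 -𝟙·-𝟙 4 4 (ord-σx -𝟙 3)

      sq₂ : Θ x -𝟙 2 10 · Θ x -𝟙 2 10 ≈ B · C ∔ -𝟙 · x ↑ 2 · (A · D)
      sq₂ = trans (Θ-square -𝟙 -𝟙·-𝟙 2 8 (ord-σx -𝟙 1))
        (+-cong (*-congʳ (Θ-comm 𝟙 3 20)) (*-congˡ (*-congʳ (Θ-comm 𝟙 15 8))))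

      di₁ : Θ x 𝟙 1 5 ≈ A ∔ 𝟙 · x ↑ 1 · B
      di₁ = Θ-dissect 𝟙 𝟙·𝟙 1 4 (ord-σx 𝟙 0)

      di₃ : Θ x -𝟙 3 3 ≈ C ∔ -𝟙 · x ↑ 3 · D
      di₃ = Θ-dissect -𝟙 -𝟙·-𝟙 3 0 (ord-σx -𝟙 2)

  open Theta

  -- The same four thetas A, B, C, D occur throughout: the squares are AC - x⁴BD and BC - x²AD, and
  -- the factors on the right are A + xB and C - x³D. Expanding their product gives the left side.
  Θ-identity : Θ x -𝟙 4 8 · Θ x -𝟙 4 8 ∔ x · (Θ x -𝟙 2 10 · Θ x -𝟙 2 10) ≈ Θ x 𝟙 1 5 · Θ x -𝟙 3 3
  Θ-identity = begin
    Θ x -𝟙 4 8 · Θ x -𝟙 4 8 ∔ x · (Θ x -𝟙 2 10 · Θ x -𝟙 2 10)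
      ≈⟨ +-cong sq₄ (*-congˡ sq₂) ⟩
    (A · C ∔ -𝟙 · (x · (x · x ↑ 2)) · (B · D)) ∔ x · (B · C ∔ -𝟙 · x ↑ 2 · (A · D))
      ≈⟨ solve 7 (λ x y m A B C D →
           ((A :* C) :+ ((m :* (x :* (x :* y))) :* (B :* D))) :+
               (x :* ((B :* C) :+ ((m :* y) :* (A :* D)))) :=
           (A :+ (x :* B)) :* (C :+ ((m :* (x :* y)) :* D))) refl x (x ↑ 2) -𝟙 A B C D ⟩
    (A ∔ x · B) · (C ∔ -𝟙 · (x · x ↑ 2) · D)
      ≈⟨ *-cong (trans di₁ (+-congˡ (*-congʳ (trans (*-identityˡ _) (↑-1 x))))) di₃ ⟨
    Θ x 𝟙 1 5 · Θ x -𝟙 3 3 ∎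
    where open Solve

  Θ-square₁ : Θ x -𝟙 1 2 · Θ x -𝟙 1 2 ≈ Θ x 𝟙 2 4 · Θ x 𝟙 3 3 ∔ -𝟙 · x · (Θ x 𝟙 5 1 · Θ x 𝟙 6 0)
  Θ-square₁ = trans (Θ-square -𝟙 -𝟙·-𝟙 1 1 (ord-σx -𝟙 0)) (+-congˡ (*-congʳ (*-congˡ (↑-1 x))))

-- Eta quotient identities in a general variable

open Series.SolveMonoid public using (Expr; id; _⊕_; _⊜_) renaming (solve to ·-solve)

infixr 8 _⋆_
-- Repeats the recursion of `↑`, down to the final unit, so that a solver expression denotes the
-- power by computation.
_⋆_ : ∀ {n} → Expr n → ℕ → Expr n
e ⋆ zero  = id
e ⋆ suc k = e ⊕ e ⋆ k

module EtaIdentities {x : PowerSeries} (x₁ : Ord 1 x) where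
  open Products x₁
  open Series hiding (_≈_)

  private
    -- These are (x^i; x^12)_∞ and (-x^i; x^6)_∞. Splitting each f_j into residue classes modulo 12
    -- turns eta identities into rearrangements of such factors.
    p P⁺ : ℕ → PowerSeries
    p i = P x -𝟙 12 i
    P⁺ i = P x 𝟙 6 i

  F₆ : F x 6 ≈ p 6 · F x 12
  F₆ = P-split₂ -𝟙 6 6

  F₄ : F x 4 ≈ p 4 · p 8 · F x 12
  F₄ = P-split₃ -𝟙 4 4

  F₃ : F x 3 ≈ (p 3 · p 9) · F x 6
  F₃ = trans (P-split₂ -𝟙 3 3) (*-congʳ (P-split₂ -𝟙 6 3))

  F₂ : F x 2 ≈ (p 2 · p 8) · (p 4 · p 10) · F x 6
  F₂ = trans (P-split₃ -𝟙 2 2) (*-congʳ (*-cong (P-split₂ -𝟙 6 2) (P-split₂ -𝟙 6 4)))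

  F₁ : F x 1 ≈ ((p 1 · p 7) · (p 3 · p 9) · (p 5 · p 11)) · F x 2
  F₁ = trans (P-split₂ -𝟙 1 1) (*-congʳ (trans (P-split₃ -𝟙 2 1)
    (*-cong (*-cong (P-split₂ -𝟙 6 1) (P-split₂ -𝟙 6 3)) (P-split₂ -𝟙 6 5))))

  pair : ∀ i → P⁺ i · (p i · p (i ℕ.+ 6)) ≈ p (2 ℕ.* i)
  pair i = trans (*-congˡ (sym (P-split₂ -𝟙 6 i))) (P-pair 6 i)

  -- Evaluates (x², x¹⁰; x¹²)_∞ as f₂f₁₂/(f₄f₆).
  F₂F₁₂ : F x 2 · F x 12 ≈ p 2 · p 10 · F x 4 · F x 6
  F₂F₁₂ = begin
    F x 2 · F x 12
      ≈⟨ *-congʳ F₂ ⟩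
    (p 2 · p 8) · (p 4 · p 10) · F x 6 · F x 12
      ≈⟨ ·-solve 6 (λ a b c d e f → (((a ⊕ b) ⊕ (c ⊕ d)) ⊕ e) ⊕ f ⊜ ((a ⊕ d) ⊕ ((c ⊕ b) ⊕ f)) ⊕ e)
          refl (p 2) (p 8) (p 4) (p 10) (F x 6) (F x 12) ⟩
    p 2 · p 10 · (p 4 · p 8 · F x 12) · F x 6
      ≈⟨ *-congʳ (*-congˡ F₄) ⟨
    p 2 · p 10 · F x 4 · F x 6 ∎

  -- With `F₂F₁₂` and `F₃` it gives (-x, -x⁵; x⁶)_∞ = f₂²f₃f₁₂/(f₁f₄f₆²).
  P⁺₁₅ : P⁺ 1 · P⁺ 5 · F x 1 ≈ p 2 · p 10 · (p 3 · p 9) · F x 2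
  P⁺₁₅ = begin
    P⁺ 1 · P⁺ 5 · F x 1
      ≈⟨ *-congˡ F₁ ⟩
    P⁺ 1 · P⁺ 5 · (((p 1 · p 7) · (p 3 · p 9) · (p 5 · p 11)) · F x 2)
      ≈⟨ ·-solve 6 (λ a b c d e f → (a ⊕ b) ⊕ (((c ⊕ d) ⊕ e) ⊕ f) ⊜ (((a ⊕ c) ⊕ (b ⊕ e)) ⊕ d) ⊕ f) refl
           (P⁺ 1) (P⁺ 5) (p 1 · p 7) (p 3 · p 9) (p 5 · p 11) (F x 2) ⟩
    (P⁺ 1 · (p 1 · p 7)) · (P⁺ 5 · (p 5 · p 11)) · (p 3 · p 9) · F x 2
      ≈⟨ *-congʳ (*-congʳ (*-cong (pair 1) (pair 5))) ⟩
    p 2 · p 10 · (p 3 · p 9) · F x 2 ∎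

  private
    w T : PowerSeries
    w = p 3 · p 9
    T = p 2 · p 10 · F x 12

  -- `Θ-identity` in product form: f(-x⁴, -x⁸) = f₄, f(-x², -x¹⁰) = T = f₂f₁₂²/(f₄f₆), and the last
  -- factor is f(-x³, -x³) = f₃²/f₆ because w = f₃/f₆.
  F₄²+xT² : F x 4 · F x 4 ∔ x · (T · T) ≈ (P⁺ 1 · P⁺ 5 · F x 6) · (w · w · F x 6)
  F₄²+xT² = begin
    F x 4 · F x 4 ∔ x · (T · T)
      ≈⟨ +-cong (*-cong θ₄ θ₄) (*-congˡ (*-cong θ₂ θ₂)) ⟨
    Θ x -𝟙 4 8 · Θ x -𝟙 4 8 ∔ x · (Θ x -𝟙 2 10 · Θ x -𝟙 2 10)
      ≈⟨ Θ-identity ⟩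
    Θ x 𝟙 1 5 · Θ x -𝟙 3 3
      ≈⟨ *-cong (Θ-product 𝟙 𝟙·𝟙 1 5) (trans (Θ-product -𝟙 -𝟙·-𝟙 3 3)
          (*-congʳ (*-cong (P-split₂ -𝟙 6 3) (P-split₂ -𝟙 6 3)))) ⟩
    (P⁺ 1 · P⁺ 5 · F x 6) · (w · w · F x 6) ∎
    where
    θ₄ : Θ x -𝟙 4 8 ≈ F x 4
    θ₄ = trans (Θ-product -𝟙 -𝟙·-𝟙 4 8) (sym F₄)
    θ₂ : Θ x -𝟙 2 10 ≈ T
    θ₂ = Θ-product -𝟙 -𝟙·-𝟙 2 10

  -- f₃³/f₁ = f₄³f₆²/(f₂²f₁₂) + x f₁₂³/f₄
  f₃³/f₁-dissection : F x 3 ↑ 3 · F x 2 ↑ 2 · F x 12 · F x 4 ≈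
                      F x 1 · (F x 4 ↑ 4 · F x 6 ↑ 2 ∔ x · (F x 12 ↑ 4 · F x 2 ↑ 2))
  f₃³/f₁-dissection = sym (begin
    f₁ · (f₄ ↑ 4 · f₆ ↑ 2 ∔ x · (f₁₂ ↑ 4 · f₂ ↑ 2))
      -- Since f₂f₁₂² = f₄f₆T, the bracket is f₄²f₆² (f₄² + xT²).
      ≈⟨ *-congˡ (+-congˡ (*-congˡ (·-solve 2 (λ a b → a ⋆ 4 ⊕ b ⋆ 2 ⊜ (a ⊕ a) ⊕
          ((b ⊕ a) ⊕ (b ⊕ a))) refl f₁₂ f₂))) ⟩
    f₁ · (f₄ ↑ 4 · f₆ ↑ 2 ∔ x · (f₁₂ · f₁₂ · (f₂ · f₁₂ · (f₂ · f₁₂))))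
      ≈⟨ *-congˡ (+-congˡ (*-congˡ (*-congˡ (*-cong F₂F₁₂ F₂F₁₂)))) ⟩
    f₁ · (f₄ ↑ 4 · f₆ ↑ 2 ∔ x · (f₁₂ · f₁₂ · (p 2 · p 10 · f₄ · f₆ · (p 2 · p 10 · f₄ · f₆))))
      ≈⟨ *-congˡ (+-cong (·-solve 2 (λ a b → a ⋆ 4 ⊕ b ⋆ 2 ⊜ ((a ⊕ a) ⊕ (b ⊕ b)) ⊕ (a ⊕ a)) refl f₄ f₆)
           (·-solve 5 (λ x a b c d → x ⊕ ((a ⊕ a) ⊕ (((b ⊕ c) ⊕ d) ⊕ ((b ⊕ c) ⊕ d))) ⊜
              ((c ⊕ c) ⊕ (d ⊕ d)) ⊕ (x ⊕ ((b ⊕ a) ⊕ (b ⊕ a)))) refl x f₁₂ (p 2 · p 10) f₄ f₆)) ⟩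
    f₁ · (f₄ · f₄ · (f₆ · f₆) · (f₄ · f₄) ∔ f₄ · f₄ · (f₆ · f₆) · (x · (T · T)))
      ≈⟨ *-congˡ (trans (sym (distribˡ _ _ _)) (*-congˡ F₄²+xT²)) ⟩
    f₁ · (f₄ · f₄ · (f₆ · f₆) · ((P⁺ 1 · P⁺ 5 · f₆) · (w · w · f₆)))
      ≈⟨ ·-solve 5 (λ a d f m w → a ⊕ (((d ⊕ d) ⊕ (f ⊕ f)) ⊕ ((m ⊕ f) ⊕ ((w ⊕ w) ⊕ f))) ⊜
           (m ⊕ a) ⊕ (d ⋆ 2 ⊕ (f ⋆ 4 ⊕ w ⋆ 2))) refl f₁ f₄ f₆ (P⁺ 1 · P⁺ 5) w ⟩
    P⁺ 1 · P⁺ 5 · f₁ · (f₄ ↑ 2 · (f₆ ↑ 4 · w ↑ 2))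
      ≈⟨ *-congʳ P⁺₁₅ ⟩
    p 2 · p 10 · w · f₂ · (f₄ ↑ 2 · (f₆ ↑ 4 · w ↑ 2))
      ≈⟨ ·-solve 5 (λ t w b d f → ((t ⊕ w) ⊕ b) ⊕ (d ⋆ 2 ⊕ (f ⋆ 4 ⊕ w ⋆ 2)) ⊜
           (((w ⊕ f) ⋆ 3 ⊕ b) ⊕ ((t ⊕ d) ⊕ f)) ⊕ d) refl (p 2 · p 10) w f₂ f₄ f₆ ⟩
    (w · f₆) ↑ 3 · f₂ · (p 2 · p 10 · f₄ · f₆) · f₄
      ≈⟨ *-congʳ (*-cong (*-congʳ (↑-cong 3 F₃)) F₂F₁₂) ⟨
    f₃ ↑ 3 · f₂ · (f₂ · f₁₂) · f₄
      ≈⟨ ·-solve 4 (λ c b l d → ((c ⊕ b) ⊕ (b ⊕ l)) ⊕ d ⊜ ((c ⊕ b ⋆ 2) ⊕ l) ⊕ d) refl (f₃ ↑ 3) f₂ f₁₂ f₄ ⟩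
    f₃ ↑ 3 · f₂ ↑ 2 · f₁₂ · f₄ ∎)
    where
    f₁ = F x 1
    f₂ = F x 2
    f₃ = F x 3
    f₄ = F x 4
    f₆ = F x 6
    f₁₂ = F x 12

  -- f₁² = f₄f₆⁷/(f₂f₃²f₁₂³) - 2x f₂²f₃f₁₂³/(f₁f₄f₆²)
  f₁²-dissection : F x 1 ↑ 3 · (F x 2 · F x 3 ↑ 2 · F x 4 · F x 6 ↑ 2 · F x 12 ↑ 3) ≈
                   F x 1 · F x 4 ↑ 2 · F x 6 ↑ 9
                   ∔ (𝟙 ∔ 𝟙) · (-𝟙 · x · (F x 2 ↑ 3 · F x 3 ↑ 3 · F x 12 ↑ 6))
  f₁²-dissection = begin
    f₁ ↑ 3 · (f₂ · f₃ ↑ 2 · f₄ · f₆ ↑ 2 · f₁₂ ↑ 3)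
      ≈⟨ ·-solve 2 (λ a z → a ⋆ 3 ⊕ z ⊜ (a ⊕ a) ⊕ (a ⊕ z)) refl f₁ (f₂ · f₃ ↑ 2 · f₄ · f₆ ↑ 2 · f₁₂ ↑ 3) ⟩
    f₁ · f₁ · Z
      ≈⟨ *-congʳ (*-cong θ₁ θ₁) ⟨
    Θ x -𝟙 1 2 · Θ x -𝟙 1 2 · Z
      ≈⟨ *-congʳ Θ-square₁ ⟩
    (Θ x 𝟙 2 4 · Θ x 𝟙 3 3 ∔ -𝟙 · x · (Θ x 𝟙 5 1 · Θ x 𝟙 6 0)) · Z
      -- The product for f(x⁶, 1) starts with the factor 1 + x⁰ = 2, the origin of the coefficient
      -- 2.
      ≈⟨ *-congʳ (+-cong (*-cong (Θ-product 𝟙 𝟙·𝟙 2 4) (Θ-product 𝟙 𝟙·𝟙 3 3))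
           (*-congˡ (*-cong (Θ-product 𝟙 𝟙·𝟙 5 1) (trans (Θ-product 𝟙 𝟙·𝟙 6 0)
             (*-congʳ (*-congˡ (trans (P-head 𝟙 6 0) (*-congʳ (+-congˡ (*-identityˡ 𝟙)))))))))) ⟩
    ((P⁺ 2 · P⁺ 4 · f₆) · (P⁺ 3 · P⁺ 3 · f₆) ∔
      -𝟙 · x · ((P⁺ 5 · P⁺ 1 · f₆) · (P⁺ 6 · ((𝟙 ∔ 𝟙) · P⁺ 6) · f₆))) · Z
      ≈⟨ distribʳ _ _ _ ⟩
    (P⁺ 2 · P⁺ 4 · f₆) · (P⁺ 3 · P⁺ 3 · f₆) · Z ∔
      -𝟙 · x · ((P⁺ 5 · P⁺ 1 · f₆) · (P⁺ 6 · ((𝟙 ∔ 𝟙) · P⁺ 6) · f₆)) · Z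
      ≈⟨ +-cong first second ⟩
    f₁ · f₄ ↑ 2 · f₆ ↑ 9 ∔ (𝟙 ∔ 𝟙) · (-𝟙 · x · (f₂ ↑ 3 · f₃ ↑ 3 · f₁₂ ↑ 6)) ∎
    where
    f₁ = F x 1
    f₂ = F x 2
    f₃ = F x 3
    f₄ = F x 4
    f₆ = F x 6
    f₁₂ = F x 12
    Z = f₁ · (f₂ · f₃ ↑ 2 · f₄ · f₆ ↑ 2 · f₁₂ ↑ 3)

    θ₁ : Θ x -𝟙 1 2 ≈ f₁
    θ₁ = trans (Θ-product -𝟙 -𝟙·-𝟙 1 2) (sym (P-split₃ -𝟙 1 1))

    P⁺₂₄ : P⁺ 2 · P⁺ 4 · f₂ ≈ p 4 · p 8 · f₆
    P⁺₂₄ = trans (*-congˡ F₂) (trans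
      (·-solve 5 (λ a b c d f → (a ⊕ b) ⊕ ((c ⊕ d) ⊕ f) ⊜ ((a ⊕ c) ⊕ (b ⊕ d)) ⊕ f) refl (P⁺ 2)
          (P⁺ 4) (p 2 · p 8) (p 4 · p 10) f₆)
      (*-congʳ (*-cong (pair 2) (pair 4))))

    P⁺₃ : P⁺ 3 · f₃ ≈ p 6 · f₆
    P⁺₃ = trans (*-congˡ F₃) (trans (sym (*-assoc _ _ _)) (*-congʳ (pair 3)))

    P⁺₆ : P⁺ 6 · f₆ ≈ f₁₂
    P⁺₆ = trans (*-congˡ F₆) (pair 6)

    first : (P⁺ 2 · P⁺ 4 · f₆) · (P⁺ 3 · P⁺ 3 · f₆) · Z ≈ f₁ · f₄ ↑ 2 · f₆ ↑ 9
    first = begin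
      (P⁺ 2 · P⁺ 4 · f₆) · (P⁺ 3 · P⁺ 3 · f₆) · Z
        ≈⟨ ·-solve 8 (λ m n a b c d f l → ((m ⊕ f) ⊕ ((n ⊕ n) ⊕ f)) ⊕
            (a ⊕ ((((b ⊕ c ⋆ 2) ⊕ d) ⊕ f ⋆ 2) ⊕ l ⋆ 3)) ⊜
             ((m ⊕ b) ⊕ (n ⊕ c) ⋆ 2) ⊕ (a ⊕ (d ⊕ (f ⋆ 4 ⊕ l ⋆ 3)))) refl (P⁺ 2 · P⁺ 4) (P⁺ 3) f₁ f₂
                 f₃ f₄ f₆ f₁₂ ⟩
      (P⁺ 2 · P⁺ 4 · f₂) · (P⁺ 3 · f₃) ↑ 2 · (f₁ · (f₄ · (f₆ ↑ 4 · f₁₂ ↑ 3)))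
        ≈⟨ *-congʳ (*-cong P⁺₂₄ (↑-cong 2 P⁺₃)) ⟩
      (p 4 · p 8 · f₆) · (p 6 · f₆) ↑ 2 · (f₁ · (f₄ · (f₆ ↑ 4 · f₁₂ ↑ 3)))
        ≈⟨ ·-solve 6 (λ t s a d f l → ((t ⊕ f) ⊕ (s ⊕ f) ⋆ 2) ⊕ (a ⊕ (d ⊕ (f ⋆ 4 ⊕ l ⋆ 3))) ⊜
             (a ⊕ (d ⊕ ((t ⊕ l) ⊕ id))) ⊕ ((s ⊕ l) ⋆ 2 ⊕ f ⋆ 7)) refl (p 4 · p 8) (p 6) f₁ f₄ f₆ f₁₂ ⟩
      f₁ · (f₄ · ((p 4 · p 8 · f₁₂) · 𝟙)) · ((p 6 · f₁₂) ↑ 2 · f₆ ↑ 7)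
        ≈⟨ *-cong (*-congˡ (*-congˡ (*-congʳ F₄))) (*-congʳ (↑-cong 2 F₆)) ⟨
      f₁ · f₄ ↑ 2 · (f₆ ↑ 2 · f₆ ↑ 7)
        ≈⟨ *-congˡ (↑-+ f₆ 2 7) ⟨
      f₁ · f₄ ↑ 2 · f₆ ↑ 9 ∎

    second : -𝟙 · x · ((P⁺ 5 · P⁺ 1 · f₆) · (P⁺ 6 · ((𝟙 ∔ 𝟙) · P⁺ 6) · f₆)) · Z ≈
             (𝟙 ∔ 𝟙) · (-𝟙 · x · (f₂ ↑ 3 · f₃ ↑ 3 · f₁₂ ↑ 6))
    second = begin
      -𝟙 · x · ((P⁺ 5 · P⁺ 1 · f₆) · (P⁺ 6 · ((𝟙 ∔ 𝟙) · P⁺ 6) · f₆)) · Z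
        ≈⟨ ·-solve 11 (λ y t m₁ m₅ m₆ a b c d f l →
             (y ⊕ (((m₅ ⊕ m₁) ⊕ f) ⊕ ((m₆ ⊕ (t ⊕ m₆)) ⊕ f))) ⊕ (a ⊕ ((((b ⊕ c ⋆ 2) ⊕ d) ⊕ f ⋆ 2) ⊕ l ⋆ 3)) ⊜
             (t ⊕ y) ⊕ (((m₁ ⊕ m₅) ⊕ a) ⊕ ((m₆ ⊕ f) ⋆ 2 ⊕ (b ⊕ (c ⋆ 2 ⊕ (d ⊕ (f ⋆ 2 ⊕ l ⋆ 3)))))))
             refl (-𝟙 · x) (𝟙 ∔ 𝟙) (P⁺ 1) (P⁺ 5) (P⁺ 6) f₁ f₂ f₃ f₄ f₆ f₁₂ ⟩
      (𝟙 ∔ 𝟙) · (-𝟙 · x) · ((P⁺ 1 · P⁺ 5 · f₁) ·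
          ((P⁺ 6 · f₆) ↑ 2 · (f₂ · (f₃ ↑ 2 · (f₄ · (f₆ ↑ 2 · f₁₂ ↑ 3))))))
        ≈⟨ *-congˡ (*-cong P⁺₁₅ (*-congʳ (↑-cong 2 P⁺₆))) ⟩
      (𝟙 ∔ 𝟙) · (-𝟙 · x) · ((p 2 · p 10 · w · f₂) · (f₁₂ ↑ 2 · (f₂ · (f₃ ↑ 2 · (f₄ · (f₆ ↑ 2 · f₁₂ ↑ 3))))))
        ≈⟨ *-congˡ (·-solve 7 (λ t w b c d f l →
             ((t ⊕ w) ⊕ b) ⊕ (l ⋆ 2 ⊕ (b ⊕ (c ⋆ 2 ⊕ (d ⊕ (f ⋆ 2 ⊕ l ⋆ 3))))) ⊜
             (((t ⊕ d) ⊕ f) ⊕ (w ⊕ f)) ⊕ (b ⋆ 2 ⊕ (c ⋆ 2 ⊕ l ⋆ 5))) refl (p 2 · p 10) w f₂ f₃ f₄ f₆ f₁₂) ⟩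
      (𝟙 ∔ 𝟙) · (-𝟙 · x) · ((p 2 · p 10 · f₄ · f₆) · (w · f₆) · (f₂ ↑ 2 · (f₃ ↑ 2 · f₁₂ ↑ 5)))
        ≈⟨ *-congˡ (*-congʳ (*-cong F₂F₁₂ F₃)) ⟨
      (𝟙 ∔ 𝟙) · (-𝟙 · x) · ((f₂ · f₁₂) · f₃ · (f₂ ↑ 2 · (f₃ ↑ 2 · f₁₂ ↑ 5)))
        ≈⟨ ·-solve 5 (λ t y b c l → (t ⊕ y) ⊕ (((b ⊕ l) ⊕ c) ⊕ (b ⋆ 2 ⊕ (c ⋆ 2 ⊕ l ⋆ 5))) ⊜
             t ⊕ (y ⊕ ((b ⋆ 3 ⊕ c ⋆ 3) ⊕ l ⋆ 6))) refl (𝟙 ∔ 𝟙) (-𝟙 · x) f₂ f₃ f₁₂ ⟩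
      (𝟙 ∔ 𝟙) · (-𝟙 · x · (f₂ ↑ 3 · f₃ ↑ 3 · f₁₂ ↑ 6)) ∎

-- Dissections of eta quotients

q q⁻ : PowerSeries
q  = q^ 1
q⁻ = -𝟙 · q

q₁ : Ord 1 q
q₁ = ⟨ (λ { zero _ → ≡.refl ; (suc n) (s≤s ()) }) ⟩

q⁻₁ : Ord 1 q⁻
q⁻₁ = ord-·ʳ -𝟙 q₁

open Series hiding (_≈_)

q↑ : ∀ e → q ↑ e ≈ q^ e
q↑ zero    = refl
q↑ (suc e) = trans (*-congˡ (q↑ e)) (sym (q^-+ 1 e))

opaque
  unfolding _·_ _∔_ neg

  ⊖-∔ : ∀ a b → a ⊖ b ≈ a ∔ neg b
  ⊖-∔ a b = ⟨ (λ n _ → ≡.refl) ⟩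

  ⊛-· : ∀ a b → a ⊛ b ≈ a · b
  ⊛-· a b = ⟨ (λ n _ → ≡.refl) ⟩

partialProduct-prod : ∀ j N → partialProduct j N ≈ prod N (factor q -𝟙 j j)
partialProduct-prod j zero    = refl
partialProduct-prod j (suc N) = trans (⊛-· _ _) (trans (*-comm _ _) (*-cong (partialProduct-prod j N) (begin
  𝟙 ⊖ q^ (j ℕ.* suc N)               ≈⟨ ⊖-∔ _ _ ⟩
  𝟙 ∔ neg (q^ (j ℕ.* suc N))         ≈⟨ +-congˡ (-‿cong (trans (sym (q↑ _)) (sym (*-identityˡ _)))) ⟩
  𝟙 ∔ neg (𝟙 · q ↑ (j ℕ.* suc N))    ≈⟨ +-congˡ (-‿distribˡ-* 𝟙 _) ⟩
  𝟙 ∔ -𝟙 · q ↑ (j ℕ.* suc N)         ≈⟨ +-congˡ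
      (*-congˡ (↑-≡ q (≡.trans (ℕ.*-suc j N) (cong (j ℕ.+_) (ℕ.*-comm j N))))) ⟩
  factor q -𝟙 j j N                  ∎)))

F≈f : ∀ j .{{_ : NonZero j}} → F q j ≈ f j
F≈f j = ≈-by-mod λ K → Mod.trans K (∏-mod (Products.factor-tame q₁ -𝟙 j j) ℕ.≤-refl)
  (Mod.trans K (restrict (sym (partialProduct-prod j K)))
    ⟨ (λ n n<K → f-limit j n K (ℕ.<⇒≤ n<K)) ⟩)

F-dilate : ∀ d j → F (q ↑ d) j ≈ F q (j ℕ.* d)
F-dilate d j = ∏-cong λ k → +-congˡ (*-congˡ (trans (↑-* q d (j ℕ.+ k ℕ.* j)) (↑-≡ q (eq j k d))))
  where
  eq : ∀ j k d → (j ℕ.+ k ℕ.* j) ℕ.* d ≡ j ℕ.* d ℕ.+ k ℕ.* (j ℕ.* d)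
  eq = ℕSolver.solve-∀

q⁻² : q⁻ ↑ 2 ≈ q ↑ 2
q⁻² = trans (↑-· -𝟙 q 2) (trans (*-congʳ (trans (*-congˡ (↑-1 -𝟙)) -𝟙·-𝟙)) (*-identityˡ _))

q⁻-even : ∀ e → q⁻ ↑ (e ℕ.* 2) ≈ q ↑ (e ℕ.* 2)
q⁻-even e = trans (sym (↑-* q⁻ 2 e)) (trans (↑-cong e q⁻²) (↑-* q 2 e))

F-even : ∀ j → F q⁻ (j ℕ.* 2) ≈ F q (j ℕ.* 2)
F-even j = ∏-cong λ k → +-congˡ (*-congˡ (trans (↑-≡ q⁻ (eq j k))
    (trans (q⁻-even (j ℕ.+ k ℕ.* j)) (↑-≡ q (≡.sym (eq j k))))))
  where
  eq : ∀ j k → j ℕ.* 2 ℕ.+ k ℕ.* (j ℕ.* 2) ≡ (j ℕ.+ k ℕ.* j) ℕ.* 2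
  eq = ℕSolver.solve-∀

P-odd : ∀ m i → P q⁻ -𝟙 (m ℕ.* 2) (suc (i ℕ.* 2)) ≈ P q 𝟙 (m ℕ.* 2) (suc (i ℕ.* 2))
P-odd m i = ∏-cong λ k → +-congˡ (begin
  -𝟙 · q⁻ ↑ suc (i ℕ.* 2 ℕ.+ k ℕ.* (m ℕ.* 2))  ≈⟨ *-congˡ (↑-≡ q⁻ (cong suc (eq i k m))) ⟩
  -𝟙 · (-𝟙 · q · q⁻ ↑ (e k ℕ.* 2))             ≈⟨ *-congˡ (*-congˡ (q⁻-even (e k))) ⟩
  -𝟙 · (-𝟙 · q · q ↑ (e k ℕ.* 2))
      ≈⟨ trans (*-congˡ (*-assoc _ _ _)) (trans (sym (*-assoc _ _ _)) (*-congʳ -𝟙·-𝟙)) ⟩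
  𝟙 · q ↑ suc (e k ℕ.* 2)                      ≈⟨ *-congˡ (↑-≡ q (cong suc (≡.sym (eq i k m)))) ⟩
  𝟙 · q ↑ suc (i ℕ.* 2 ℕ.+ k ℕ.* (m ℕ.* 2))    ∎)
  where
  e : ℕ → ℕ
  e k = i ℕ.+ k ℕ.* m
  eq : ∀ i k m → i ℕ.* 2 ℕ.+ k ℕ.* (m ℕ.* 2) ≡ (i ℕ.+ k ℕ.* m) ℕ.* 2
  eq = ℕSolver.solve-∀

opaque
  unfolding _·_ _∔_ neg

  units : ∀ {a b} → a 0 ≡ 1ℤ → b 0 ≡ 1ℤ → (a · b) 0 ≡ 1ℤ
  units {a} {b} p r = ≡.trans (coeff-·-0 a b) (cong₂ ℤ._*_ p r)

unit-↑ : ∀ {a} n → a 0 ≡ 1ℤ → (a ↑ n) 0 ≡ 1ℤ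
unit-↑ zero    p = ≡.refl
unit-↑ (suc n) p = units p (unit-↑ n p)

-- A series with constant term 1 is a unit; this undoes the clearing of denominators.
cancel : ∀ {u a b} → u 0 ≡ 1ℤ → u · a ≈ u · b → a ≈ b
cancel {u} {a} {b} u₀ p = trans (sym (undo a)) (trans (*-congˡ p) (undo b))
  where
  undo : ∀ c → inverse u · (u · c) ≈ c
  undo c = trans (sym (*-assoc _ _ _)) (trans (*-congʳ (trans (*-comm _ _) (·-inverse u u₀))) (*-identityˡ c))

-- For odd j, replacing q by -q keeps the factors of f_j with even exponent and turns (q^j;
-- q^(2j))_∞ into (-q^j; q^(2j))_∞. The two multiply to f_2j/f_4j, so f_j(-q) = f_2j³/(f_j f_4j).
F-neg : ∀ i → let j = suc (i ℕ.* 2) in F q⁻ j · F q j · F q (2 ℕ.* (j ℕ.* 2)) ≈ F q (j ℕ.* 2) ↑ 3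
F-neg i = begin
  F q⁻ j · F q j · F q (2 ℕ.* (j ℕ.* 2))
    ≈⟨ *-congʳ (*-cong (trans (split q⁻₁) (*-cong (P-odd j i) (F-even j))) (split q₁)) ⟩
  (P q 𝟙 (j ℕ.* 2) j · F₂) · (P q -𝟙 (j ℕ.* 2) j · F₂) · F₄
    ≈⟨ ·-solve 4 (λ a b c d → ((a ⊕ b) ⊕ (c ⊕ b)) ⊕ d ⊜ (((a ⊕ c) ⊕ d) ⊕ b) ⊕ b) refl _ F₂ _ F₄ ⟩
  (P q 𝟙 (j ℕ.* 2) j · P q -𝟙 (j ℕ.* 2) j) · F₄ · F₂ · F₂
    ≈⟨ *-congʳ (*-congʳ (*-congʳ (Products.P-pair q₁ (j ℕ.* 2) j))) ⟩
  P q -𝟙 (2 ℕ.* (j ℕ.* 2)) (2 ℕ.* j) · F₄ · F₂ · F₂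
    ≈⟨ *-congʳ (*-congʳ recombine) ⟩
  F₂ · F₂ · F₂
    ≈⟨ ·-solve 1 (λ a → (a ⊕ a) ⊕ a ⊜ a ⋆ 3) refl F₂ ⟩
  F₂ ↑ 3 ∎
  where
  j = suc (i ℕ.* 2)
  F₂ = F q (j ℕ.* 2)
  F₄ = F q (2 ℕ.* (j ℕ.* 2))
  split : ∀ {x} → Ord 1 x → F x j ≈ P x -𝟙 (j ℕ.* 2) j · F x (j ℕ.* 2)
  split {x} x₁ = trans (Products.P-split₂ x₁ -𝟙 j j)
    (reflexive (cong₂ (λ m b → P x -𝟙 m j · P x -𝟙 m b) (ℕ.*-comm 2 j) (eq j)))
    where
    eq : ∀ j → j ℕ.+ j ≡ j ℕ.* 2
    eq = ℕSolver.solve-∀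
  recombine : P q -𝟙 (2 ℕ.* (j ℕ.* 2)) (2 ℕ.* j) · F₄ ≈ F₂
  recombine = sym (trans (Products.P-split₂ q₁ -𝟙 (j ℕ.* 2) (j ℕ.* 2))
    (*-cong (reflexive (cong (P q -𝟙 (2 ℕ.* (j ℕ.* 2))) (ℕ.*-comm j 2)))
            (reflexive (cong (P q -𝟙 (2 ℕ.* (j ℕ.* 2))) (eq j)))))
    where
    eq : ∀ j → j ℕ.* 2 ℕ.+ j ℕ.* 2 ≡ 2 ℕ.* (j ℕ.* 2)
    eq = ℕSolver.solve-∀

f₁ f₂ f₃ f₄ f₆ f₈ f₁₂ f₂₄ : PowerSeries
f₁ = f 1
f₂ = f 2
f₃ = f 3
f₄ = f 4
f₆ = f 6
f₈ = f 8
f₁₂ = f 12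
f₂₄ = f 24

dissection₁ : f₃ ↑ 3 · f₂ ↑ 2 · f₁₂ · f₄ ≈ f₁ · (f₄ ↑ 4 · f₆ ↑ 2 ∔ q · (f₁₂ ↑ 4 · f₂ ↑ 2))
dissection₁ = trans (sym (*-cong (*-cong (*-cong (↑-cong 3 (F≈f 3)) (↑-cong 2 (F≈f 2))) (F≈f 12)) (F≈f 4)))
  (trans (EtaIdentities.f₃³/f₁-dissection q₁)
    (*-cong (F≈f 1) (+-cong (*-cong (↑-cong 4 (F≈f 4)) (↑-cong 2 (F≈f 6)))
        (*-congˡ (*-cong (↑-cong 4 (F≈f 12)) (↑-cong 2 (F≈f 2)))))))

dissection₂ : f₆ ↑ 3 · f₄ ↑ 2 · f₂₄ · f₈ ≈ f₂ · (f₈ ↑ 4 · f₁₂ ↑ 2 ∔ q ↑ 2 · (f₂₄ ↑ 4 · f₄ ↑ 2))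
dissection₂ = trans (sym (*-cong (*-cong (*-cong (↑-cong 3 (F² 3)) (↑-cong 2 (F² 2))) (F² 12)) (F² 4)))
  (trans (EtaIdentities.f₃³/f₁-dissection (weaken {1} {2} (s≤s z≤n) (ord-↑ q₁ 2)))
    (*-cong (F² 1) (+-cong (*-cong (↑-cong 4 (F² 4)) (↑-cong 2 (F² 6)))
        (*-congˡ (*-cong (↑-cong 4 (F² 12)) (↑-cong 2 (F² 2)))))))
  where
  F² : ∀ j .{{_ : NonZero (j ℕ.* 2)}} → F (q ↑ 2) j ≈ f (j ℕ.* 2)
  F² j = trans (F-dilate 2 j) (F≈f (j ℕ.* 2))

-- The dissection of the square at -q involves n₁ = f₁(-q) and n₃ = f₃(-q). The factor Z supplies
-- what `h₁` and `h₃` need to eliminate them, together with the f₃³ to which `dissection₁` applies.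
f₃/f₁³-dissection : f₃ · f₂ ↑ 9 · f₁₂ ↑ 2 ≈
                    f₁ ↑ 3 · (f₄ ↑ 6 · f₆ ↑ 3 ∔ (𝟙 ∔ (𝟙 ∔ 𝟙)) · (q · (f₄ ↑ 2 · f₆ · f₁₂ ↑ 4 · f₂ ↑ 2)))
f₃/f₁³-dissection = cancel {U} unit-U (begin
  U · (f₃ · f₂ ↑ 9 · f₁₂ ↑ 2)
    ≈⟨ ·-solve 5 (λ b c d f l → (((b ⊕ d) ⊕ l ⋆ 2) ⊕ f ⋆ 8) ⊕ ((c ⊕ b ⋆ 9) ⊕ l ⋆ 2) ⊜
         ((b ⋆ 3) ⋆ 3 ⊕ (f ⋆ 3) ⋆ 2) ⊕ ((((b ⊕ d) ⊕ f ⋆ 2) ⊕ l ⋆ 4) ⊕ c)) refl f₂ f₃ f₄ f₆ f₁₂ ⟩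
  (f₂ ↑ 3) ↑ 3 · (f₆ ↑ 3) ↑ 2 · (f₂ · f₄ · f₆ ↑ 2 · f₁₂ ↑ 4 · f₃)
    ≈⟨ *-congʳ (*-cong (↑-cong 3 h₁) (↑-cong 2 h₃)) ⟨
  (n₁ · f₁ · f₄) ↑ 3 · (n₃ · f₃ · f₁₂) ↑ 2 · (f₂ · f₄ · f₆ ↑ 2 · f₁₂ ↑ 4 · f₃)
    ≈⟨ ·-solve 8 (λ m n a b c d f l →
         (((m ⊕ a) ⊕ d) ⋆ 3 ⊕ ((n ⊕ c) ⊕ l) ⋆ 2) ⊕ ((((b ⊕ d) ⊕ f ⋆ 2) ⊕ l ⋆ 4) ⊕ c) ⊜
         (((a ⋆ 3 ⊕ d ⋆ 3) ⊕ c ⋆ 3) ⊕ l ⋆ 3) ⊕ (m ⋆ 3 ⊕ ((((b ⊕ n ⋆ 2) ⊕ d) ⊕ f ⋆ 2) ⊕ l ⋆ 3)))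
         refl n₁ n₃ f₁ f₂ f₃ f₄ f₆ f₁₂ ⟩
  Z · (n₁ ↑ 3 · (f₂ · n₃ ↑ 2 · f₄ · f₆ ↑ 2 · f₁₂ ↑ 3))
    ≈⟨ *-congˡ squared ⟩
  Z · (n₁ · f₄ ↑ 2 · f₆ ↑ 9 ∔ (𝟙 ∔ 𝟙) · (q · (f₂ ↑ 3 · n₃ ↑ 3 · f₁₂ ↑ 6)))
    ≈⟨ distribˡ _ _ _ ⟩
  Z · (n₁ · f₄ ↑ 2 · f₆ ↑ 9) ∔ Z · ((𝟙 ∔ 𝟙) · (q · (f₂ ↑ 3 · n₃ ↑ 3 · f₁₂ ↑ 6)))
    -- The coefficient 3 is 1 + 2: one qS from dissecting f₃³/f₁ and two from the square.
    ≈⟨ +-cong first second ⟩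
  (V ∔ q · S) ∔ (𝟙 ∔ 𝟙) · (q · S)
    ≈⟨ +-assoc _ _ _ ⟩
  V ∔ (q · S ∔ (𝟙 ∔ 𝟙) · (q · S))
    ≈⟨ +-congˡ (trans (+-congʳ (sym (*-identityˡ _))) (sym (distribʳ _ _ _))) ⟩
  V ∔ (𝟙 ∔ (𝟙 ∔ 𝟙)) · (q · S)
    ≈⟨ +-cong (·-solve 5 (λ a b d f l → (a ⊕ (d ⋆ 4 ⊕ f ⋆ 2)) ⊕ ((((b ⊕ a ⋆ 2) ⊕ d ⋆ 3) ⊕ f ⋆ 9) ⊕ l ⋆ 2) ⊜
                 ((((b ⊕ d) ⊕ l ⋆ 2) ⊕ f ⋆ 8) ⊕ a ⋆ 3) ⊕ (d ⋆ 6 ⊕ f ⋆ 3)) refl f₁ f₂ f₄ f₆ f₁₂)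
              (·-solve 7 (λ t q a b d f l → t ⊕ (q ⊕ ((((b ⋆ 3 ⊕ f ⋆ 9) ⊕ l ⋆ 6) ⊕ a ⋆ 3) ⊕ d ⋆ 3)) ⊜
                 ((((b ⊕ d) ⊕ l ⋆ 2) ⊕ f ⋆ 8) ⊕ a ⋆ 3) ⊕
                     (t ⊕ (q ⊕ (((d ⋆ 2 ⊕ f) ⊕ l ⋆ 4) ⊕ b ⋆ 2)))) refl (𝟙 ∔ (𝟙 ∔ 𝟙)) q f₁ f₂ f₄ f₆ f₁₂) ⟩
  U · f₁ ↑ 3 · (f₄ ↑ 6 · f₆ ↑ 3) ∔ U · f₁ ↑ 3 · ((𝟙 ∔ (𝟙 ∔ 𝟙)) · (q · (f₄ ↑ 2 · f₆ · f₁₂ ↑ 4 · f₂ ↑ 2)))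
    ≈⟨ trans (sym (distribˡ _ _ _)) (*-assoc _ _ _) ⟩
  U · (f₁ ↑ 3 · (f₄ ↑ 6 · f₆ ↑ 3 ∔ (𝟙 ∔ (𝟙 ∔ 𝟙)) · (q · (f₄ ↑ 2 · f₆ · f₁₂ ↑ 4 · f₂ ↑ 2)))) ∎)
  where
  n₁ = F q⁻ 1
  n₃ = F q⁻ 3
  U = f₂ · f₄ · f₁₂ ↑ 2 · f₆ ↑ 8
  Z = f₁ ↑ 3 · f₄ ↑ 3 · f₃ ↑ 3 · f₁₂ ↑ 3
  R = f₂ · f₁ ↑ 2 · f₄ ↑ 3 · f₆ ↑ 9 · f₁₂ ↑ 2
  V = f₁ · (f₄ ↑ 4 · f₆ ↑ 2) · R
  S = f₂ ↑ 3 · f₆ ↑ 9 · f₁₂ ↑ 6 · f₁ ↑ 3 · f₄ ↑ 3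

  unit-U : U 0 ≡ 1ℤ
  unit-U = units (units (units {f₂} {f₄} ≡.refl ≡.refl) (unit-↑ {f₁₂} 2 ≡.refl)) (unit-↑ {f₆} 8 ≡.refl)

  h₁ : n₁ · f₁ · f₄ ≈ f₂ ↑ 3
  h₁ = trans (*-cong (*-congˡ (sym (F≈f 1))) (sym (F≈f 4))) (trans (F-neg 0) (↑-cong 3 (F≈f 2)))

  h₃ : n₃ · f₃ · f₁₂ ≈ f₆ ↑ 3
  h₃ = trans (*-cong (*-congˡ (sym (F≈f 3))) (sym (F≈f 12))) (trans (F-neg 1) (↑-cong 3 (F≈f 6)))

  F⁻ : ∀ j .{{_ : NonZero (j ℕ.* 2)}} → F q⁻ (j ℕ.* 2) ≈ f (j ℕ.* 2)
  F⁻ j = trans (F-even j) (F≈f (j ℕ.* 2))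

  squared : n₁ ↑ 3 · (f₂ · n₃ ↑ 2 · f₄ · f₆ ↑ 2 · f₁₂ ↑ 3) ≈
            n₁ · f₄ ↑ 2 · f₆ ↑ 9 ∔ (𝟙 ∔ 𝟙) · (q · (f₂ ↑ 3 · n₃ ↑ 3 · f₁₂ ↑ 6))
  squared = trans
    (sym (*-congˡ (*-cong (*-cong (*-cong (*-congʳ (F⁻ 1)) (F⁻ 2)) (↑-cong 2 (F⁻ 3))) (↑-cong 3 (F⁻ 6)))))
    (trans (EtaIdentities.f₁²-dissection q⁻₁)
      (+-cong (*-cong (*-congˡ (↑-cong 2 (F⁻ 2))) (↑-cong 9 (F⁻ 3)))
              (*-congˡ (*-cong (trans (sym (*-assoc _ _ _)) (trans (*-congʳ -𝟙·-𝟙) (*-identityˡ q)))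
                (*-cong (*-congʳ (↑-cong 3 (F⁻ 1))) (↑-cong 6 (F⁻ 6)))))))

  first : Z · (n₁ · f₄ ↑ 2 · f₆ ↑ 9) ≈ V ∔ q · S
  first = begin
    Z · (n₁ · f₄ ↑ 2 · f₆ ↑ 9)
      ≈⟨ ·-solve 6 (λ m a c d f l → (((a ⋆ 3 ⊕ d ⋆ 3) ⊕ c ⋆ 3) ⊕ l ⋆ 3) ⊕ ((m ⊕ d ⋆ 2) ⊕ f ⋆ 9) ⊜
           ((m ⊕ a) ⊕ d) ⊕ (a ⋆ 2 ⊕ (d ⋆ 4 ⊕ (f ⋆ 9 ⊕ (c ⋆ 3 ⊕ l ⋆ 3))))) refl n₁ f₁ f₃ f₄ f₆ f₁₂ ⟩
    n₁ · f₁ · f₄ · (f₁ ↑ 2 · (f₄ ↑ 4 · (f₆ ↑ 9 · (f₃ ↑ 3 · f₁₂ ↑ 3))))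
      ≈⟨ *-congʳ h₁ ⟩
    f₂ ↑ 3 · (f₁ ↑ 2 · (f₄ ↑ 4 · (f₆ ↑ 9 · (f₃ ↑ 3 · f₁₂ ↑ 3))))
      ≈⟨ ·-solve 6 (λ a b c d f l → b ⋆ 3 ⊕ (a ⋆ 2 ⊕ (d ⋆ 4 ⊕ (f ⋆ 9 ⊕ (c ⋆ 3 ⊕ l ⋆ 3)))) ⊜
           (((c ⋆ 3 ⊕ b ⋆ 2) ⊕ l) ⊕ d) ⊕ ((((b ⊕ a ⋆ 2) ⊕ d ⋆ 3) ⊕ f ⋆ 9) ⊕ l ⋆ 2)) refl f₁ f₂ f₃ f₄ f₆ f₁₂ ⟩
    f₃ ↑ 3 · f₂ ↑ 2 · f₁₂ · f₄ · R
      ≈⟨ *-congʳ dissection₁ ⟩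
    f₁ · (f₄ ↑ 4 · f₆ ↑ 2 ∔ q · (f₁₂ ↑ 4 · f₂ ↑ 2)) · R
      ≈⟨ trans (*-congʳ (distribˡ _ _ _)) (distribʳ _ _ _) ⟩
    V ∔ f₁ · (q · (f₁₂ ↑ 4 · f₂ ↑ 2)) · R
      ≈⟨ +-congˡ (·-solve 6 (λ q a b d f l → (a ⊕ (q ⊕ (l ⋆ 4 ⊕ b ⋆ 2))) ⊕
          ((((b ⊕ a ⋆ 2) ⊕ d ⋆ 3) ⊕ f ⋆ 9) ⊕ l ⋆ 2) ⊜
           q ⊕ ((((b ⋆ 3 ⊕ f ⋆ 9) ⊕ l ⋆ 6) ⊕ a ⋆ 3) ⊕ d ⋆ 3)) refl q f₁ f₂ f₄ f₆ f₁₂) ⟩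
    V ∔ q · S ∎

  second : Z · ((𝟙 ∔ 𝟙) · (q · (f₂ ↑ 3 · n₃ ↑ 3 · f₁₂ ↑ 6))) ≈ (𝟙 ∔ 𝟙) · (q · S)
  second = begin
    Z · ((𝟙 ∔ 𝟙) · (q · (f₂ ↑ 3 · n₃ ↑ 3 · f₁₂ ↑ 6)))
      ≈⟨ ·-solve 8 (λ t q n a b c d l →
           (((a ⋆ 3 ⊕ d ⋆ 3) ⊕ c ⋆ 3) ⊕ l ⋆ 3) ⊕ (t ⊕ (q ⊕ ((b ⋆ 3 ⊕ n ⋆ 3) ⊕ l ⋆ 6))) ⊜
           t ⊕ (q ⊕ ((((b ⋆ 3 ⊕ ((n ⊕ c) ⊕ l) ⋆ 3) ⊕ l ⋆ 6) ⊕ a ⋆ 3) ⊕ d ⋆ 3))) refl (𝟙 ∔ 𝟙) q n₃ f₁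
               f₂ f₃ f₄ f₁₂ ⟩
    (𝟙 ∔ 𝟙) · (q · (f₂ ↑ 3 · (n₃ · f₃ · f₁₂) ↑ 3 · f₁₂ ↑ 6 · f₁ ↑ 3 · f₄ ↑ 3))
      ≈⟨ *-congˡ (*-congˡ (*-congʳ (*-congʳ (*-congʳ (*-congˡ (trans (↑-cong 3 h₃) (↑-* f₆ 3 3))))))) ⟩
    (𝟙 ∔ 𝟙) · (q · S) ∎

-- Signs of coefficients

open import Data.Nat using (_+_; _*_)

-- For ε = ±1: z ε^(n/2) ≥ 0 if n is even, and z = 0 if n is odd.
Sign : ℤ → ℕ → ℤ → Set
Sign ε zero          z = 0ℤ ℤ.≤ z
Sign ε (suc zero)    z = z ≡ 0ℤ
Sign ε (suc (suc n)) z = Sign ε n (ε ℤ.* z)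

-- z ε^(n/2) > 0 if n is even.
StrictSign : ℤ → ℕ → ℤ → Set
StrictSign ε zero          z = 0ℤ < z
StrictSign ε (suc zero)    z = ⊤
StrictSign ε (suc (suc n)) z = StrictSign ε n (ε ℤ.* z)

-- For ε = ±1, `Signed ε` means b(ε q²) for a series b with nonnegative coefficients.
Signed StrictlySigned : ℤ → PowerSeries → Set
Signed ε a = ∀ n → Sign ε n (a n)
StrictlySigned ε a = ∀ n → StrictSign ε n (a n)

q^-diagonal : ∀ e → (q^ e) e ≡ 1ℤ
q^-diagonal e = cong (if_then 1ℤ else 0ℤ) (dec-true (e ℕ.≟ e) ≡.refl)

q^-off-diagonal : ∀ {n e} → n ≢ e → (q^ e) n ≡ 0ℤ
q^-off-diagonal {n} {e} n≢e = cong (if_then 1ℤ else 0ℤ) (dec-false (n ℕ.≟ e) n≢e)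

module _ {ε : ℤ} where

  Sign-0 : ∀ n → Sign ε n 0ℤ
  Sign-0 zero          = ℤ.≤-refl
  Sign-0 (suc zero)    = ≡.refl
  Sign-0 (suc (suc n)) = subst (Sign ε n) (≡.sym (ℤ.*-zeroʳ ε)) (Sign-0 n)

  Sign-+ : ∀ n {x y} → Sign ε n x → Sign ε n y → Sign ε n (x ℤ.+ y)
  Sign-+ zero          p r = ℤ.+-mono-≤ p r
  Sign-+ (suc zero)    p r = cong₂ ℤ._+_ p r
  Sign-+ (suc (suc n)) {x} {y} p r = subst (Sign ε n) (≡.sym (ℤ.*-distribˡ-+ ε x y)) (Sign-+ n p r)

  StrictSign-+ : ∀ n {x y} → StrictSign ε n x → Sign ε n y → StrictSign ε n (x ℤ.+ y)
  StrictSign-+ zero          p r = ℤ.+-mono-<-≤ p r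
  StrictSign-+ (suc zero)    p r = tt
  StrictSign-+ (suc (suc n)) {x} {y} p r = subst (StrictSign ε n) (≡.sym (ℤ.*-distribˡ-+ ε x y))
      (StrictSign-+ n p r)

  Sign-scale : ∀ n {x y} → 0ℤ ℤ.≤ x → Sign ε n y → Sign ε n (x ℤ.* y)
  Sign-scale zero          {x} {y} p r = subst (ℤ._≤ x ℤ.* y) (ℤ.*-zeroʳ x)
      (ℤ.*-monoˡ-≤-nonNeg x {{ℤ.nonNegative p}} r)
  Sign-scale (suc zero)    {x} p r = ≡.trans (cong (x ℤ.*_) r) (ℤ.*-zeroʳ x)
  Sign-scale (suc (suc n)) {x} {y} p r = subst (Sign ε n) (lemma x ε y) (Sign-scale n p r)
    where
    lemma : ∀ x e y → x ℤ.* (e ℤ.* y) ≡ e ℤ.* (x ℤ.* y)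
    lemma = ℤSolver.solve-∀

  -- The sign ε^(n/2) is multiplicative on even indices, and a factor at an odd index is zero.
  Sign-* : ∀ m n {x y} → Sign ε m x → Sign ε n y → Sign ε (m + n) (x ℤ.* y)
  Sign-* zero          n p r = Sign-scale n p r
  Sign-* (suc zero)    n {x} {y} p r = subst (Sign ε (suc n)) (cong (ℤ._* y) (≡.sym p)) (Sign-0 (suc n))
  Sign-* (suc (suc m)) n {x} {y} p r = subst (Sign ε (m + n)) (ℤ.*-assoc ε x y) (Sign-* m n p r)

  Sign-sum : ∀ n {m} (t : Fin m → ℤ) → (∀ k → Sign ε n (t k)) → Sign ε n (sum t)
  Sign-sum n {zero}  t p = Sign-0 n
  Sign-sum n {suc m} t p = Sign-+ n (p zero) (Sign-sum n (t ∘ suc) (p ∘ suc))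

  signed-≈ : ∀ {a b} → a ≈ b → Signed ε a → Signed ε b
  signed-≈ p r n = subst (Sign ε n) (at p n tt) (r n)

  opaque
    unfolding _·_ _∔_ neg

    signed-· : ∀ {a b} → Signed ε a → Signed ε b → Signed ε (a · b)
    signed-· {a} {b} p r n = Sign-sum n _ λ k →
      subst (λ m → Sign ε m (a (toℕ k) ℤ.* b (n ∸ toℕ k))) (ℕ.m+[n∸m]≡n (ℕ.≤-pred (toℕ<n k)))
        (Sign-* (toℕ k) (n ∸ toℕ k) (p (toℕ k)) (r (n ∸ toℕ k)))

    signed-∔ : ∀ {a b} → Signed ε a → Signed ε b → Signed ε (a ∔ b)
    signed-∔ p r n = Sign-+ n (p n) (r n)

    strictlySigned-∔ : ∀ {a b} → StrictlySigned ε a → Signed ε b → StrictlySigned ε (a ∔ b)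
    strictlySigned-∔ p r n = StrictSign-+ n (p n) (r n)

    signed-neg-q^ : ∀ e → Sign ε e -1ℤ → Signed ε (neg (q^ e))
    signed-neg-q^ e p n with n ℕ.≟ e
    ... | yes ≡.refl = subst (λ z → Sign ε e (ℤ.- z)) (≡.sym (q^-diagonal e)) p
    ... | no n≢e     = subst (λ z → Sign ε n (ℤ.- z)) (≡.sym (q^-off-diagonal n≢e)) (Sign-0 n)

  signed-q^ : ∀ e → Sign ε e 1ℤ → Signed ε (q^ e)
  signed-q^ e p n with n ℕ.≟ e
  ... | yes ≡.refl = subst (Sign ε e) (≡.sym (q^-diagonal e)) p
  ... | no n≢e     = subst (Sign ε n) (≡.sym (q^-off-diagonal n≢e)) (Sign-0 n)

  signed-𝟙 : Signed ε 𝟙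
  signed-𝟙 = signed-q^ 0 (ℤ.+≤+ z≤n)

  signed-prod : ∀ L {g} → (∀ k → Signed ε (g k)) → Signed ε (prod L g)
  signed-prod zero    p = signed-𝟙
  signed-prod (suc L) p = signed-· (signed-prod L p) (p L)

  signed-∏ : ∀ {g} → (∀ k → Signed ε (g k)) → Signed ε (∏ g)
  signed-∏ p n = signed-prod (suc n) p n

  signed-↑ : ∀ n {a} → Signed ε a → Signed ε (a ↑ n)
  signed-↑ zero    p = signed-𝟙
  signed-↑ (suc n) p = signed-· p (signed-↑ n p)

  signed-q↑ : ∀ e → Sign ε e 1ℤ → Signed ε (q ↑ e)
  signed-q↑ e p = signed-≈ (sym (q↑ e)) (signed-q^ e p)

  -- The iterates of s ↦ c ∔ y · s converge to a.
  signed-fixpoint : ∀ {a c y} → Ord 1 y → a ≈ c ∔ y · a → Signed ε c → Signed ε y → Signed ε a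
  signed-fixpoint {a} {c} {y} y₁ p c-signed y-signed n =
    subst (Sign ε n) (≡.sym (at (converge (suc n)) n ℕ.≤-refl)) (s-signed (suc n) n)
    where
    s : ℕ → PowerSeries
    s zero    = 𝟘
    s (suc k) = c ∔ y · s k
    s-signed : ∀ k → Signed ε (s k)
    s-signed zero    = Sign-0
    s-signed (suc k) = signed-∔ c-signed (signed-· y-signed (s-signed k))
    converge : ∀ k → a ≡ s k mod k
    converge zero    = ⟨ (λ _ ()) ⟩
    converge (suc k) = Mod.trans (suc k) (restrict p) (Mod.+-congˡ (suc k) (·-mod-suc y₁ (converge k)))

-- Geometric series and reciprocals of infinite products

geo : PowerSeries → PowerSeries
geo y = inverse (𝟙 ∔ -𝟙 · y)

opaque
  unfolding _·_ _∔_ neg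

  unit-1-y : ∀ {y} → Ord 1 y → (𝟙 ∔ -𝟙 · y) 0 ≡ 1ℤ
  unit-1-y {y} y₁ = cong (λ z → 1ℤ ℤ.+ z) (at (ord-·ʳ -𝟙 y₁) 0 (s≤s z≤n))

geo-inverse : ∀ {y} → Ord 1 y → (𝟙 ∔ -𝟙 · y) · geo y ≈ 𝟙
geo-inverse y₁ = ·-inverse _ (unit-1-y y₁)

split-1 : ∀ y → 𝟙 ≈ (𝟙 ∔ -𝟙 · y) ∔ y
split-1 y = sym (trans (+-assoc _ _ _) (trans (+-congˡ (trans (+-congʳ -y) (-‿inverseˡ y))) (+-identityʳ 𝟙)))
  where
  -y : -𝟙 · y ≈ neg y
  -y = trans (sym (-‿distribˡ-* 𝟙 y)) (-‿cong (*-identityˡ y))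

geo-step : ∀ {y} → Ord 1 y → geo y ≈ 𝟙 ∔ y · geo y
geo-step {y} y₁ = trans (sym (*-identityˡ _)) (trans (*-congʳ (split-1 y))
  (trans (distribʳ _ _ _) (+-congʳ (geo-inverse y₁))))

-- Puts a series with a factor 1/(1 - y) into the recurrence form a = c + y a used for strict signs.
geo-multiple : ∀ {y} c → Ord 1 y → geo y · c ≈ c ∔ y · (geo y · c)
geo-multiple c y₁ = trans (*-congʳ (geo-step y₁))
    (trans (distribʳ _ _ _) (+-cong (*-identityˡ c) (*-assoc _ _ _)))

signed-geo : ∀ {ε y} → Ord 1 y → Signed ε y → Signed ε (geo y)
signed-geo y₁ p = signed-fixpoint y₁ (geo-step y₁) signed-𝟙 p

geo-tame : ∀ {y} K → Ord 1 y → Ord K y → geo y ≡ 𝟙 mod K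
geo-tame K y₁ y-K = Mod.trans K (restrict (geo-step y₁)) (∔-ord (Mod.refl K) (ord-·ˡ _ y-K))

-- P⁻ m b = ∏ (1 - q^(b + k m)), with inverse P⁻¹ m b.
P⁻ P⁻¹ : ℕ → ℕ → PowerSeries
P⁻ m b = P q -𝟙 m b
P⁻¹ m b = ∏ λ k → geo (q ↑ (b + k * m))

ord-q : ∀ b → .{{NonZero b}} → ∀ m k → Ord 1 (q ↑ (b + k * m))
ord-q (suc b) m k = weaken {1} {suc b + k * m} (s≤s z≤n) (ord-↑ q₁ (suc b + k * m))

P⁻¹-tame : ∀ m b → .{{NonZero m}} → .{{NonZero b}} → Tame (λ k → geo (q ↑ (b + k * m)))
P⁻¹-tame m b k = geo-tame k (ord-q b m k)
  (weaken (ℕ.≤-trans (ℕ.m≤m*n k m) (ℕ.m≤n+m (k * m) b)) (ord-↑ q₁ (b + k * m)))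

signed-P⁻ : ∀ {ε} m b → (∀ k → Sign ε (b + k * m) -1ℤ) → Signed ε (P⁻ m b)
signed-P⁻ m b p = signed-∏ λ k → signed-∔ signed-𝟙
  (signed-≈ (trans (-‿cong (trans (sym (q↑ _)) (sym (*-identityˡ _)))) (-‿distribˡ-* 𝟙 _))
      (signed-neg-q^ (b + k * m) (p k)))

signed-P⁻¹ : ∀ {ε} m b → .{{NonZero b}} → (∀ k → Sign ε (b + k * m) 1ℤ) → Signed ε (P⁻¹ m b)
signed-P⁻¹ m b p = signed-∏ λ k → signed-geo (ord-q b m k) (signed-q↑ (b + k * m) (p k))

sign⁺ : ∀ j → Sign 1ℤ (j * 2) 1ℤ
sign⁺ zero    = ℤ.+≤+ z≤n
sign⁺ (suc j) = sign⁺ j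

sign⁻ : ∀ j → Sign -1ℤ (j * 4) 1ℤ
sign⁻ zero    = ℤ.+≤+ z≤n
sign⁻ (suc j) = sign⁻ j

multiple : ∀ b c k d → b * d + k * (c * d) ≡ (b + k * c) * d
multiple = ℕSolver.solve-∀

-- Even exponents for the sign 1; multiples of 4, or 2 mod 4 with coefficient -1, for the sign -1.
signed⁺ : ∀ m b → .{{NonZero (b * 2)}} → Signed 1ℤ (P⁻¹ (m * 2) (b * 2))
signed⁺ m b = signed-P⁻¹ (m * 2) (b * 2) λ k → subst (λ e → Sign 1ℤ e 1ℤ) (≡.sym (multiple b m k 2))
    (sign⁺ (b + k * m))

signed⁻ : ∀ m b → .{{NonZero (b * 4)}} → Signed -1ℤ (P⁻¹ (m * 4) (b * 4))
signed⁻ m b = signed-P⁻¹ (m * 4) (b * 4) λ k → subst (λ e → Sign -1ℤ e 1ℤ)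
    (≡.sym (multiple b m k 4)) (sign⁻ (b + k * m))

signed⁻′ : ∀ m b → Signed -1ℤ (P⁻ (m * 4) (2 + b * 4))
signed⁻′ m b = signed-P⁻ (m * 4) (2 + b * 4) λ k → subst (λ e → Sign -1ℤ (2 + e) -1ℤ)
    (≡.sym (multiple b m k 4)) (sign⁻ (b + k * m))


P⁻-inverse : ∀ m b → .{{_ : NonZero m}} → .{{_ : NonZero b}} → P⁻ m b · P⁻¹ m b ≈ 𝟙
P⁻-inverse m b = trans (sym (∏-· (Products.factor-tame q₁ -𝟙 m b) (P⁻¹-tame m b)))
  (trans (∏-cong λ k → geo-inverse (ord-q b m k)) ⟨ (λ n _ → at (prod-𝟙 (suc n)) n tt) ⟩)

P⁻¹-head : ∀ m b → .{{_ : NonZero m}} → .{{_ : NonZero b}} → P⁻¹ m b ≈ geo (q ↑ b) · P⁻¹ m (b + m)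
P⁻¹-head m b = trans (∏-head (P⁻¹-tame m b))
  (*-cong (reflexive (cong (λ e → geo (q ↑ e)) (ℕ.+-identityʳ b)))
          (∏-cong λ k → reflexive (cong (λ e → geo (q ↑ e)) (≡.sym (ℕ.+-assoc b m (k * m))))))

-- Coefficients and recurrences for strict signs

opaque
  unfolding _·_ _∔_ neg

  coeff-∔ : ∀ a b n → (a ∔ b) n ≡ a n ℤ.+ b n
  coeff-∔ a b n = ≡.refl

  q·-0 : ∀ a → (q · a) 0 ≡ 0ℤ
  q·-0 a = ≡.trans (ℤ.+-identityʳ _) (ℤ.*-zeroˡ (a 0))

  q·-suc : ∀ a n → (q · a) (suc n) ≡ a n
  q·-suc a n = ≡.trans (Convolution.q^suc-⊛ n 0 a) (Convolution.⊛-identityˡ n a)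

  -𝟙·-coeff : ∀ a n → (-𝟙 · a) n ≡ -1ℤ ℤ.* a n
  -𝟙·-coeff a n = ≡.trans (at (trans (sym (-‿distribˡ-* 𝟙 a)) (-‿cong (*-identityˡ a))) n tt)
      (≡.sym (ℤ.-1*i≡-i (a n)))

q↑2·-coeff : ∀ a n → (q ↑ 2 · a) (2 + n) ≡ a n
q↑2·-coeff a n = ≡.trans (at (trans (*-assoc _ _ _) (*-congˡ (*-congʳ (↑-1 q)))) (2 + n) tt)
  (≡.trans (q·-suc (q · a) (suc n)) (q·-suc a n))

q↑4·-coeff : ∀ a n → (q ↑ 4 · a) (4 + n) ≡ a n
q↑4·-coeff a n = ≡.trans (at (trans (*-congʳ (↑-+ q 2 2)) (*-assoc _ _ _)) (4 + n) tt)
  (≡.trans (q↑2·-coeff (q ↑ 2 · a) (2 + n)) (q↑2·-coeff a n))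

-- The equation reads a (n + 2) = a n + c (n + 2), so positivity spreads from the constant term to
-- all even indices.
strictlySigned⁺ : ∀ {a c} → a ≈ c ∔ q ↑ 2 · a → 0ℤ < a 0 → Signed 1ℤ c → StrictlySigned 1ℤ a
strictlySigned⁺ p a₀ c-signed zero          = a₀
strictlySigned⁺ p a₀ c-signed (suc zero)    = tt
strictlySigned⁺ {a} {c} p a₀ c-signed (suc (suc n)) = subst (StrictSign 1ℤ n) (≡.sym eq)
  (StrictSign-+ n (strictlySigned⁺ p a₀ c-signed n) (c-signed (2 + n)))
  where
  eq : 1ℤ ℤ.* a (2 + n) ≡ a n ℤ.+ 1ℤ ℤ.* c (2 + n)
  eq = ≡.trans (cong (1ℤ ℤ.*_) (≡.trans (at p (2 + n) tt)
      (≡.trans (coeff-∔ _ _ (2 + n)) (cong (λ z → c (2 + n) ℤ.+ z) (q↑2·-coeff a n)))))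
    (lemma (c (2 + n)) (a n))
    where
    lemma : ∀ x y → 1ℤ ℤ.* (x ℤ.+ y) ≡ y ℤ.+ 1ℤ ℤ.* x
    lemma = ℤSolver.solve-∀

-- Here a (n + 2) = c (n + 2) - a n, and for even n both summands carry the sign of (-1)^((n+2)/2),
-- so nothing cancels.
strictlySigned⁻ : ∀ {a c} → a ≈ c ∔ -𝟙 · (q ↑ 2 · a) → 0ℤ < a 0 → Signed -1ℤ c → StrictlySigned -1ℤ a
strictlySigned⁻ p a₀ c-signed zero          = a₀
strictlySigned⁻ p a₀ c-signed (suc zero)    = tt
strictlySigned⁻ {a} {c} p a₀ c-signed (suc (suc n)) = subst (StrictSign -1ℤ n) (≡.sym eq)
  (StrictSign-+ n (strictlySigned⁻ p a₀ c-signed n) (c-signed (2 + n)))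
  where
  eq : -1ℤ ℤ.* a (2 + n) ≡ a n ℤ.+ -1ℤ ℤ.* c (2 + n)
  eq = ≡.trans (cong (-1ℤ ℤ.*_) (≡.trans (at p (2 + n) tt) (≡.trans (coeff-∔ _ _ (2 + n))
      (cong (λ z → c (2 + n) ℤ.+ z) (≡.trans (-𝟙·-coeff _ (2 + n)) (cong (-1ℤ ℤ.*_) (q↑2·-coeff a n)))))))
    (lemma (c (2 + n)) (a n))
    where
    lemma : ∀ x y → -1ℤ ℤ.* (x ℤ.+ -1ℤ ℤ.* y) ≡ y ℤ.+ -1ℤ ℤ.* x
    lemma = ℤSolver.solve-∀

sign-even : ∀ n {z} → Sign 1ℤ (n * 2) z → 0ℤ ℤ.≤ z
sign-even zero    p = p
sign-even (suc n) {z} p = subst (0ℤ ℤ.≤_) (ℤ.*-identityˡ z) (sign-even n p)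

strictSign-even : ∀ n {z} → StrictSign 1ℤ (n * 2) z → 0ℤ < z
strictSign-even zero    p = p
strictSign-even (suc n) {z} p = subst (0ℤ <_) (ℤ.*-identityˡ z) (strictSign-even n p)

sign-odd : ∀ {ε} .{{_ : ℤ.NonZero ε}} n {z} → Sign ε (suc (n * 2)) z → z ≡ 0ℤ
sign-odd zero    p = p
sign-odd {ε} (suc n) {z} p = ℤ.*-cancelˡ-≡ ε z 0ℤ (≡.trans (sign-odd {ε} n p) (≡.sym (ℤ.*-zeroʳ ε)))

-1*-1* : ∀ z → -1ℤ ℤ.* (-1ℤ ℤ.* z) ≡ z
-1*-1* = ℤSolver.solve-∀

strictSign-4n : ∀ n {z} → StrictSign -1ℤ (n * 4) z → 0ℤ < z
strictSign-4n zero    p = p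
strictSign-4n (suc n) {z} p = subst (0ℤ <_) (-1*-1* z) (strictSign-4n n p)

strictSign-4n+2 : ∀ n {z} → StrictSign -1ℤ (2 + n * 4) z → z < 0ℤ
strictSign-4n+2 n {z} p = subst (_< 0ℤ) (≡.trans (cong ℤ.-_ (ℤ.-1*i≡-i z)) (ℤ.neg-involutive z))
    (ℤ.neg-mono-< (strictSign-4n n p))

-- The same recurrence with step 4, for series whose smallest factor is 1/(1 - q⁴).
growth : ∀ {a c} → a ≈ c ∔ q ↑ 4 · a → 0ℤ < a 0 → Signed 1ℤ c → ∀ n → 0ℤ < a (n * 4)
growth p a₀ c-signed zero    = a₀
growth {a} {c} p a₀ c-signed (suc n) = subst (0ℤ <_)
  (≡.sym (≡.trans (at p (4 + n * 4) tt) (≡.trans (coeff-∔ _ _ (4 + n * 4))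
      (cong (λ z → c (4 + n * 4) ℤ.+ z) (q↑4·-coeff a (n * 4))))))
  (ℤ.+-mono-≤-< (sign-even (2 + n * 2) (subst (λ e → Sign 1ℤ e (c (4 + n * 4))) (eq n)
      (c-signed (4 + n * 4)))) (growth p a₀ c-signed n))
  where
  eq : ∀ n → 4 + n * 4 ≡ (2 + n * 2) * 2
  eq = ℕSolver.solve-∀

SignPattern : PowerSeries → Set
SignPattern a = ∀ n → a (2 * n) > 0ℤ × a (4 * n + 1) > 0ℤ × a (4 * n + 3) < 0ℤ

-- X lives on even indices and q Y on odd ones, so the parts do not interact; the index 2k of Y,
-- with sign (-1)^k, lands at 2k + 1.
signPattern : ∀ {a X Y} → a ≈ X ∔ q · Y → Signed 1ℤ X → (∀ n → 0ℤ < X (n * 2)) →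
              Signed -1ℤ Y → StrictlySigned -1ℤ Y → SignPattern a
signPattern {a} {X} {Y} p X-signed X-pos Y-signed Y-strict n =
    subst (λ e → 0ℤ < a e) (ℕ.*-comm n 2) (even n)
  , subst (0ℤ <_) (≡.sym (odd (4 * n + 1) (n * 4) (n * 2) (eq₁ n) (eq₂ n)))
      (strictSign-4n n (Y-strict (n * 4)))
  , subst (_< 0ℤ) (≡.sym (odd (4 * n + 3) (2 + n * 4) (suc (n * 2)) (eq₃ n) (eq₄ n)))
      (strictSign-4n+2 n (Y-strict (2 + n * 4)))
  where
  coeff : ∀ e → a e ≡ X e ℤ.+ (q · Y) e
  coeff e = ≡.trans (at p e tt) (coeff-∔ X (q · Y) e)
  qY-even : ∀ n → (q · Y) (n * 2) ≡ 0ℤ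
  qY-even zero    = q·-0 Y
  qY-even (suc n) = ≡.trans (q·-suc Y (suc (n * 2))) (sign-odd { -1ℤ} n (Y-signed (suc (n * 2))))
  even : ∀ n → 0ℤ < a (n * 2)
  even n = subst (0ℤ <_) (≡.sym (≡.trans (coeff (n * 2))
      (≡.trans (cong (λ z → X (n * 2) ℤ.+ z) (qY-even n)) (ℤ.+-identityʳ _)))) (X-pos n)
  odd : ∀ e d i → e ≡ suc d → d ≡ i * 2 → a e ≡ Y d
  odd e d i ≡.refl d≡ = ≡.trans (coeff (suc d)) (≡.trans (cong₂ ℤ._+_
    (sign-odd {1ℤ} i (subst (λ d′ → Sign 1ℤ (suc d′) (X (suc d))) d≡ (X-signed (suc d))))
        (q·-suc Y d)) (ℤ.+-identityˡ _))
  eq₁ : ∀ n → 4 * n + 1 ≡ suc (n * 4)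
  eq₁ = ℕSolver.solve-∀
  eq₂ : ∀ n → n * 4 ≡ n * 2 * 2
  eq₂ = ℕSolver.solve-∀
  eq₃ : ∀ n → 4 * n + 3 ≡ suc (2 + n * 4)
  eq₃ = ℕSolver.solve-∀
  eq₄ : ∀ n → 2 + n * 4 ≡ suc (n * 2) * 2
  eq₄ = ℕSolver.solve-∀

-- The two eta quotients

-- Constant terms are read off from cleared eta quotient identities, where those of the f_j are
-- known by computation.
constant-1 : ∀ {a u v} → a · u ≈ v → u 0 ≡ 1ℤ → v 0 ≡ 1ℤ → a 0 ≡ 1ℤ
constant-1 {a} {u} p u₀ v₀ = ≡.trans (≡.sym (ℤ.*-identityʳ (a 0)))
  (≡.trans (cong (a 0 ℤ.*_) (≡.sym u₀)) (≡.trans (≡.sym (coeff-·-0 a u)) (≡.trans (at p 0 tt) v₀)))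

1>0 : ∀ {z} → z ≡ 1ℤ → 0ℤ < z
1>0 ≡.refl = ℤ.+<+ (s≤s z≤n)

f-halve : ∀ j → .{{_ : NonZero j}} → .{{_ : NonZero (2 * j)}} → f j ≈ P⁻ (2 * j) j · f (2 * j)
f-halve j = trans (sym (F≈f j)) (trans (Products.P-split₂ q₁ -𝟙 j j)
  (*-congˡ (trans (reflexive (cong (P⁻ (2 * j)) (eq j))) (F≈f (2 * j)))))
  where
  eq : ∀ j → j + j ≡ 2 * j
  eq = ℕSolver.solve-∀

f-third : ∀ j → .{{_ : NonZero j}} → .{{_ : NonZero (3 * j)}} →
          f j ≈ P⁻ (3 * j) j · P⁻ (3 * j) (2 * j) · f (3 * j)
f-third j = trans (sym (F≈f j)) (trans (Products.P-split₃ q₁ -𝟙 j j)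
  (*-cong (*-congˡ (reflexive (cong (P⁻ (3 * j)) (eq j)))) (F≈f (3 * j))))
  where
  eq : ∀ j → j + j ≡ 2 * j
  eq = ℕSolver.solve-∀

-- f₆²/(f₂f₁₂).  By 1/(1 - y) + z/(1 - z) = (1 - yz)/((1 - y)(1 - z)) its factors
-- (1 - q^(12k+6))/((1 - q^(6k+2))(1 - q^(6k+4))) have nonnegative coefficients.
module EvenA where

  y z g : ℕ → PowerSeries
  y k = q ↑ (2 + k * 6)
  z k = q ↑ (4 + k * 6)
  g k = geo (y k) ∔ z k · geo (z k)

  y₁ : ∀ k → Ord 1 (y k)
  y₁ = ord-q 2 6

  z₁ : ∀ k → Ord 1 (z k)
  z₁ = ord-q 4 6

  X : PowerSeries
  X = ∏ g

  g-tame : Tame g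
  g-tame k = ∔-ord (P⁻¹-tame 6 2 k) (ord-·ˡ (geo (z k)) (weaken k≤ (ord-↑ q₁ (4 + k * 6))))
    where
    k≤ : k ℕ.≤ 4 + k * 6
    k≤ = ℕ.≤-trans (ℕ.m≤m*n k 6) (ℕ.m≤n+m (k * 6) 4)

  g-factor : ∀ k → (𝟙 ∔ -𝟙 · y k) · (𝟙 ∔ -𝟙 · z k) · g k ≈ 𝟙 ∔ -𝟙 · q ↑ (6 + k * 12)
  g-factor k = begin
    u · v · (geo (y k) ∔ z k · geo (z k))
      ≈⟨ distribˡ _ _ _ ⟩
    u · v · geo (y k) ∔ u · v · (z k · geo (z k))
      ≈⟨ +-cong (·-solve 3 (λ u v g → (u ⊕ v) ⊕ g ⊜ (u ⊕ g) ⊕ v) refl u v (geo (y k)))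
                (·-solve 4 (λ u v z g → (u ⊕ v) ⊕ (z ⊕ g) ⊜ (v ⊕ g) ⊕ (u ⊕ z)) refl u v (z k) (geo (z k))) ⟩
    u · geo (y k) · v ∔ v · geo (z k) · (u · z k)
      ≈⟨ +-cong (trans (*-congʳ (geo-inverse (y₁ k))) (*-identityˡ v))
          (trans (*-congʳ (geo-inverse (z₁ k))) (*-identityˡ _)) ⟩
    v ∔ u · z k
      ≈⟨ +-congˡ (trans (distribʳ _ _ _) (+-cong (*-identityˡ _) (*-assoc _ _ _))) ⟩
    v ∔ (z k ∔ -𝟙 · (y k · z k))
      ≈⟨ trans (sym (+-assoc _ _ _)) (+-cong (sym (split-1 (z k)))
          (*-congˡ (trans (sym (↑-+ q (2 + k * 6) (4 + k * 6))) (↑-≡ q (eq k))))) ⟩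
    𝟙 ∔ -𝟙 · q ↑ (6 + k * 12) ∎
    where
    u = 𝟙 ∔ -𝟙 · y k
    v = 𝟙 ∔ -𝟙 · z k
    eq : ∀ k → (2 + k * 6) + (4 + k * 6) ≡ 6 + k * 12
    eq = ℕSolver.solve-∀

  X-product : P⁻ 6 2 · P⁻ 6 4 · X ≈ P⁻ 12 6
  X-product = begin
    P⁻ 6 2 · P⁻ 6 4 · X
      ≈⟨ *-congʳ (∏-· t₂ t₄) ⟨
    ∏ (λ k → (𝟙 ∔ -𝟙 · y k) · (𝟙 ∔ -𝟙 · z k)) · X
      ≈⟨ ∏-· (tame-· t₂ t₄) g-tame ⟨
    ∏ (λ k → (𝟙 ∔ -𝟙 · y k) · (𝟙 ∔ -𝟙 · z k) · g k)
      ≈⟨ ∏-cong g-factor ⟩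
    P⁻ 12 6 ∎
    where
    t₂ = Products.factor-tame q₁ -𝟙 6 2
    t₄ = Products.factor-tame q₁ -𝟙 6 4

  X-quotient : X · (f₂ · f₁₂) ≈ f₆ ↑ 2
  X-quotient = begin
    X · (f₂ · f₁₂)
      ≈⟨ *-congˡ (*-congʳ (f-third 2)) ⟩
    X · (P⁻ 6 2 · P⁻ 6 4 · f₆ · f₁₂)
      ≈⟨ ·-solve 4 (λ x p f l → x ⊕ ((p ⊕ f) ⊕ l) ⊜ ((p ⊕ x) ⊕ l) ⊕ (f ⊕ id)) refl X
          (P⁻ 6 2 · P⁻ 6 4) f₆ f₁₂ ⟩
    P⁻ 6 2 · P⁻ 6 4 · X · f₁₂ · (f₆ · 𝟙)
      ≈⟨ *-congʳ (trans (*-congʳ X-product) (sym (f-halve 6))) ⟩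
    f₆ ↑ 2 ∎

  g-signed : ∀ k → Signed 1ℤ (g k)
  g-signed k = signed-∔ (signed-geo (y₁ k) y-signed) (signed-· z-signed (signed-geo (z₁ k) z-signed))
    where
    y-signed : Signed 1ℤ (y k)
    y-signed = signed-q↑ (2 + k * 6) (subst (λ e → Sign 1ℤ e 1ℤ) (≡.sym (multiple 1 3 k 2))
        (sign⁺ (1 + k * 3)))
    z-signed : Signed 1ℤ (z k)
    z-signed = signed-q↑ (4 + k * 6) (subst (λ e → Sign 1ℤ e 1ℤ) (≡.sym (multiple 2 3 k 2))
        (sign⁺ (2 + k * 3)))

  X-signed : Signed 1ℤ X
  X-signed = signed-∏ g-signed

  -- The first factor is 1/(1 - q²) + q⁴/(1 - q⁴). Its first summand times the other factors is
  -- positive at all even indices, and the second only adds nonnegative terms.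
  X-positive : ∀ n → 0ℤ < X (n * 2)
  X-positive n = strictSign-even n (subst (StrictSign 1ℤ (n * 2)) (≡.sym (at X≈ (n * 2) tt))
    (strictlySigned-∔ (strictlySigned⁺ (geo-multiple X′ (y₁ 0)) (1>0 X′-constant) X′-signed)
        rest-signed (n * 2)))
    where
    X′ rest : PowerSeries
    X′ = ∏ (g ∘ suc)
    rest = z 0 · geo (z 0) · X′
    X′-signed : Signed 1ℤ X′
    X′-signed = signed-∏ (g-signed ∘ suc)
    rest-signed : Signed 1ℤ rest
    rest-signed = signed-· (signed-· (signed-q↑ 4 (sign⁺ 2))
        (signed-geo (z₁ 0) (signed-q↑ 4 (sign⁺ 2)))) X′-signed
    X≈ : X ≈ geo (y 0) · X′ ∔ rest
    X≈ = trans (∏-head g-tame) (distribʳ _ _ _)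
    X-constant : X 0 ≡ 1ℤ
    X-constant = constant-1 X-quotient (units {f₂} {f₁₂} ≡.refl ≡.refl) (unit-↑ {f₆} 2 ≡.refl)
    X′-constant : (geo (y 0) · X′) 0 ≡ 1ℤ
    X′-constant = ≡.trans (≡.sym (≡.trans (coeff-∔ (geo (y 0) · X′) rest 0)
      (≡.trans (cong (λ c → (geo (y 0) · X′) 0 ℤ.+ c)
          (at (ord-·ˡ X′ (ord-·ˡ (geo (z 0)) (z₁ 0))) 0 (s≤s z≤n))) (ℤ.+-identityʳ _))))
      (≡.trans (≡.sym (at X≈ 0 tt)) X-constant)

-- f₂f₁₂³/f₄⁴
module OddA where

  -- c is (1 + q²) Y: the factor 1 - q² and one factor 1/(1 - q⁴) have been cancelled against 1 +
  -- q², which leaves a product whose sign is visible.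
  Y c : PowerSeries
  Y = P⁻ 4 2 · (P⁻¹ 12 4 · P⁻¹ 12 8) ↑ 3
  c = P⁻ 4 6 · (P⁻¹ 12 16 · P⁻¹ 12 8) · (P⁻¹ 12 4 · P⁻¹ 12 8) ↑ 2

  private
    I₄₈ : PowerSeries
    I₄₈ = P⁻¹ 12 4 · P⁻¹ 12 8

  Y-quotient : Y · f₄ ↑ 4 ≈ f₂ · f₁₂ ↑ 3
  Y-quotient = begin
    P⁻ 4 2 · I₄₈ ↑ 3 · f₄ ↑ 4
      ≈⟨ ·-solve 3 (λ p i d → (p ⊕ i ⋆ 3) ⊕ d ⋆ 4 ⊜ (p ⊕ d) ⊕ (i ⊕ d) ⋆ 3) refl (P⁻ 4 2) I₄₈ f₄ ⟩
    P⁻ 4 2 · f₄ · (I₄₈ · f₄) ↑ 3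
      ≈⟨ *-cong (sym (f-halve 2)) (↑-cong 3 I₄₈-f₄) ⟩
    f₂ · f₁₂ ↑ 3 ∎
    where
    I₄₈-f₄ : I₄₈ · f₄ ≈ f₁₂
    I₄₈-f₄ = begin
      I₄₈ · f₄
        ≈⟨ *-congˡ (f-third 4) ⟩
      P⁻¹ 12 4 · P⁻¹ 12 8 · (P⁻ 12 4 · P⁻ 12 8 · f₁₂)
        ≈⟨ ·-solve 5 (λ i j p r l → (i ⊕ j) ⊕ ((p ⊕ r) ⊕ l) ⊜ ((p ⊕ i) ⊕ (r ⊕ j)) ⊕ l) refl
            (P⁻¹ 12 4) (P⁻¹ 12 8) (P⁻ 12 4) (P⁻ 12 8) f₁₂ ⟩
      (P⁻ 12 4 · P⁻¹ 12 4) · (P⁻ 12 8 · P⁻¹ 12 8) · f₁₂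
        ≈⟨ *-congʳ (trans (*-cong (P⁻-inverse 12 4) (P⁻-inverse 12 8)) (*-identityˡ 𝟙)) ⟩
      𝟙 · f₁₂
        ≈⟨ *-identityˡ f₁₂ ⟩
      f₁₂ ∎

  -- (1 + q²)(1 - q²)/(1 - q⁴) = 1
  step : Y ≈ c ∔ -𝟙 · (q ↑ 2 · Y)
  step = sym (begin
    c ∔ -𝟙 · (q ↑ 2 · Y)
      ≈⟨ +-cong 1+q² (*-assoc _ _ _) ⟨
    (𝟙 ∔ q ↑ 2) · Y ∔ -𝟙 · q ↑ 2 · Y
      ≈⟨ distribʳ _ _ _ ⟨
    (𝟙 ∔ q ↑ 2 ∔ -𝟙 · q ↑ 2) · Y
      ≈⟨ *-congʳ (trans (+-assoc _ _ _) (trans (+-congˡ (+-comm _ _))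
          (trans (sym (+-assoc _ _ _)) (sym (split-1 (q ↑ 2)))))) ⟩
    𝟙 · Y
      ≈⟨ *-identityˡ Y ⟩
    Y ∎)
    where
    u v : PowerSeries
    u = 𝟙 ∔ -𝟙 · q ↑ 2
    v = 𝟙 ∔ q ↑ 2
    v·u : v · u ≈ 𝟙 ∔ -𝟙 · q ↑ 4
    v·u = begin
      v · u
        ≈⟨ trans (distribʳ _ _ _) (+-cong (*-identityˡ u)
            (trans (distribˡ _ _ _) (+-congʳ (*-identityʳ _)))) ⟩
      u ∔ (q ↑ 2 ∔ q ↑ 2 · (-𝟙 · q ↑ 2))
        ≈⟨ trans (sym (+-assoc _ _ _)) (+-congʳ (sym (split-1 (q ↑ 2)))) ⟩
      𝟙 ∔ q ↑ 2 · (-𝟙 · q ↑ 2)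
        ≈⟨ +-congˡ (trans (·-solve 2 (λ y m → y ⊕ (m ⊕ y) ⊜ m ⊕ (y ⊕ y)) refl (q ↑ 2) -𝟙)
            (*-congˡ (sym (↑-+ q 2 2)))) ⟩
      𝟙 ∔ -𝟙 · q ↑ 4 ∎
    1+q² : v · Y ≈ c
    1+q² = begin
      v · (P⁻ 4 2 · (P⁻¹ 12 4 · P⁻¹ 12 8) ↑ 3)
        ≈⟨ *-congˡ (*-cong (Products.P-head q₁ -𝟙 4 2) (*-congʳ (*-congʳ (P⁻¹-head 12 4)))) ⟩
      v · (u · P⁻ 4 6 · (geo (q ↑ 4) · P⁻¹ 12 16 · P⁻¹ 12 8 · I₄₈ ↑ 2))
        ≈⟨ ·-solve 7 (λ v u p g i j k → v ⊕ ((u ⊕ p) ⊕ (((g ⊕ i) ⊕ j) ⊕ k)) ⊜ ((v ⊕ u) ⊕ g) ⊕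
            ((p ⊕ (i ⊕ j)) ⊕ k))
             refl v u (P⁻ 4 6) (geo (q ↑ 4)) (P⁻¹ 12 16) (P⁻¹ 12 8) (I₄₈ ↑ 2) ⟩
      v · u · geo (q ↑ 4) · c
        ≈⟨ *-congʳ (trans (*-congʳ v·u) (geo-inverse (ord-q 4 0 0))) ⟩
      𝟙 · c
        ≈⟨ *-identityˡ c ⟩
      c ∎

  I₄₈-signed : Signed -1ℤ I₄₈
  I₄₈-signed = signed-· (signed⁻ 3 1) (signed⁻ 3 2)

  Y-signed : Signed -1ℤ Y
  Y-signed = signed-· (signed⁻′ 1 0) (signed-↑ 3 I₄₈-signed)

  c-signed : Signed -1ℤ c
  c-signed = signed-· (signed-· (signed⁻′ 1 1) (signed-· (signed⁻ 3 4) (signed⁻ 3 2))) (signed-↑ 2 I₄₈-signed)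

  Y-constant : Y 0 ≡ 1ℤ
  Y-constant = constant-1 Y-quotient (unit-↑ {f₄} 4 ≡.refl) (units {f₂} ≡.refl (unit-↑ {f₁₂} 3 ≡.refl))

  Y-strictlySigned : StrictlySigned -1ℤ Y
  Y-strictlySigned = strictlySigned⁻ step (1>0 Y-constant) c-signed

-- f₂f₆f₁₂²/f₄⁵
module OddB where

  -- h = f₆/(f₄f₁₂) is itself signed, so multiplying by it carries the recurrence of `OddA.Y` over
  -- to this quotient.
  h Y : PowerSeries
  h = P⁻ 12 6 · P⁻¹ 4 4
  Y = OddA.Y · h

  h-quotient : h · (f₄ · f₁₂) ≈ f₆
  h-quotient = begin
    P⁻ 12 6 · P⁻¹ 4 4 · (f₄ · f₁₂)
      ≈⟨ ·-solve 4 (λ p i d l → (p ⊕ i) ⊕ (d ⊕ l) ⊜ (d ⊕ i) ⊕ (p ⊕ l)) refl (P⁻ 12 6) (P⁻¹ 4 4) f₄ f₁₂ ⟩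
    f₄ · P⁻¹ 4 4 · (P⁻ 12 6 · f₁₂)
      ≈⟨ *-cong (trans (*-congʳ (sym (F≈f 4))) (P⁻-inverse 4 4)) (sym (f-halve 6)) ⟩
    𝟙 · f₆
      ≈⟨ *-identityˡ f₆ ⟩
    f₆ ∎

  Y-quotient : Y · f₄ ↑ 5 ≈ f₂ · f₆ · f₁₂ ↑ 2
  Y-quotient = cancel {f₁₂} ≡.refl (begin
    f₁₂ · (OddA.Y · h · f₄ ↑ 5)
      ≈⟨ ·-solve 4 (λ l y h d → l ⊕ ((y ⊕ h) ⊕ d ⋆ 5) ⊜ (y ⊕ d ⋆ 4) ⊕ (h ⊕ (d ⊕ l))) refl f₁₂ OddA.Y h f₄ ⟩
    OddA.Y · f₄ ↑ 4 · (h · (f₄ · f₁₂))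
      ≈⟨ *-cong OddA.Y-quotient h-quotient ⟩
    f₂ · f₁₂ ↑ 3 · f₆
      ≈⟨ ·-solve 3 (λ b f l → (b ⊕ l ⋆ 3) ⊕ f ⊜ l ⊕ ((b ⊕ f) ⊕ l ⋆ 2)) refl f₂ f₆ f₁₂ ⟩
    f₁₂ · (f₂ · f₆ · f₁₂ ↑ 2) ∎)

  step : Y ≈ OddA.c · h ∔ -𝟙 · (q ↑ 2 · Y)
  step = trans (*-congʳ OddA.step) (trans (distribʳ _ _ _)
      (+-congˡ (trans (*-assoc _ _ _) (*-congˡ (*-assoc _ _ _)))))

  h-signed : Signed -1ℤ h
  h-signed = signed-· (signed⁻′ 3 1) (signed⁻ 1 1)

  Y-signed : Signed -1ℤ Y
  Y-signed = signed-· OddA.Y-signed h-signed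

  Y-strictlySigned : StrictlySigned -1ℤ Y
  Y-strictlySigned = strictlySigned⁻ step (1>0 Y-constant) (signed-· OddA.c-signed h-signed)
    where
    Y-constant : Y 0 ≡ 1ℤ
    Y-constant = constant-1 Y-quotient (unit-↑ {f₄} 5 ≡.refl)
        (units {f₂ · f₆} (units {f₂} {f₆} ≡.refl ≡.refl) (unit-↑ {f₁₂} 2 ≡.refl))

-- f₆³/(f₂f₄f₁₂²) = f₈³/(f₄³f₂₄) + q² f₂₄³/(f₄f₈f₁₂²)
module EvenB where

  -- The f_j are split until the numerators cancel and only reciprocals remain. In X₂ the factor
  -- with the head 1/(1 - q⁴) stands apart because it drives the recurrence.
  X₁ X₂ X : PowerSeries
  X₁ = P⁻¹ 8 4 ↑ 3 · P⁻¹ 24 24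
  X₂ = P⁻¹ 12 4 · (P⁻¹ 12 8 · P⁻¹ 24 12 ↑ 3 · (P⁻¹ 24 8 · P⁻¹ 24 16) · P⁻¹ 24 24)
  X  = X₁ ∔ q ↑ 2 · X₂

  private
    f₂₄-inverse : f₂₄ · P⁻¹ 24 24 ≈ 𝟙
    f₂₄-inverse = trans (*-congʳ (sym (F≈f 24))) (P⁻-inverse 24 24)

  X₁-quotient : X₁ · (f₄ ↑ 3 · f₂₄) ≈ f₈ ↑ 3
  X₁-quotient = begin
    P⁻¹ 8 4 ↑ 3 · P⁻¹ 24 24 · (f₄ ↑ 3 · f₂₄)
      ≈⟨ *-congˡ (*-congʳ (↑-cong 3 (f-halve 4))) ⟩
    P⁻¹ 8 4 ↑ 3 · P⁻¹ 24 24 · ((P⁻ 8 4 · f₈) ↑ 3 · f₂₄)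
      ≈⟨ ·-solve 5 (λ i j p e l → (i ⋆ 3 ⊕ j) ⊕ ((p ⊕ e) ⋆ 3 ⊕ l) ⊜ ((p ⊕ i) ⋆ 3 ⊕ (l ⊕ j)) ⊕ e ⋆ 3) refl
           (P⁻¹ 8 4) (P⁻¹ 24 24) (P⁻ 8 4) f₈ f₂₄ ⟩
    (P⁻ 8 4 · P⁻¹ 8 4) ↑ 3 · (f₂₄ · P⁻¹ 24 24) · f₈ ↑ 3
      ≈⟨ *-congʳ (trans (*-cong (trans (↑-cong 3 (P⁻-inverse 8 4)) (𝟙↑ 3)) f₂₄-inverse) (*-identityˡ 𝟙)) ⟩
    𝟙 · f₈ ↑ 3
      ≈⟨ *-identityˡ _ ⟩
    f₈ ↑ 3 ∎

  X₂-quotient : X₂ · (f₄ · f₈ · f₁₂ ↑ 2) ≈ f₂₄ ↑ 3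
  X₂-quotient = begin
    X₂ · (f₄ · f₈ · f₁₂ ↑ 2)
      ≈⟨ *-congˡ (*-congʳ (*-cong (f-third 4) (f-third 8))) ⟩
    X₂ · (P⁻ 12 4 · P⁻ 12 8 · f₁₂ · (P⁻ 24 8 · P⁻ 24 16 · f₂₄) · f₁₂ ↑ 2)
      ≈⟨ *-congˡ (·-solve 4 (λ p l r e → ((p ⊕ l) ⊕ (r ⊕ e)) ⊕ l ⋆ 2 ⊜ ((p ⊕ l ⋆ 3) ⊕ r) ⊕ e) refl
          (P⁻ 12 4 · P⁻ 12 8) f₁₂ (P⁻ 24 8 · P⁻ 24 16) f₂₄) ⟩
    X₂ · (P⁻ 12 4 · P⁻ 12 8 · f₁₂ ↑ 3 · (P⁻ 24 8 · P⁻ 24 16) · f₂₄)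
      ≈⟨ *-congˡ (*-congʳ (*-congʳ (*-congˡ (↑-cong 3 (f-halve 12))))) ⟩
    X₂ · (P⁻ 12 4 · P⁻ 12 8 · (P⁻ 24 12 · f₂₄) ↑ 3 · (P⁻ 24 8 · P⁻ 24 16) · f₂₄)
      ≈⟨ ·-solve 12 (λ i₁ i₂ i₃ i₄ i₅ i₆ p₁ p₂ p₃ p₄ p₅ e →
           (i₁ ⊕ (((i₂ ⊕ i₃ ⋆ 3) ⊕ (i₄ ⊕ i₅)) ⊕ i₆)) ⊕ ((((p₁ ⊕ p₂) ⊕ (p₃ ⊕ e) ⋆ 3) ⊕ (p₄ ⊕ p₅)) ⊕ e) ⊜
           (((p₁ ⊕ i₁) ⊕ ((p₂ ⊕ i₂) ⊕ (p₃ ⊕ i₃) ⋆ 3)) ⊕ ((p₄ ⊕ i₄) ⊕ ((p₅ ⊕ i₅) ⊕ (e ⊕ i₆)))) ⊕ e ⋆ 3)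
           refl (P⁻¹ 12 4) (P⁻¹ 12 8) (P⁻¹ 24 12) (P⁻¹ 24 8) (P⁻¹ 24 16) (P⁻¹ 24 24)
                (P⁻ 12 4) (P⁻ 12 8) (P⁻ 24 12) (P⁻ 24 8) (P⁻ 24 16) f₂₄ ⟩
    ((P⁻ 12 4 · P⁻¹ 12 4) · ((P⁻ 12 8 · P⁻¹ 12 8) · (P⁻ 24 12 · P⁻¹ 24 12) ↑ 3))
      · ((P⁻ 24 8 · P⁻¹ 24 8) · ((P⁻ 24 16 · P⁻¹ 24 16) · (f₂₄ · P⁻¹ 24 24))) · f₂₄ ↑ 3
      ≈⟨ *-congʳ (*-cong (*-cong (P⁻-inverse 12 4) (*-cong (P⁻-inverse 12 8) (↑-cong 3 (P⁻-inverse 24 12))))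
           (*-cong (P⁻-inverse 24 8) (*-cong (P⁻-inverse 24 16) f₂₄-inverse))) ⟩
    (𝟙 · (𝟙 · 𝟙 ↑ 3)) · (𝟙 · (𝟙 · 𝟙)) · f₂₄ ↑ 3
      ≈⟨ ·-solve 1 (λ e → ((id ⊕ (id ⊕ id ⋆ 3)) ⊕ (id ⊕ (id ⊕ id))) ⊕ e ⊜ e) refl (f₂₄ ↑ 3) ⟩
    f₂₄ ↑ 3 ∎

  -- Multiplied by u = f₄²f₈f₂₄ this is `dissection₂`, the dissection of f₆³/f₂ in the variable q².
  X-quotient : X · (f₂ · f₁₂ ↑ 2 · f₄) ≈ f₆ ↑ 3
  X-quotient = cancel {u} (units {f₄ ↑ 2 · f₂₄} (units {f₄ ↑ 2} (unit-↑ {f₄} 2 ≡.refl) ≡.refl) ≡.refl) (begin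
    u · (X · w)
      ≈⟨ trans (sym (*-assoc _ _ _)) (trans (*-congʳ (*-comm u X)) (trans (*-assoc _ _ _) (distribʳ _ _ _))) ⟩
    X₁ · (u · w) ∔ q ↑ 2 · X₂ · (u · w)
      ≈⟨ +-cong
           (·-solve 6 (λ x b d e l m → x ⊕ (((d ⋆ 2 ⊕ m) ⊕ e) ⊕ ((b ⊕ l ⋆ 2) ⊕ d)) ⊜
               (x ⊕ (d ⋆ 3 ⊕ m)) ⊕ (b ⊕ (e ⊕ l ⋆ 2)))
              refl X₁ f₂ f₄ f₈ f₁₂ f₂₄)
           (·-solve 7 (λ r x b d e l m → (r ⊕ x) ⊕ (((d ⋆ 2 ⊕ m) ⊕ e) ⊕ ((b ⊕ l ⋆ 2) ⊕ d)) ⊜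
               (x ⊕ ((d ⊕ e) ⊕ l ⋆ 2)) ⊕ (b ⊕ (r ⊕ (d ⋆ 2 ⊕ m))))
              refl (q ↑ 2) X₂ f₂ f₄ f₈ f₁₂ f₂₄) ⟩
    X₁ · (f₄ ↑ 3 · f₂₄) · (f₂ · (f₈ · f₁₂ ↑ 2)) ∔ X₂ · (f₄ · f₈ · f₁₂ ↑ 2) · (f₂ · (q ↑ 2 · (f₄ ↑ 2 · f₂₄)))
      ≈⟨ +-cong (*-congʳ X₁-quotient) (*-congʳ X₂-quotient) ⟩
    f₈ ↑ 3 · (f₂ · (f₈ · f₁₂ ↑ 2)) ∔ f₂₄ ↑ 3 · (f₂ · (q ↑ 2 · (f₄ ↑ 2 · f₂₄)))
      ≈⟨ +-cong (·-solve 3 (λ b e l → e ⋆ 3 ⊕ (b ⊕ (e ⊕ l ⋆ 2)) ⊜ b ⊕ (e ⋆ 4 ⊕ l ⋆ 2)) refl f₂ f₈ f₁₂)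
                (·-solve 4 (λ r b d m → m ⋆ 3 ⊕ (b ⊕ (r ⊕ (d ⋆ 2 ⊕ m))) ⊜ b ⊕ (r ⊕ (m ⋆ 4 ⊕ d ⋆ 2)))
                    refl (q ↑ 2) f₂ f₄ f₂₄) ⟩
    f₂ · (f₈ ↑ 4 · f₁₂ ↑ 2) ∔ f₂ · (q ↑ 2 · (f₂₄ ↑ 4 · f₄ ↑ 2))
      ≈⟨ distribˡ _ _ _ ⟨
    f₂ · (f₈ ↑ 4 · f₁₂ ↑ 2 ∔ q ↑ 2 · (f₂₄ ↑ 4 · f₄ ↑ 2))
      ≈⟨ dissection₂ ⟨
    f₆ ↑ 3 · f₄ ↑ 2 · f₂₄ · f₈
      ≈⟨ ·-solve 4 (λ d e f m → ((f ⊕ d ⋆ 2) ⊕ m) ⊕ e ⊜ ((d ⋆ 2 ⊕ m) ⊕ e) ⊕ f) refl f₄ f₈ (f₆ ↑ 3) f₂₄ ⟩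
    u · f₆ ↑ 3 ∎)
    where
    u w : PowerSeries
    u = f₄ ↑ 2 · f₂₄ · f₈
    w = f₂ · f₁₂ ↑ 2 · f₄

  private
    J₁ J₂ : PowerSeries
    J₁ = P⁻¹ 8 4 ↑ 2 · P⁻¹ 24 24
    J₂ = P⁻¹ 12 8 · P⁻¹ 24 12 ↑ 3 · (P⁻¹ 24 8 · P⁻¹ 24 16) · P⁻¹ 24 24

    J₁-signed : Signed 1ℤ J₁
    J₁-signed = signed-· (signed-↑ 2 (signed⁺ 4 2)) (signed⁺ 12 12)

    J₂-signed : Signed 1ℤ J₂
    J₂-signed = signed-· (signed-· (signed-· (signed⁺ 6 4) (signed-↑ 3 (signed⁺ 12 6)))
      (signed-· (signed⁺ 12 4) (signed⁺ 12 8))) (signed⁺ 12 12)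

    q⁴ : Ord 1 (q ↑ 4)
    q⁴ = ord-q 4 0 0

  X₁-signed : Signed 1ℤ X₁
  X₁-signed = signed-· (signed-↑ 3 (signed⁺ 4 2)) (signed⁺ 12 12)

  X₂-signed : Signed 1ℤ X₂
  X₂-signed = signed-· (signed⁺ 6 2) J₂-signed

  qX₂-signed : Signed 1ℤ (q ↑ 2 · X₂)
  qX₂-signed = signed-· (signed-q↑ 2 (sign⁺ 1)) X₂-signed

  X-signed : Signed 1ℤ X
  X-signed = signed-∔ X₁-signed qX₂-signed

  grows : ∀ {a b c d} → a ≈ b · d → b ≈ geo (q ↑ 4) · c → a ≈ c · d ∔ q ↑ 4 · a
  grows {a} {b} {c} {d} p r = trans a≈ (trans (geo-multiple (c · d) q⁴) (+-congˡ (*-congˡ (sym a≈))))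
    where
    a≈ : a ≈ geo (q ↑ 4) · (c · d)
    a≈ = trans p (trans (*-congʳ r) (*-assoc _ _ _))

  X₁-positive : ∀ n → 0ℤ < X₁ (n * 4)
  X₁-positive = growth (grows (*-assoc _ _ _) (P⁻¹-head 8 4)) (1>0 X₁-constant)
      (signed-· (signed⁺ 4 6) J₁-signed)
    where
    X₁-constant : X₁ 0 ≡ 1ℤ
    X₁-constant = constant-1 X₁-quotient (units {f₄ ↑ 3} {f₂₄} (unit-↑ {f₄} 3 ≡.refl) ≡.refl)
        (unit-↑ {f₈} 3 ≡.refl)

  X₂-positive : ∀ n → 0ℤ < X₂ (n * 4)
  X₂-positive = growth (grows refl (P⁻¹-head 12 4)) (1>0 X₂-constant) (signed-· (signed⁺ 6 8) J₂-signed)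
    where
    X₂-constant : X₂ 0 ≡ 1ℤ
    X₂-constant = constant-1 X₂-quotient (units {f₄ · f₈} (units {f₄} {f₈} ≡.refl ≡.refl)
        (unit-↑ {f₁₂} 2 ≡.refl)) (unit-↑ {f₂₄} 3 ≡.refl)

  -- X₁ and X₂ are series in q⁴, so neither summand covers all even indices: strictness comes from
  -- X₁ at 4n and from q²X₂ at 4n + 2.
  X-positive-4 : ∀ n → 0ℤ < X (n * 4)
  X-positive-4 n = subst (0ℤ <_) (≡.sym (coeff-∔ X₁ (q ↑ 2 · X₂) (n * 4))) (ℤ.+-mono-<-≤ (X₁-positive n)
    (sign-even (n * 2) (subst (λ e → Sign 1ℤ e ((q ↑ 2 · X₂) (n * 4))) (eq n) (qX₂-signed (n * 4)))))
    where
    eq : ∀ n → n * 4 ≡ n * 2 * 2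
    eq = ℕSolver.solve-∀

  X-positive-4+2 : ∀ n → 0ℤ < X (2 + n * 4)
  X-positive-4+2 n = subst (0ℤ <_) (≡.sym (coeff-∔ X₁ (q ↑ 2 · X₂) (2 + n * 4))) (ℤ.+-mono-≤-<
    (sign-even (1 + n * 2) (subst (λ e → Sign 1ℤ e (X₁ (2 + n * 4))) (eq n) (X₁-signed (2 + n * 4))))
    (subst (0ℤ <_) (≡.sym (q↑2·-coeff X₂ (n * 4))) (X₂-positive n)))
    where
    eq : ∀ n → 2 + n * 4 ≡ (1 + n * 2) * 2
    eq = ℕSolver.solve-∀

  X-positive : ∀ n → 0ℤ < X (n * 2)
  X-positive n = subst (λ e → 0ℤ < X (e * 2)) (≡.sym (m≡m%n+[m/n]*n n 2)) (by-remainder (n % 2) (m%n<n n 2))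
    where
    k : ℕ
    k = n / 2
    eq₀ : ∀ k → k * 4 ≡ k * 2 * 2
    eq₀ = ℕSolver.solve-∀
    eq₁ : ∀ k → 2 + k * 4 ≡ (1 + k * 2) * 2
    eq₁ = ℕSolver.solve-∀
    by-remainder : ∀ r → r ℕ.< 2 → 0ℤ < X ((r + k * 2) * 2)
    by-remainder zero             _ = subst (λ e → 0ℤ < X e) (eq₀ k) (X-positive-4 k)
    by-remainder (suc zero)       _ = subst (λ e → 0ℤ < X e) (eq₁ k) (X-positive-4+2 k)
    by-remainder (suc (suc r)) (s≤s (s≤s ()))

-- Integer powers and the two sign patterns

^ₙ-↑ : ∀ a n → a ^ₙ n ≈ a ↑ n
^ₙ-↑ a zero    = refl
^ₙ-↑ a (suc n) = trans (⊛-· _ _) (*-congˡ (^ₙ-↑ a n))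

^-negative : ∀ {a} n → a 0 ≡ 1ℤ → a ^ -[1+ n ] · a ↑ suc n ≈ 𝟙
^-negative {a} n a₀ = trans (*-comm _ _) (trans (*-congˡ (^ₙ-↑ (inverse a) (suc n)))
  (trans (sym (↑-· a (inverse a) (suc n))) (trans (↑-cong (suc n) (·-inverse a a₀)) (𝟙↑ (suc n)))))

product₄ : ∀ t₁ t₂ t₃ t₄ → a (t₁ ∷ t₂ ∷ t₃ ∷ t₄ ∷ []) ≈ f₁ ^ t₁ · (f₂ ^ t₂ · (f₃ ^ t₃ · f₄ ^ t₄))
product₄ t₁ t₂ t₃ t₄ = trans (⊛-· _ _) (*-congˡ
    (trans (⊛-· _ _) (*-congˡ (trans (⊛-· _ _) (*-congˡ (trans (⊛-· _ _) (*-identityʳ _)))))))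

-- u = f₁f₂f₄⁴f₁₂ is a common denominator of the quotient and its two parts; times u the quotient
-- becomes the left side of `dissection₁`.
A-pattern : SignPattern (a (ℤ.- + 1 ∷ + 1 ∷ + 3 ∷ ℤ.- + 3 ∷ []))
A-pattern = signPattern (cancel {u} unit-u (begin
    u · A
      ≈⟨ *-congˡ (product₄ (ℤ.- + 1) (+ 1) (+ 3) (ℤ.- + 3)) ⟩
    u · (f₁ ^ (ℤ.- + 1) · (f₂ ^ₙ 1 · (f₃ ^ₙ 3 · f₄ ^ (ℤ.- + 3))))
      ≈⟨ *-congˡ (*-congˡ (*-cong (trans (^ₙ-↑ f₂ 1) (↑-1 f₂)) (*-congʳ (^ₙ-↑ f₃ 3)))) ⟩
    u · (f₁ ^ (ℤ.- + 1) · (f₂ · (f₃ ↑ 3 · f₄ ^ (ℤ.- + 3))))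
      ≈⟨ ·-solve 7 (λ a b c d l i j → (((a ⋆ 1 ⊕ d ⋆ 3) ⊕ (b ⊕ l)) ⊕ d) ⊕ (i ⊕ (b ⊕ (c ⊕ j))) ⊜
           (i ⊕ a ⋆ 1) ⊕ ((j ⊕ d ⋆ 3) ⊕ (((c ⊕ b ⋆ 2) ⊕ l) ⊕ d))) refl f₁ f₂ (f₃ ↑ 3) f₄ f₁₂
               (f₁ ^ (ℤ.- + 1)) (f₄ ^ (ℤ.- + 3)) ⟩
    f₁ ^ (ℤ.- + 1) · f₁ ↑ 1 · (f₄ ^ (ℤ.- + 3) · f₄ ↑ 3 · (f₃ ↑ 3 · f₂ ↑ 2 · f₁₂ · f₄))
      ≈⟨ trans (*-cong (^-negative {f₁} 0 ≡.refl)
          (trans (*-congʳ (^-negative {f₄} 2 ≡.refl)) (*-identityˡ _))) (*-identityˡ _) ⟩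
    f₃ ↑ 3 · f₂ ↑ 2 · f₁₂ · f₄
      ≈⟨ dissection₁ ⟩
    f₁ · (f₄ ↑ 4 · f₆ ↑ 2 ∔ q · (f₁₂ ↑ 4 · f₂ ↑ 2))
      ≈⟨ distribˡ _ _ _ ⟩
    f₁ · (f₄ ↑ 4 · f₆ ↑ 2) ∔ f₁ · (q · (f₁₂ ↑ 4 · f₂ ↑ 2))
      ≈⟨ +-cong
           (·-solve 3 (λ a d f → a ⊕ (d ⋆ 4 ⊕ f) ⊜ f ⊕ (a ⊕ d ⋆ 4)) refl f₁ f₄ (f₆ ↑ 2))
           (·-solve 4 (λ q a b l → a ⊕ (q ⊕ (l ⋆ 4 ⊕ b ⋆ 2)) ⊜ (b ⊕ l ⋆ 3) ⊕ (a ⊕ (q ⊕ (b ⊕ l))))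
               refl q f₁ f₂ f₁₂) ⟩
    f₆ ↑ 2 · (f₁ · f₄ ↑ 4) ∔ f₂ · f₁₂ ↑ 3 · (f₁ · (q · (f₂ · f₁₂)))
      ≈⟨ +-cong (*-congʳ EvenA.X-quotient) (*-congʳ OddA.Y-quotient) ⟨
    X · (f₂ · f₁₂) · (f₁ · f₄ ↑ 4) ∔ Y · f₄ ↑ 4 · (f₁ · (q · (f₂ · f₁₂)))
      ≈⟨ +-cong
           (·-solve 5 (λ x a b d l → (x ⊕ (b ⊕ l)) ⊕ (a ⊕ d ⋆ 4) ⊜ (((a ⋆ 1 ⊕ d ⋆ 3) ⊕ (b ⊕ l)) ⊕ d)
               ⊕ x) refl X f₁ f₂ f₄ f₁₂)
           (·-solve 6 (λ y q a b d l → (y ⊕ d ⋆ 4) ⊕ (a ⊕ (q ⊕ (b ⊕ l))) ⊜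
               (((a ⋆ 1 ⊕ d ⋆ 3) ⊕ (b ⊕ l)) ⊕ d) ⊕ (q ⊕ y)) refl Y q f₁ f₂ f₄ f₁₂) ⟩
    u · X ∔ u · (q · Y)
      ≈⟨ distribˡ _ _ _ ⟨
    u · (X ∔ q · Y) ∎))
  EvenA.X-signed EvenA.X-positive OddA.Y-signed OddA.Y-strictlySigned
  where
  A = a (ℤ.- + 1 ∷ + 1 ∷ + 3 ∷ ℤ.- + 3 ∷ [])
  X = EvenA.X
  Y = OddA.Y
  u = f₁ ↑ 1 · f₄ ↑ 3 · (f₂ · f₁₂) · f₄
  unit-u : u 0 ≡ 1ℤ
  unit-u = units {f₁ ↑ 1 · f₄ ↑ 3 · (f₂ · f₁₂)}
      (units {f₁ ↑ 1 · f₄ ↑ 3} (units {f₁ ↑ 1} (unit-↑ {f₁} 1 ≡.refl) (unit-↑ {f₄} 3 ≡.refl))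
      (units {f₂} {f₁₂} ≡.refl ≡.refl)) ≡.refl

B-pattern : SignPattern (a (ℤ.- + 3 ∷ + 8 ∷ + 1 ∷ ℤ.- + 7 ∷ []))
B-pattern = signPattern (cancel {u} unit-u (begin
    u · B
      ≈⟨ *-congˡ (product₄ (ℤ.- + 3) (+ 8) (+ 1) (ℤ.- + 7)) ⟩
    u · (f₁ ^ (ℤ.- + 3) · (f₂ ^ₙ 8 · (f₃ ^ₙ 1 · f₄ ^ (ℤ.- + 7))))
      ≈⟨ *-congˡ (*-congˡ (*-cong (^ₙ-↑ f₂ 8) (*-congʳ (trans (^ₙ-↑ f₃ 1) (↑-1 f₃))))) ⟩
    u · (f₁ ^ (ℤ.- + 3) · (f₂ ↑ 8 · (f₃ · f₄ ^ (ℤ.- + 7))))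
      ≈⟨ ·-solve 7 (λ a b c d l i j → ((a ⊕ d) ⊕ (b ⊕ l)) ⊕ (i ⊕ (b ⋆ 8 ⊕ (c ⊕ j))) ⊜
           (i ⊕ a) ⊕ ((j ⊕ d) ⊕ ((c ⊕ b ⋆ 9) ⊕ l))) refl (f₁ ↑ 3) f₂ f₃ (f₄ ↑ 7) (f₁₂ ↑ 2)
               (f₁ ^ (ℤ.- + 3)) (f₄ ^ (ℤ.- + 7)) ⟩
    f₁ ^ (ℤ.- + 3) · f₁ ↑ 3 · (f₄ ^ (ℤ.- + 7) · f₄ ↑ 7 · (f₃ · f₂ ↑ 9 · f₁₂ ↑ 2))
      ≈⟨ trans (*-cong (^-negative {f₁} 2 ≡.refl)
          (trans (*-congʳ (^-negative {f₄} 6 ≡.refl)) (*-identityˡ _))) (*-identityˡ _) ⟩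
    f₃ · f₂ ↑ 9 · f₁₂ ↑ 2
      ≈⟨ f₃/f₁³-dissection ⟩
    f₁ ↑ 3 · (f₄ ↑ 6 · f₆ ↑ 3 ∔ t · (q · (f₄ ↑ 2 · f₆ · f₁₂ ↑ 4 · f₂ ↑ 2)))
      ≈⟨ distribˡ _ _ _ ⟩
    f₁ ↑ 3 · (f₄ ↑ 6 · f₆ ↑ 3) ∔ f₁ ↑ 3 · (t · (q · (f₄ ↑ 2 · f₆ · f₁₂ ↑ 4 · f₂ ↑ 2)))
      ≈⟨ +-cong
           (·-solve 3 (λ a d f → a ⊕ (d ⊕ f) ⊜ f ⊕ (a ⊕ d)) refl (f₁ ↑ 3) (f₄ ↑ 6) (f₆ ↑ 3))
           (·-solve 7 (λ t q a b d f l → a ⊕ (t ⊕ (q ⊕ (((d ⊕ f) ⊕ l ⋆ 4) ⊕ b ⋆ 2))) ⊜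
              ((b ⊕ f) ⊕ l ⋆ 2) ⊕ (t ⊕ (q ⊕ (a ⊕ (d ⊕ (b ⊕ l ⋆ 2)))))) refl t q (f₁ ↑ 3) f₂ (f₄ ↑ 2) f₆ f₁₂) ⟩
    f₆ ↑ 3 · (f₁ ↑ 3 · f₄ ↑ 6) ∔ f₂ · f₆ · f₁₂ ↑ 2 · (t · (q · (f₁ ↑ 3 · (f₄ ↑ 2 · (f₂ · f₁₂ ↑ 2)))))
      ≈⟨ +-cong (*-congʳ EvenB.X-quotient) (*-congʳ OddB.Y-quotient) ⟨
    X · (f₂ · f₁₂ ↑ 2 · f₄) · (f₁ ↑ 3 · f₄ ↑ 6) ∔ OddB.Y · f₄ ↑ 5 ·
        (t · (q · (f₁ ↑ 3 · (f₄ ↑ 2 · (f₂ · f₁₂ ↑ 2)))))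
      ≈⟨ +-cong
           (·-solve 5 (λ x a b d l → (x ⊕ ((b ⊕ l) ⊕ d)) ⊕ (a ⊕ d ⋆ 6) ⊜ ((a ⊕ d ⋆ 7) ⊕ (b ⊕ l)) ⊕
               x) refl X (f₁ ↑ 3) f₂ f₄ (f₁₂ ↑ 2))
           (·-solve 7 (λ y t q a b d l → (y ⊕ d ⋆ 5) ⊕ (t ⊕ (q ⊕ (a ⊕ (d ⋆ 2 ⊕ (b ⊕ l))))) ⊜
              ((a ⊕ d ⋆ 7) ⊕ (b ⊕ l)) ⊕ (q ⊕ (t ⊕ y))) refl OddB.Y t q (f₁ ↑ 3) f₂ f₄ (f₁₂ ↑ 2)) ⟩
    u · X ∔ u · (q · (t · OddB.Y))
      ≈⟨ distribˡ _ _ _ ⟨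
    u · (X ∔ q · (t · OddB.Y))
      -- The multiple by 3 is rewritten as a sum of three copies, since the sign predicates are
      -- stable under addition.
      ≈⟨ *-congˡ (+-congˡ (*-congˡ triple)) ⟩
    u · (X ∔ q · Y) ∎))
  EvenB.X-signed EvenB.X-positive (signed-∔ OddB.Y-signed (signed-∔ OddB.Y-signed OddB.Y-signed))
  (strictlySigned-∔ OddB.Y-strictlySigned (signed-∔ OddB.Y-signed OddB.Y-signed))
  where
  B = a (ℤ.- + 3 ∷ + 8 ∷ + 1 ∷ ℤ.- + 7 ∷ [])
  X = EvenB.X
  Y = OddB.Y ∔ (OddB.Y ∔ OddB.Y)
  t = 𝟙 ∔ (𝟙 ∔ 𝟙)
  u = f₁ ↑ 3 · f₄ ↑ 7 · (f₂ · f₁₂ ↑ 2)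
  unit-u : u 0 ≡ 1ℤ
  unit-u = units {f₁ ↑ 3 · f₄ ↑ 7} (units {f₁ ↑ 3} (unit-↑ {f₁} 3 ≡.refl) (unit-↑ {f₄} 7 ≡.refl))
      (units {f₂} ≡.refl (unit-↑ {f₁₂} 2 ≡.refl))
  triple : t · OddB.Y ≈ Y
  triple = trans (distribʳ _ _ _) (+-cong (*-identityˡ _)
      (trans (distribʳ _ _ _) (+-cong (*-identityˡ _) (*-identityˡ _))))

theorem4p1 : ∀ (t₁ t₂ t₃ t₄ : ℤ) → (t₁ ∷ t₂ ∷ t₃ ∷ t₄ ∷ []) ∈ S₄ → ∀ (n : ℕ) →
    a (t₁ ∷ t₂ ∷ t₃ ∷ t₄ ∷ []) (2 * n) > 0ℤ
    × a (t₁ ∷ t₂ ∷ t₃ ∷ t₄ ∷ []) (4 * n + 1) > 0ℤ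
    × a (t₁ ∷ t₂ ∷ t₃ ∷ t₄ ∷ []) (4 * n + 3) < 0ℤ
theorem4p1 _ _ _ _ (here ≡.refl)         = A-pattern
theorem4p1 _ _ _ _ (there (here ≡.refl)) = B-pattern
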